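{- Let $G$ be a graph in $\mathcal{C}$, $H$ a hole in $G$ and $w$ a major vertex with respect to $H$. If $C$ is a connected component of $G\setminus N[w]$, then there exists a $w$-sector $P=x\dots y$ of $H$ (with ends $x$ and $y$) such that $N(C)\subseteq \{x,y\}\cup (N(w)\setminus V(H))$.
   Context: All graphs are finite and simple. A graph $G$ contains $H$ if some induced subgraph of $G$ is isomorphic to $H$; otherwise $G$ is $H$-free. A path means a chordless (induced) path, and its length is its number of edges. A hole is an induced cycle with at least 4 vertices. A square is a hole of length (number of vertices) 4. $N(w)$ is the set of neighbors of $w$, $N[w]=\{w\}\cup N(w)$, and for a set (or subgraph) $A$, $N(A)$ is the set of vertices outside $A$ with at least one neighbor in $A$; $N_H(u)$ is the set of neighbors of $u$ in $V(H)$. A pyramid is a graph made of three chordless paths $P_1=a\dots b_1$, $P_2=a\dots b_2$, $P_3=a\dots b_3$ of length at least 1, two of which have length at least 2, vertex-disjoint except at $a$, such that $b_1b_2b_3$ is a triangle and no edges exist between the paths except those of the triangle and the three edges incident with $a$. A theta is a graph made of three internally vertex-disjoint chordless paths $P_1=a\dots b$, $P_2=a\dots b$, $P_3=a\dots b$ of length at least 2 such that no edges exist between the paths except the three edges incident with $a$ and the three edges incident with $b$. A prism is a graph made of three vertex-disjoint chordless paths $P_1=a_1\dots b_1$, $P_2=a_2\dots b_2$, $P_3=a_3\dots b_3$ of length at least 1 such that $a_1a_2a_3$ and $b_1b_2b_3$ are triangles and no edges exist between the paths except those of the two triangles. A wheel is a graph made of a hole (the rim) and a vertex outside it (the center) that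 has at least three neighbors in the rim; an even wheel is a wheel whose center has an even number of neighbors in the rim. $\mathcal{C}$ denotes the class of (square, prism, pyramid, theta, even wheel)-free graphs. Let $H$ be a hole and $u$ a vertex not in $H$. The vertex $u$ is major w.r.t. $H$ if $N_H(u)$ is not included in a 3-vertex path of $H$. When $u$ has at least two neighbors in $H$, a $u$-sector of $H$ is a path of $H$ of length at least 1 whose ends are adjacent to $u$ and whose internal vertices are not. -}

module Defs where

open import Data.Fin using (Fin; zero; fromℕ; toℕ; _≟_)
open import Data.Fin.Subset using (Subset; _∈_; _∉_)
open import Data.List using (length; filter; allFin)
open import Data.Nat using (ℕ; suc; _+_; _≤_)
open import Data.Nat.Divisibility using (_∣_)
import Data.Nat.Properties as ℕ
open import Data.Product using (Σ-syntax; ∃-syntax; _×_; _,_)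
open import Data.Sum using (_⊎_; inj₁; inj₂; swap)
open import Function using (_⇔_; Injective)
open import Relation.Binary using (Rel; Decidable; Symmetric; Irreflexive)
open import Relation.Binary.Construct.Closure.ReflexiveTransitive using (Star)
open import Relation.Binary.PropositionalEquality using (_≡_; _≢_; refl)
open import Relation.Nullary using (¬_)
open import Relation.Nullary.Decidable using (_×-dec_; _⊎-dec_)
open import Relation.Unary using (Pred)
open import Level using (0ℓ)

-- Simple graphs on the vertex set Fin n.
record Graph (n : ℕ) : Set₁ where
  field
    Adj    : Rel (Fin n) 0ℓ
    adj?   : Decidable Adj
    symm   : Symmetric Adj
    irrefl : Irreflexive _≡_ Adj

open Graph public using (Adj; adj?)

-- An isomorphism from H onto an induced subgraph of G; thus "G contains H"
-- is H ↪ G.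
infix 4 _↪_
record _↪_ {m n} (H : Graph m) (G : Graph n) : Set where
  field
    at        : Fin m → Fin n
    injective : Injective _≡_ _≡_ at
    adjacent  : ∀ i j → Adj H i j ⇔ Adj G (at i) (at j)

open _↪_ public using (at)

infix 4 _On_
_On_ : ∀ {m n} {H : Graph m} {G : Graph n} → Fin n → H ↪ G → Set
v On e = ∃[ i ] at e i ≡ v

Free : (∀ {m} → Graph m → Set) → ∀ {n} → Graph n → Set₁
Free Is G = ∀ {m} (H : Graph m) → Is H → ¬ (H ↪ G)

-- The chordless path of length ℓ (ℓ edges, suc ℓ vertices).
pathGraph : (ℓ : ℕ) → Graph (suc ℓ)
pathGraph ℓ = record
  { Adj    = λ i j → Next i j ⊎ Next j i
  ; adj?   = λ i j → next? i j ⊎-dec next? j i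
  ; symm   = swap
  ; irrefl = λ { refl (inj₁ p) → ℕ.1+n≢n p ; refl (inj₂ p) → ℕ.1+n≢n p }
  }
  where
  Next : Rel (Fin (suc ℓ)) 0ℓ
  Next i j = suc (toℕ i) ≡ toℕ j
  next? : Decidable Next
  next? i j = suc (toℕ i) ℕ.≟ toℕ j

-- The cycle on 3 + m vertices; the second summand of Next closes it up.
cycleGraph : (m : ℕ) → Graph (3 + m)
cycleGraph m = record
  { Adj    = λ i j → Next i j ⊎ Next j i
  ; adj?   = λ i j → next? i j ⊎-dec next? j i
  ; symm   = swap
  ; irrefl = λ { refl (inj₁ p) → ¬next p ; refl (inj₂ p) → ¬next p }
  }
  where
  Next : Rel (Fin (3 + m)) 0ℓ
  Next i j = suc (toℕ i) ≡ toℕ j ⊎ (i ≡ fromℕ (2 + m) × j ≡ zero)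
  next? : Decidable Next
  next? i j = (suc (toℕ i) ℕ.≟ toℕ j) ⊎-dec ((i ≟ fromℕ (2 + m)) ×-dec (j ≟ zero))
  ¬next : ∀ {i} → ¬ Next i i
  ¬next (inj₁ p)             = ℕ.1+n≢n p
  ¬next (inj₂ (refl , ()))

Path : ∀ {n} → Graph n → ℕ → Set
Path G ℓ = pathGraph ℓ ↪ G

first last : ∀ {n} {G : Graph n} {ℓ} → Path G ℓ → Fin n
first       P = at P zero
last {ℓ = ℓ} P = at P (fromℕ ℓ)

IsEnd : ∀ {ℓ} → Fin (suc ℓ) → Set
IsEnd {ℓ} x = x ≡ zero ⊎ x ≡ fromℕ ℓ

record Hole {n} (G : Graph n) : Set where
  field
    {extra} : ℕ

  cycle : Graph (4 + extra)
  cycle = cycleGraph (suc extra)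

  field
    embed : cycle ↪ G

open Hole public using (cycle; embed)

square : Graph 4
square = cycleGraph 1

------------------------------------------------------------------------
-- Three-path configurations.  In each record `span` says that the graph has
-- no vertex outside the three paths, and every edge of the graph is either
-- an edge of one of the (induced) paths or is governed by `cross`.

record IsPrism {n} (G : Graph n) : Set where
  field
    len       : Fin 3 → ℕ
    P         : (i : Fin 3) → Path G (len i)
    len≥1     : ∀ i → 1 ≤ len i
    disjoint  : ∀ {i j} → i ≢ j → ∀ x y → at (P i) x ≢ at (P j) y
    triangleᵃ : ∀ {i j} → i ≢ j → Adj G (first (P i)) (first (P j))
    triangleᵇ : ∀ {i j} → i ≢ j → Adj G (last (P i)) (last (P j))
    cross     : ∀ {i j} → i ≢ j → ∀ x y → Adj G (at (P i) x) (at (P j) y) →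
                (x ≡ zero × y ≡ zero) ⊎ (x ≡ fromℕ (len i) × y ≡ fromℕ (len j))
    span      : ∀ v → ∃[ i ] v On P i

-- The vertex a lies on all three paths, so an edge at a is an edge of one of
-- them; this is why `cross` only constrains vertices other than a.
record IsPyramid {n} (G : Graph n) : Set where
  field
    a        : Fin n
    len      : Fin 3 → ℕ
    P        : (i : Fin 3) → Path G (len i)
    from-a   : ∀ i → first (P i) ≡ a
    len≥1    : ∀ i → 1 ≤ len i
    two-long : ∃[ i ] ∃[ j ] i ≢ j × 2 ≤ len i × 2 ≤ len j
    disjoint : ∀ {i j} → i ≢ j → ∀ x y → at (P i) x ≡ at (P j) y →
               x ≡ zero × y ≡ zero
    triangle : ∀ {i j} → i ≢ j → Adj G (last (P i)) (last (P j))
    cross    : ∀ {i j} → i ≢ j → ∀ x y → x ≢ zero → y ≢ zero →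
               Adj G (at (P i) x) (at (P j) y) →
               x ≡ fromℕ (len i) × y ≡ fromℕ (len j)
    span     : ∀ v → ∃[ i ] v On P i

-- Likewise for edges at a or b.
record IsTheta {n} (G : Graph n) : Set where
  field
    a b      : Fin n
    len      : Fin 3 → ℕ
    P        : (i : Fin 3) → Path G (len i)
    from-a   : ∀ i → first (P i) ≡ a
    to-b     : ∀ i → last (P i) ≡ b
    len≥2    : ∀ i → 2 ≤ len i
    disjoint : ∀ {i j} → i ≢ j → ∀ x y → at (P i) x ≡ at (P j) y →
               IsEnd x × IsEnd y
    cross    : ∀ {i j} → i ≢ j → ∀ x y → ¬ IsEnd x → ¬ IsEnd y →
               ¬ Adj G (at (P i) x) (at (P j) y)
    span     : ∀ v → ∃[ i ] v On P i

rimDegree : ∀ {n} {G : Graph n} → Hole G → Fin n → ℕ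
rimDegree {G = G} H u = length (filter (λ i → adj? G u (at (embed H) i)) (allFin _))

record IsEvenWheel {n} (G : Graph n) : Set where
  field
    rim     : Hole G
    center  : Fin n
    outside : ¬ center On embed rim
    deg≥3   : 3 ≤ rimDegree rim center
    even    : 2 ∣ rimDegree rim center
    span    : ∀ v → v ≡ center ⊎ v On embed rim

record 𝒞 {n} (G : Graph n) : Set₁ where
  field
    square-free    : ¬ (square ↪ G)
    prism-free     : Free IsPrism G
    pyramid-free   : Free IsPyramid G
    theta-free     : Free IsTheta G
    evenWheel-free : Free IsEvenWheel G

------------------------------------------------------------------------

-- Paths of H are paths in the abstract cycle `cycle H`; a position i on H
-- stands for the vertex at (embed H) i of G.
record Major {n} {G : Graph n} (H : Hole G) (u : Fin n) : Set where
  field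
    outside : ¬ u On embed H
    spread  : ¬ (Σ[ Q ∈ Path (cycle H) 2 ]
                   (∀ i → Adj G u (at (embed H) i) → i On Q))

record Sector {n} {G : Graph n} (H : Hole G) (u : Fin n) : Set where
  field
    {len}    : ℕ
    len≥1    : 1 ≤ len
    path     : Path (cycle H) len
    x-adj    : Adj G u (at (embed H) (first path))
    y-adj    : Adj G u (at (embed H) (last path))
    interior : ∀ i → ¬ IsEnd i → ¬ Adj G u (at (embed H) (at path i))

  x y : Fin n
  x = at (embed H) (first path)
  y = at (embed H) (last path)

closedNbhd : ∀ {n} → Graph n → Fin n → Pred (Fin n) 0ℓ
closedNbhd G w v = v ≡ w ⊎ Adj G w v

-- N(C) for a vertex set C.
nbhd : ∀ {n} → Graph n → Subset n → Pred (Fin n) 0ℓ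
nbhd G C v = v ∉ C × ∃[ c ] c ∈ C × Adj G v c

-- C is (the vertex set of) a connected component of G ∖ X: the set of all
-- vertices joined to some given vertex outside X by a walk outside X.
IsComponentOf_∖_ : ∀ {n} (G : Graph n) (X : Pred (Fin n) 0ℓ) → Subset n → Set
IsComponentOf_∖_ G X C =
  ∃[ v ] ¬ X v × (∀ u → u ∈ C ⇔ Star (λ s t → ¬ X s × ¬ X t × Adj G s t) v u)

module Submission where

-- A walk outside N[w] touches only vertices of a single w-sector of H; applied to a walk through all of C
-- this is the theorem. In a shortest counterexample the walk minus its last vertex fits in a sector S₁ and
-- the walk minus its first vertex in a sector S₂ ≠ S₁. If S₁ and S₂ share an end y, rerouting H along the
-- walk gives a hole meeting N(w) in exactly the neighbours of w on H other than y; one of the two neighbour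
-- counts is even, which yields an even wheel or a theta. If S₁ and S₂ are disjoint, the attachments at the
-- ends of the walk give a theta, a pyramid, a prism, or again such a rerouting. The walk of a single vertex
-- q is the case of two nonadjacent centers w and q: a sector with q attached to its interior and the
-- rest of H form a theta or a pyramid unless q sees nothing else of H but the two vertices next to that sector,
-- and what remains is a rerouting, a square, or a vertex q with exactly four neighbours on H.
--
-- Cycles and paths are lists of vertices. The three paths of a theta, pyramid or prism are given as walks
-- through pairwise anticomplete lists and are shortened to chordless paths only when the forbidden graph is built.

-- A rerouting alone contradicts nothing: the parity argument needs two nonadjacent neighbours of
-- `w` that survive on the new hole. They come from majority: for every `w`-sector, `w` has a
-- neighbour on `H` that is neither in the sector nor next to it (`outside-meets`), and this
-- neighbour and the end of the sector that is kept form such a pair. A component may contain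
-- vertices of `H`, so the claim about walks concerns the vertices of `H` that lie on the walk or
-- are adjacent to it. A vertex of `H` on a walk that straddles two sectors would be touched by both
-- shorter walks, hence lie in both sectors and be a neighbour of `w`. So a vertex of `H` needs
-- separate treatment only as a walk of one vertex. Two disjoint sectors may still be joined by an
-- edge of `H`. A walk attached just to the ends of that edge gives no theta, but it fits in the
-- sector that the edge forms.

open import Defs
open import Data.Empty using (⊥; ⊥-elim)
open import Data.Fin using (Fin; zero; suc; fromℕ; inject₁; toℕ; _≟_)
import Data.Fin.Properties as Fin
open import Data.Fin.Subset using (Subset)
import Data.Fin.Subset as Subset
import Data.Fin.Subset.Properties as Subset
open import Data.List using (List; []; _∷_; [_]; _++_; length; lookup; filter; allFin; tabulate; reverse; deduplicate)
open import Data.List.Membership.Propositional using (_∈_; _∉_; find; lose)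
open import Data.List.Membership.Propositional.Properties using (∈-++⁺ˡ; ∈-++⁺ʳ; ∈-++⁻; ∈-∃++; ∈-lookup; ∈-allFin; ∈-deduplicate⁺; ∈-deduplicate⁻; ∈-tabulate⁺; ∈-tabulate⁻; ∈-filter⁺; ∈-filter⁻)
open import Data.List.Properties using (++-assoc; ++-identityʳ; unfold-reverse; reverse-++; reverse-involutive; ∷-injective; ∷ʳ-injective; length-++; filter-++; filter-none; filter-accept; tabulate-lookup)
open import Data.List.Relation.Binary.Subset.Propositional using (_⊆_)
open import Data.List.Relation.Binary.Subset.Propositional.Properties using (Any-resp-⊆; ⊆-refl; ∷⁺ʳ; ++⁺)
open import Data.List.Relation.Unary.All as All using (All; []; _∷_)
open import Data.List.Relation.Unary.AllPairs using ([]; _∷_)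
open import Data.List.Relation.Unary.Any as Any using (Any; here; there; any?)
open import Data.List.Relation.Unary.Any.Properties using (reverse⁺; reverse⁻; lookup-index)
open import Data.List.Relation.Unary.Linked as Linked using (Linked; []; [-]; _∷_)
open import Data.List.Relation.Unary.Unique.Propositional using (Unique)
open import Data.List.Relation.Unary.Unique.DecPropositional.Properties using (deduplicate-!)
open import Data.Nat using (ℕ; zero; suc; _+_; _≤_; z≤n; s≤s)
open import Data.Nat.Divisibility using (_∣_; divides)
import Data.Nat.Properties as ℕ
open import Data.Product using (Σ-syntax; ∃-syntax; _×_; _,_; proj₁; proj₂; map₂)
open import Data.Sum using (_⊎_; inj₁; inj₂; [_,_]′)
open import Function using (_∘_; _⇔_; mk⇔; Equivalence)
open import Relation.Binary.Construct.Closure.ReflexiveTransitive using (Star; ε; _◅_; _◅◅_)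
open import Relation.Binary.PropositionalEquality using (_≡_; _≢_; refl; sym; trans; cong; cong₂; subst; subst₂; ≢-sym; module ≡-Reasoning)
open import Relation.Nullary using (¬_; Dec; yes; no)
open import Relation.Nullary.Decidable using (_⊎-dec_; _×-dec_; _→-dec_; ¬?; decidable-stable)

-- Lists

module _ {ℓ} {A : Set ℓ} where

  snoc-view : ∀ (x : A) xs → ∃[ ys ] ∃[ z ] x ∷ xs ≡ ys ++ [ z ]
  snoc-view x []       = [] , x , refl
  snoc-view x (y ∷ xs) with snoc-view y xs
  ... | ys , z , eq = x ∷ ys , z , cong (x ∷_) eq

  snoc≢[] : ∀ (xs : List A) {z} → xs ++ [ z ] ≢ []
  snoc≢[] []      ()
  snoc≢[] (_ ∷ _) ()

  reverse-⊆ : ∀ (xs : List A) → reverse xs ⊆ xs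
  reverse-⊆ xs = reverse⁻

  ++-⊆ : ∀ {xs ys zs : List A} → xs ⊆ zs → ys ⊆ zs → xs ++ ys ⊆ zs
  ++-⊆ {xs} p q v∈ with ∈-++⁻ xs v∈
  ... | inj₁ v∈xs = p v∈xs
  ... | inj₂ v∈ys = q v∈ys

  ++-swap-⊆ : ∀ (xs : List A) {ys} → xs ++ ys ⊆ ys ++ xs
  ++-swap-⊆ xs {ys} = ++-⊆ (∈-++⁺ʳ ys) ∈-++⁺ˡ

  prefix-⊆-init : ∀ (xs : List A) {y ys zs z} → xs ++ y ∷ ys ≡ zs ++ [ z ] → xs ⊆ zs
  prefix-⊆-init (x ∷ [])      {zs = []} ()
  prefix-⊆-init (x ∷ x₁ ∷ xs) {zs = []} ()
  prefix-⊆-init (x ∷ xs) {zs = z ∷ zs} eq (here refl) = here (proj₁ (∷-injective eq))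
  prefix-⊆-init (x ∷ xs) {zs = z ∷ zs} eq (there v∈)  =
    there (prefix-⊆-init xs (proj₂ (∷-injective eq)) v∈)

  reverse-snoc : ∀ (xs : List A) z → reverse (xs ++ [ z ]) ≡ z ∷ reverse xs
  reverse-snoc xs z = reverse-++ xs [ z ]

  reverse-two : ∀ (x : A) I y R → reverse (x ∷ I ++ y ∷ R) ≡ reverse R ++ y ∷ reverse I ++ [ x ]
  reverse-two x I y R = begin
    reverse (x ∷ I ++ y ∷ R)                    ≡⟨ reverse-++ (x ∷ I) (y ∷ R) ⟩
    reverse (y ∷ R) ++ reverse (x ∷ I)          ≡⟨ cong₂ _++_ (unfold-reverse y R) (unfold-reverse x I) ⟩
    (reverse R ++ [ y ]) ++ reverse I ++ [ x ]  ≡⟨ ++-assoc (reverse R) [ y ] _ ⟩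
    reverse R ++ y ∷ reverse I ++ [ x ]         ∎
    where open ≡-Reasoning

  linked-++⁻ˡ : ∀ {r} {R : A → A → Set r} xs {ys} → Linked R (xs ++ ys) → Linked R xs
  linked-++⁻ˡ []           _       = []
  linked-++⁻ˡ (x ∷ [])     _       = [-]
  linked-++⁻ˡ (x ∷ y ∷ xs) (p ∷ l) = p ∷ linked-++⁻ˡ (y ∷ xs) l

  linked-++⁻ʳ : ∀ {r} {R : A → A → Set r} xs {ys} → Linked R (xs ++ ys) → Linked R ys
  linked-++⁻ʳ []       l = l
  linked-++⁻ʳ (x ∷ xs) l = linked-++⁻ʳ xs (Linked.tail l)

  linked-join : ∀ {r} {R : A → A → Set r} xs {y ys} →
                Linked R (xs ++ [ y ]) → Linked R (y ∷ ys) → Linked R (xs ++ y ∷ ys)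
  linked-join []            _       l = l
  linked-join (x ∷ [])      (p ∷ _) l = p ∷ l
  linked-join (x ∷ x₁ ∷ xs) (p ∷ k) l = p ∷ linked-join (x₁ ∷ xs) k l

  linked-reverse : ∀ {r} {R : A → A → Set r} → (∀ {x y} → R x y → R y x) →
                   ∀ {xs} → Linked R xs → Linked R (reverse xs)
  linked-reverse R-sym []  = []
  linked-reverse R-sym [-] = [-]
  linked-reverse {R = R} R-sym {x ∷ y ∷ xs} (p ∷ l)
    rewrite unfold-reverse x (y ∷ xs) | unfold-reverse y xs | ++-assoc (reverse xs) [ y ] [ x ] =
    linked-join (reverse xs)
      (subst (Linked R) (unfold-reverse y xs) (linked-reverse R-sym l)) (R-sym p ∷ [-])

  first-split : ∀ {p} {P : A → Set p} → (∀ x → Dec (P x)) → ∀ {xs} → Any P xs →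
                ∃[ ys ] ∃[ z ] ∃[ zs ] xs ≡ ys ++ z ∷ zs × P z × (∀ {v} → v ∈ ys → ¬ P v)
  first-split P? {x ∷ xs} a with P? x
  ... | yes px = [] , x , xs , refl , px , λ ()
  first-split P? {x ∷ xs} (here px) | no ¬px = ⊥-elim (¬px px)
  first-split P? {x ∷ xs} (there a) | no ¬px with first-split P? a
  ... | ys , z , zs , eq , pz , ¬p =
    x ∷ ys , z , zs , cong (x ∷_) eq , pz , λ { (here refl) → ¬px ; (there v∈) → ¬p v∈ }

  last-split : ∀ {p} {P : A → Set p} → (∀ x → Dec (P x)) → ∀ {xs} → Any P xs →
               ∃[ ys ] ∃[ z ] ∃[ zs ] xs ≡ ys ++ z ∷ zs × P z × (∀ {v} → v ∈ zs → ¬ P v)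
  last-split P? {x ∷ xs} a with any? P? xs
  ... | yes a′ with last-split P? a′
  ...   | ys , z , zs , eq , pz , ¬p = x ∷ ys , z , zs , cong (x ∷_) eq , pz , ¬p
  last-split P? {x ∷ xs} (here px) | no ¬a = [] , x , xs , refl , px , λ v∈ pv → ¬a (lose v∈ pv)
  last-split P? {x ∷ xs} (there a) | no ¬a = ⊥-elim (¬a a)

  unique-++-disjoint : ∀ (xs : List A) {ys v} → Unique (xs ++ ys) → v ∈ xs → v ∉ ys
  unique-++-disjoint (x ∷ xs) (p ∷ _) (here refl) j = All.lookup p (∈-++⁺ʳ xs j) refl
  unique-++-disjoint (x ∷ xs) (_ ∷ u) (there i)   j = unique-++-disjoint xs u i j

  tabulate-snoc : ∀ {m} (f : Fin (suc m) → A) → tabulate f ≡ tabulate (f ∘ inject₁) ++ [ f (fromℕ m) ]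
  tabulate-snoc {zero}  f = refl
  tabulate-snoc {suc m} f = cong (f zero ∷_) (tabulate-snoc (f ∘ suc))

  snoc-⊆-suffix : ∀ (xs : List A) {z} ys {v vs} → xs ++ [ z ] ≡ ys ++ v ∷ vs → z ∈ v ∷ vs
  snoc-⊆-suffix xs       []          eq = subst (_ ∈_) eq (∈-++⁺ʳ xs (here refl))
  snoc-⊆-suffix []       (y ∷ [])    ()
  snoc-⊆-suffix []       (y ∷ _ ∷ _) ()
  snoc-⊆-suffix (x ∷ xs) (y ∷ ys) eq = snoc-⊆-suffix xs ys (proj₂ (∷-injective eq))

  -- Serves to decide `Fits`. The property may depend on both sides of the split because a sector
  -- ends at the next bead in cyclic order.
  split? : ∀ {p} {P : List A → A → List A → Set p} → (∀ xs x ys → Dec (P xs x ys)) →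
           ∀ zs → Dec (∃[ xs ] ∃[ x ] ∃[ ys ] zs ≡ xs ++ x ∷ ys × P xs x ys)
  split? P? [] = no λ { ([] , _ , _ , () , _) ; (_ ∷ _ , _ , _ , () , _) }
  split? P? (z ∷ zs) with P? [] z zs | split? (λ xs → P? (z ∷ xs)) zs
  ... | yes p | _                             = yes ([] , z , zs , refl , p)
  ... | no _  | yes (xs , x , ys , refl , p)  = yes (z ∷ xs , x , ys , refl , p)
  ... | no ¬p | no ¬q = no λ { ([] , _ , _ , refl , p) → ¬p p ; (_ ∷ xs , x , ys , refl , p) → ¬q (xs , x , ys , refl , p) }

  compare-splits : ∀ (xs : List A) {x ys} xs′ {x′ ys′} → xs ++ x ∷ ys ≡ xs′ ++ x′ ∷ ys′ →
                   (xs ≡ xs′ × x ≡ x′ × ys ≡ ys′) ⊎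
                   (∃[ zs ] xs′ ≡ xs ++ x ∷ zs × ys ≡ zs ++ x′ ∷ ys′) ⊎
                   (∃[ zs ] xs ≡ xs′ ++ x′ ∷ zs × ys′ ≡ zs ++ x ∷ ys)
  compare-splits []       []        refl = inj₁ (refl , refl , refl)
  compare-splits []       (z ∷ xs′) refl = inj₂ (inj₁ (xs′ , refl , refl))
  compare-splits (z ∷ xs) []        refl = inj₂ (inj₂ (xs , refl , refl))
  compare-splits (z ∷ xs) (z′ ∷ xs′) eq with ∷-injective eq
  ... | refl , eq′ with compare-splits xs xs′ eq′
  ...   | inj₁ (refl , e)              = inj₁ (refl , e)
  ...   | inj₂ (inj₁ (zs , refl , e))  = inj₂ (inj₁ (zs , refl , e))
  ...   | inj₂ (inj₂ (zs , refl , e))  = inj₂ (inj₂ (zs , refl , e))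

-- Parity, factoring of embeddings, families of three

even-or-suc-even : ∀ m → 2 ∣ m ⊎ 2 ∣ suc m
even-or-suc-even zero    = inj₁ (divides 0 refl)
even-or-suc-even (suc m) with even-or-suc-even m
... | inj₁ (divides k eq) = inj₂ (divides (suc k) (cong (2 +_) eq))
... | inj₂ d              = inj₁ d

-- Serves two purposes: to lift paths and rims to an induced subgraph of `G`, and to read a path of
-- `G` inside `H` as a path of the abstract cycle that `Major` and `Sector` speak of.
factor : ∀ {j k n} {J : Graph j} {K : Graph k} {G : Graph n} (e : K ↪ G) (p : J ↪ G) →
         (∀ i → at p i On e) → Σ[ q ∈ J ↪ K ] (∀ i → at e (at q i) ≡ at p i)
factor {J = J} {K} {G} e p on = record
  { at        = λ i → proj₁ (on i)
  ; injective = λ {i} {j} eq → _↪_.injective p (trans (sym (proj₂ (on i))) (trans (cong (at e) eq) (proj₂ (on j))))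
  ; adjacent  = λ i j → mk⇔
      (λ q → Equivalence.from (_↪_.adjacent e _ _)
        (subst₂′ (sym (proj₂ (on i))) (sym (proj₂ (on j))) (Equivalence.to (_↪_.adjacent p i j) q)))
      (λ q → Equivalence.from (_↪_.adjacent p i j)
        (subst₂′ (proj₂ (on i)) (proj₂ (on j)) (Equivalence.to (_↪_.adjacent e _ _) q)))
  } , λ i → proj₂ (on i)
  where
  subst₂′ : ∀ {a b c d} → a ≡ b → c ≡ d → Adj G a c → Adj G b d
  subst₂′ refl refl x = x

pairwise : {R : Fin 3 → Fin 3 → Set} → (∀ {i j} → R i j → R j i) →
           R zero (suc zero) → R zero (suc (suc zero)) → R (suc zero) (suc (suc zero)) →
           ∀ {i j} → i ≢ j → R i j
pairwise s p q r {zero}          {zero}          ne = ⊥-elim (ne refl)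
pairwise s p q r {zero}          {suc zero}      ne = p
pairwise s p q r {zero}          {suc (suc zero)} ne = q
pairwise s p q r {suc zero}      {zero}          ne = s p
pairwise s p q r {suc zero}      {suc zero}      ne = ⊥-elim (ne refl)
pairwise s p q r {suc zero}      {suc (suc zero)} ne = r
pairwise s p q r {suc (suc zero)} {zero}          ne = s q
pairwise s p q r {suc (suc zero)} {suc zero}      ne = s r
pairwise s p q r {suc (suc zero)} {suc (suc zero)} ne = ⊥-elim (ne refl)

three : ∀ {ℓ} {A : Fin 3 → Set ℓ} → A zero → A (suc zero) → A (suc (suc zero)) → ∀ i → A i
three x y z zero           = x
three x y z (suc zero)     = y
three x y z (suc (suc zero)) = z

module _ {A : Set} where

  lookup-injective : ∀ {L : List A} → Unique L → ∀ {i j} → lookup L i ≡ lookup L j → i ≡ j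
  lookup-injective (_ ∷ _) {zero}  {zero}  _  = refl
  lookup-injective (p ∷ _) {zero}  {suc j} eq = ⊥-elim (All.lookup p (∈-lookup j) eq)
  lookup-injective (p ∷ _) {suc i} {zero}  eq = ⊥-elim (All.lookup p (∈-lookup i) (sym eq))
  lookup-injective (_ ∷ u) {suc i} {suc j} eq = cong suc (lookup-injective u eq)

  ∈-index : ∀ {L : List A} {v} → v ∈ L → ∃[ i ] lookup L i ≡ v
  ∈-index v∈ = Any.index v∈ , sym (lookup-index v∈)

  lookup-snoc : ∀ (N : List A) {b} (x : Fin (length (N ++ [ b ]))) →
                (suc x ≡ fromℕ (length (N ++ [ b ])) × lookup (N ++ [ b ]) x ≡ b) ⊎ lookup (N ++ [ b ]) x ∈ N
  lookup-snoc []      zero    = inj₁ (refl , refl)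
  lookup-snoc (m ∷ N) zero    = inj₂ (here refl)
  lookup-snoc (m ∷ N) (suc x) with lookup-snoc N x
  ... | inj₁ (eq , eq′) = inj₁ (cong suc eq , eq′)
  ... | inj₂ i          = inj₂ (there i)

  lookup-last : ∀ a (N : List A) b → lookup (a ∷ N ++ [ b ]) (fromℕ (length (N ++ [ b ]))) ≡ b
  lookup-last a []      b = refl
  lookup-last a (m ∷ N) b = lookup-last m N b

module _ {n : ℕ} (G : Graph n) where

  -- Chordless paths and cycles as lists

  open import Data.List.Membership.DecPropositional {A = Fin n} _≟_ public using (_∈?_)

  infix 4 _~_ _~?_ _∥_

  V : Set
  V = Fin n

  _~_ : V → V → Set
  _~_ = Adj G

  _~?_ : ∀ u v → Dec (u ~ v)
  _~?_ = adj? G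

  ~-sym : ∀ {u v} → u ~ v → v ~ u
  ~-sym = Graph.symm G

  ~-irrefl : ∀ {v} → ¬ v ~ v
  ~-irrefl = Graph.irrefl G refl

  ~⇒≢ : ∀ {u v} → u ~ v → u ≢ v
  ~⇒≢ p refl = ~-irrefl p

  ≁-sym : ∀ {u v} → ¬ u ~ v → ¬ v ~ u
  ≁-sym p = p ∘ ~-sym

  -- Disjointness is included, so `Chordless` needs no separate condition that the entries be
  -- distinct.
  _∥_ : List V → List V → Set
  A ∥ B = ∀ {a b} → a ∈ A → b ∈ B → a ≢ b × ¬ a ~ b

  ∥-sym : ∀ {A B} → A ∥ B → B ∥ A
  ∥-sym p b∈ a∈ = ≢-sym (proj₁ (p a∈ b∈)) , ≁-sym (proj₂ (p a∈ b∈))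

  ∥-mono : ∀ {A A′ B B′} → A ⊆ A′ → B ⊆ B′ → A′ ∥ B′ → A ∥ B
  ∥-mono i j p a∈ b∈ = p (i a∈) (j b∈)

  ∥-++ˡ : ∀ {A A′ B} → A ∥ B → A′ ∥ B → (A ++ A′) ∥ B
  ∥-++ˡ {A} p q a∈ b∈ with ∈-++⁻ A a∈
  ... | inj₁ i = p i b∈
  ... | inj₂ i = q i b∈

  ∥-++ʳ : ∀ {A B B′} → A ∥ B → A ∥ B′ → A ∥ (B ++ B′)
  ∥-++ʳ {B = B} p q a∈ b∈ with ∈-++⁻ B b∈
  ... | inj₁ i = p a∈ i
  ... | inj₂ i = q a∈ i

  ∥-∷ˡ : ∀ {a A B} → [ a ] ∥ B → A ∥ B → (a ∷ A) ∥ B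
  ∥-∷ˡ = ∥-++ˡ

  ∥-∷ʳ : ∀ {A b B} → A ∥ [ b ] → A ∥ B → A ∥ (b ∷ B)
  ∥-∷ʳ = ∥-++ʳ

  ∥₁ : ∀ {a b} → a ≢ b → ¬ a ~ b → [ a ] ∥ [ b ]
  ∥₁ p q (here refl) (here refl) = p , q

  data Chordless : List V → Set where
    []   : Chordless []
    [-]  : ∀ {v} → Chordless [ v ]
    link : ∀ {v u us} → v ~ u → [ v ] ∥ us → Chordless (u ∷ us) → Chordless (v ∷ u ∷ us)

  chordless-++⁻ʳ : ∀ A {B} → Chordless (A ++ B) → Chordless B
  chordless-++⁻ʳ []          c            = c
  chordless-++⁻ʳ (a ∷ []) {[]} _          = []
  chordless-++⁻ʳ (a ∷ []) {_ ∷ _} (link _ _ c) = c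
  chordless-++⁻ʳ (a ∷ a′ ∷ A) (link _ _ c) = chordless-++⁻ʳ (a′ ∷ A) c

  chordless-apart : ∀ A {m B} → Chordless (A ++ m ∷ B) → A ∥ B
  chordless-apart (a ∷ [])     (link p q c) (here refl) b∈ = q (here refl) b∈
  chordless-apart (a ∷ a′ ∷ A) (link p q c) (here refl) b∈ = q (here refl) (∈-++⁺ʳ A (there b∈))
  chordless-apart (a ∷ a′ ∷ A) (link p q c) (there i)   b∈ = chordless-apart (a′ ∷ A) c i b∈

  chordless-step : ∀ A {a b B} → Chordless (A ++ a ∷ b ∷ B) → a ~ b
  chordless-step []           (link p _ _) = p
  chordless-step (a ∷ [])     (link _ _ c) = chordless-step [] c
  chordless-step (a ∷ a′ ∷ A) (link _ _ c) = chordless-step (a′ ∷ A) c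

  chordless-join : ∀ A {a b B} → Chordless (A ++ [ a ]) → Chordless (b ∷ B) → a ~ b →
                   A ∥ (b ∷ B) → [ a ] ∥ B → Chordless (A ++ a ∷ b ∷ B)
  chordless-join []           _            d p _ r = link p r d
  chordless-join (a ∷ [])     (link s _ c) d p q r =
    link s (∥-mono ⊆-refl ⊆-refl q) (chordless-join [] c d p (λ ()) r)
  chordless-join (a ∷ a′ ∷ A) (link s t c) d p q r =
    link s (λ { (here refl) j → aux j }) (chordless-join (a′ ∷ A) c d p (q ∘ there) r)
    where
    aux : ∀ {v} → v ∈ A ++ _ ∷ _ ∷ _ → a ≢ v × ¬ a ~ v
    aux v∈ with ∈-++⁻ A v∈
    ... | inj₁ i           = t (here refl) (∈-++⁺ˡ i)
    ... | inj₂ (here refl) = t (here refl) (∈-++⁺ʳ A (here refl))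
    ... | inj₂ (there i)   = q (here refl) i

  chordless-reverse : ∀ {A} → Chordless A → Chordless (reverse A)
  chordless-reverse []  = []
  chordless-reverse [-] = [-]
  chordless-reverse {v ∷ u ∷ us} (link p q c)
    rewrite unfold-reverse v (u ∷ us) | unfold-reverse u us | ++-assoc (reverse us) [ u ] [ v ] =
    chordless-join (reverse us)
      (subst Chordless (unfold-reverse u us) (chordless-reverse c)) [-] (~-sym p)
      (∥-mono (reverse-⊆ us) ⊆-refl (∥-sym q)) (λ _ ())

  chordless⇒linked : ∀ {A} → Chordless A → Linked _~_ A
  chordless⇒linked []           = []
  chordless⇒linked [-]          = [-]
  chordless⇒linked (link p _ c) = p ∷ chordless⇒linked c

  chordless⇒unique : ∀ {A} → Chordless A → Unique A
  chordless⇒unique []           = []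
  chordless⇒unique [-]          = [] ∷ []
  chordless⇒unique (link p q c) =
    (~⇒≢ p ∷ All.tabulate (λ i → proj₁ (q (here refl) i))) ∷ chordless⇒unique c

  chordless-head∉ : ∀ {a A} → Chordless (a ∷ A) → a ∉ A
  chordless-head∉ (link p q c) (here refl) = ~-irrefl p
  chordless-head∉ (link p q c) (there i)   = proj₁ (q (here refl) i) refl

  -- The path is entered at the last neighbour of `a`, so no chord from `a` remains.
  shortcut-step : ∀ M {a b} → Chordless (M ++ [ b ]) → a ∉ M ++ [ b ] → Any (a ~_) (M ++ [ b ]) →
                  ∃[ N ] N ⊆ M × Chordless (a ∷ N ++ [ b ])
  shortcut-step [] c a∉ (here p) = [] , (λ ()) , link p (λ _ ()) [-]
  shortcut-step (m ∷ M) {a} {b} c a∉ nb with any? (a ~?_) (M ++ [ b ])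
  ... | yes nb′ with shortcut-step M (chordless-++⁻ʳ [ m ] c) (a∉ ∘ there) nb′
  ...   | N , i , d = N , there ∘ i , d
  shortcut-step (m ∷ M) {a} c a∉ (there nb) | no ¬nb = ⊥-elim (¬nb nb)
  shortcut-step (m ∷ M) {a} c a∉ (here p)   | no ¬nb =
    m ∷ M , ⊆-refl , link p (λ { (here refl) j → (λ { refl → a∉ (there j) }) , λ q → ¬nb (lose j q) }) c

  -- The walk may repeat vertices. If `a` recurs on the shortened rest of the walk, the part from
  -- that occurrence on is already the path; otherwise `shortcut-step` puts `a` in front.
  shortcut : ∀ a M b → Linked _~_ (a ∷ M ++ [ b ]) → a ≢ b → ∃[ N ] N ⊆ M × Chordless (a ∷ N ++ [ b ])
  shortcut a [] b (p ∷ _) _ = [] , (λ ()) , link p (λ _ ()) [-]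
  shortcut a (m ∷ M) b (p ∷ l) a≢b with m ≟ b
  ... | yes refl = [] , (λ ()) , link p (λ _ ()) [-]
  ... | no m≢b with shortcut m M b l m≢b
  ...   | N , i , c with a ∈? (m ∷ N)
  ...     | yes a∈ with ∈-∃++ a∈
  ...       | X , Y , eq = Y , (λ v∈ → ∷⁺ʳ m i (subst (_ ∈_) (sym eq) (∈-++⁺ʳ X (there v∈)))) ,
    chordless-++⁻ʳ X (subst Chordless (trans (cong (_++ [ b ]) eq) (++-assoc X (a ∷ Y) [ b ])) c)
  shortcut a (m ∷ M) b (p ∷ l) a≢b | no m≢b | N , i , c | no a∉
    with shortcut-step (m ∷ N) c (λ a∈ → notIn (∈-++⁻ (m ∷ N) a∈)) (here p)
    where
    notIn : a ∈ (m ∷ N) ⊎ a ∈ [ b ] → ⊥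
    notIn (inj₁ j)           = a∉ j
    notIn (inj₂ (here a≡b)) = a≢b a≡b
  ... | N′ , j , d = N′ , ∷⁺ʳ m i ∘ j , d

  -- A hole cut open at `v`: the rest is a chordless path of which `v` sees exactly the two ends.
  -- `inner` forces at least four vertices, which excludes triangles.
  record Cycle (L : List V) : Set where
    field
      {v u z}  : V
      {M}      : List V
      shape    : L ≡ v ∷ u ∷ M ++ [ z ]
      inner    : M ≢ []
      v~u      : v ~ u
      v~z      : v ~ z
      apart    : [ v ] ∥ M
      path     : Chordless (u ∷ M ++ [ z ])

  cycle-view : ∀ {v u M z} → Cycle (v ∷ u ∷ M ++ [ z ]) →
               M ≢ [] × v ~ u × v ~ z × [ v ] ∥ M × Chordless (u ∷ M ++ [ z ])
  cycle-view {M = M} record { M = M′ ; shape = eq ; inner = i ; v~u = p ; v~z = q ; apart = r ; path = c }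
    with refl , eq₁ ← ∷-injective eq
    with refl , eq₂ ← ∷-injective eq₁
    with refl , refl ← ∷ʳ-injective M M′ eq₂ = i , p , q , r , c

  cycle-tail : ∀ {v P} → Cycle (v ∷ P) → Chordless P
  cycle-tail record { shape = refl ; path = c } = c

  cycle-step : ∀ {v u P} → Cycle (v ∷ u ∷ P) → v ~ u
  cycle-step record { shape = refl ; v~u = p } = p

  cycle-rotate₁ : ∀ {v P} → Cycle (v ∷ P) → Cycle (P ++ [ v ])
  cycle-rotate₁ record { M = [] ; inner = i } = ⊥-elim (i refl)
  cycle-rotate₁ record { v = v ; u = u ; z = z ; M = m ∷ M ; shape = refl ; v~u = p ; v~z = q ; apart = r
                       ; path = link s t c } = record
    { shape = refl
    ; inner = snoc≢[] M
    ; v~u   = s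
    ; v~z   = ~-sym p
    ; apart = t
    ; path  = subst Chordless (sym (++-assoc (m ∷ M) [ z ] [ v ]))
                (chordless-join (m ∷ M) c [-] (~-sym q) (∥-sym r) (λ _ ()))
    }

  cycle-rotate : ∀ A {B} → Cycle (A ++ B) → Cycle (B ++ A)
  cycle-rotate []      {B} c = subst Cycle (sym (++-identityʳ B)) c
  cycle-rotate (a ∷ A) {B} c =
    subst Cycle (++-assoc B [ a ] A)
      (cycle-rotate A (subst Cycle (++-assoc A B [ a ]) (cycle-rotate₁ c)))

  cycle-reverse : ∀ {L} → Cycle L → Cycle (reverse L)
  cycle-reverse record { v = v ; u = u ; z = z ; M = M ; shape = refl ; inner = i ; v~u = p ; v~z = q
                       ; apart = r ; path = c } =
    subst Cycle (sym (unfold-reverse v (u ∷ M ++ [ z ]))) (cycle-rotate₁ (subst (Cycle ∘ (v ∷_)) (sym eq) record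
      { shape = refl
      ; inner = λ e → i (trans (sym (reverse-involutive M)) (cong reverse e))
      ; v~u   = q
      ; v~z   = p
      ; apart = ∥-mono ⊆-refl (reverse-⊆ M) r
      ; path  = subst Chordless eq (chordless-reverse c) }))
    where
    eq : reverse (u ∷ M ++ [ z ]) ≡ z ∷ reverse M ++ [ u ]
    eq = trans (unfold-reverse u (M ++ [ z ])) (cong (_++ [ u ]) (reverse-snoc M z))

  cycle-arc : ∀ A {B} → B ≢ [] → Cycle (A ++ B) → Chordless A
  cycle-arc A {[]}    ne c = ⊥-elim (ne refl)
  cycle-arc A {b ∷ B} _  c = chordless-++⁻ʳ B (cycle-tail (cycle-rotate A c))

  cycle-arcs∥ : ∀ {v} A {m B} → Cycle (v ∷ A ++ m ∷ B) → A ∥ B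
  cycle-arcs∥ A c = chordless-apart A (cycle-tail c)

  cycle⇒unique : ∀ {L} → Cycle L → Unique L
  cycle⇒unique record { u = u ; z = z ; M = M ; shape = refl ; v~u = p ; v~z = q ; apart = r ; path = c } =
    All.tabulate (λ { (here refl) → ~⇒≢ p ; (there i) → aux (∈-++⁻ M i) }) ∷ chordless⇒unique c
    where
    aux : ∀ {w} → w ∈ M ⊎ w ∈ [ z ] → _ ≢ w
    aux (inj₁ i)           = proj₁ (r (here refl) i)
    aux (inj₂ (here refl)) = ~⇒≢ q

  -- Once the cycle starts at `a`, only `u` and `z` can be neighbours of `a`, and the nonempty
  -- stretch between them makes these two nonadjacent.
  cycle-no-triangle : ∀ {L a b c} → Cycle L → a ∈ L → b ∈ L → c ∈ L → a ~ b → a ~ c → ¬ b ~ c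
  cycle-no-triangle {L} {a} {b} {c} cy a∈ b∈ c∈ a~b a~c b~c with ∈-∃++ a∈
  ... | A , B , refl = go (cycle-rotate A cy) (++-swap-⊆ A b∈) (++-swap-⊆ A c∈)
    where
    go : ∀ {P} → Cycle (a ∷ P) → b ∈ a ∷ P → c ∈ a ∷ P → ⊥
    go _ (here refl) _ = ~-irrefl a~b
    go _ _ (here refl) = ~-irrefl a~c
    go record { M = [] ; inner = ne } _ _ = ne refl
    go record { u = u ; z = z ; M = m ∷ M ; shape = refl ; apart = r ; path = link _ t _ } (there i) (there j) =
      ends (near a~b i) (near a~c j)
      where
      near : ∀ {x} → a ~ x → x ∈ u ∷ m ∷ M ++ [ z ] → x ≡ u ⊎ x ≡ z
      near p (here eq) = inj₁ eq
      near p (there k) with ∈-++⁻ (m ∷ M) k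
      ... | inj₁ k′        = ⊥-elim (proj₂ (r (here refl) k′) p)
      ... | inj₂ (here eq) = inj₂ eq
      u≁z : ¬ u ~ z
      u≁z = proj₂ (t (here refl) (∈-++⁺ʳ M (here refl)))
      ends : b ≡ u ⊎ b ≡ z → c ≡ u ⊎ c ≡ z → ⊥
      ends (inj₁ refl) (inj₁ refl) = ~-irrefl b~c
      ends (inj₁ refl) (inj₂ refl) = u≁z b~c
      ends (inj₂ refl) (inj₁ refl) = u≁z (~-sym b~c)
      ends (inj₂ refl) (inj₂ refl) = ~-irrefl b~c

  -- Forbidden configurations spanned by walks

  Consecutive : ∀ {m} → Fin m → Fin m → Set
  Consecutive i j = suc (toℕ i) ≡ toℕ j ⊎ suc (toℕ j) ≡ toℕ i

  chordless-adj : ∀ {L} → Chordless L → ∀ i j → Consecutive i j ⇔ lookup L i ~ lookup L j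
  chordless-adj c i j = mk⇔ (to c i j) (from c i j)
    where
    suc⁻ : ∀ {m} {i j : Fin m} → Consecutive (suc i) (suc j) → Consecutive i j
    suc⁻ (inj₁ eq) = inj₁ (ℕ.suc-injective eq)
    suc⁻ (inj₂ eq) = inj₂ (ℕ.suc-injective eq)
    suc⁺ : ∀ {m} {i j : Fin m} → Consecutive i j → Consecutive (suc i) (suc j)
    suc⁺ (inj₁ eq) = inj₁ (cong suc eq)
    suc⁺ (inj₂ eq) = inj₂ (cong suc eq)
    to : ∀ {L} → Chordless L → ∀ i j → Consecutive i j → lookup L i ~ lookup L j
    to [-] zero zero (inj₁ ())
    to [-] zero zero (inj₂ ())
    to (link p q c) zero zero (inj₁ ())
    to (link p q c) zero zero (inj₂ ())
    to (link p q c) zero (suc zero) _ = p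
    to (link p q c) zero (suc (suc j)) (inj₁ ())
    to (link p q c) zero (suc (suc j)) (inj₂ ())
    to (link p q c) (suc zero) zero _ = ~-sym p
    to (link p q c) (suc (suc j)) zero (inj₁ ())
    to (link p q c) (suc (suc j)) zero (inj₂ ())
    to (link p q c) (suc i) (suc j) x = to c i j (suc⁻ x)
    from : ∀ {L} → Chordless L → ∀ i j → lookup L i ~ lookup L j → Consecutive i j
    from [-] zero zero p = ⊥-elim (~-irrefl p)
    from (link _ _ c) zero zero p = ⊥-elim (~-irrefl p)
    from (link _ _ c) zero (suc zero) p = inj₁ refl
    from (link _ q c) zero (suc (suc j)) p = ⊥-elim (proj₂ (q (here refl) (∈-lookup j)) p)
    from (link _ _ c) (suc zero) zero p = inj₂ refl
    from (link _ q c) (suc (suc j)) zero p = ⊥-elim (proj₂ (q (here refl) (∈-lookup j)) (~-sym p))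
    from (link _ _ c) (suc i) (suc j) p = suc⁺ (from c i j p)

  toPath : ∀ {v us} → Chordless (v ∷ us) → Path G (length us)
  toPath {v} {us} c = record
    { at        = lookup (v ∷ us)
    ; injective = lookup-injective (chordless⇒unique c)
    ; adjacent  = chordless-adj c
    }

  induced : List V → ∃[ m ] Graph m
  induced U = length U , record
    { Adj    = λ i j → lookup U i ~ lookup U j
    ; adj?   = λ i j → lookup U i ~? lookup U j
    ; symm   = ~-sym
    ; irrefl = λ { refl → ~-irrefl }
    }

  inclusion : ∀ {U} → Unique U → proj₂ (induced U) ↪ G
  inclusion {U} u = record
    { at        = lookup U
    ; injective = lookup-injective u
    ; adjacent  = λ i j → mk⇔ (λ p → p) (λ p → p)
    }

  lift : ∀ {j} {J : Graph j} {U} (u : Unique U) (p : J ↪ G) → (∀ i → at p i ∈ U) →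
         Σ[ q ∈ J ↪ proj₂ (induced U) ] (∀ i → lookup U (at q i) ≡ at p i)
  lift u p on = factor (inclusion u) p (λ i → ∈-index (on i))

  -- A member of a forbidden class has no vertex off its three paths, so the configuration has to
  -- become a graph of its own: the subgraph of `G` induced by the union of the lists. Repetitions
  -- are removed because the paths of a theta or a pyramid share ends.
  module ThreePaths (h : Fin 3 → V) (T : Fin 3 → List V) (c : ∀ i → Chordless (h i ∷ T i)) where

    private
      L : Fin 3 → List V
      L i = h i ∷ T i

      all : List V
      all = L zero ++ L (suc zero) ++ L (suc (suc zero))

    U : List V
    U = deduplicate _≟_ all

    unique : Unique U
    unique = deduplicate-! _≟_ all

    private
      L⊆U : ∀ i → L i ⊆ U
      L⊆U i = ∈-deduplicate⁺ _≟_ ∘ three {A = λ i → L i ⊆ all} ∈-++⁺ˡ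
        (∈-++⁺ʳ (L zero) ∘ ∈-++⁺ˡ) (∈-++⁺ʳ (L zero) ∘ ∈-++⁺ʳ (L (suc zero))) i

      lifted : ∀ i → Σ[ q ∈ Path (proj₂ (induced U)) (length (T i)) ] (∀ x → lookup U (at q x) ≡ lookup (L i) x)
      lifted i = lift unique (toPath (c i)) (λ x → L⊆U i (∈-lookup x))

    H : Graph (length U)
    H = proj₂ (induced U)

    P : ∀ i → Path H (length (T i))
    P i = proj₁ (lifted i)

    at-P : ∀ i x → lookup U (at (P i) x) ≡ lookup (L i) x
    at-P i = proj₂ (lifted i)

    same : ∀ {i j} {x y} → at (P i) x ≡ at (P j) y → lookup (L i) x ≡ lookup (L j) y
    same {i} {j} {x} {y} eq = trans (sym (at-P i x)) (trans (cong (lookup U) eq) (at-P j y))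

    same⁻ : ∀ {i j} {x y} → lookup (L i) x ≡ lookup (L j) y → at (P i) x ≡ at (P j) y
    same⁻ {i} {j} {x} {y} eq = lookup-injective unique (trans (at-P i x) (trans eq (sym (at-P j y))))

    adj : ∀ {i j} {x y} → Adj H (at (P i) x) (at (P j) y) → lookup (L i) x ~ lookup (L j) y
    adj {i} {j} {x} {y} p rewrite at-P i x | at-P j y = p

    adj⁻ : ∀ {i j} {x y} → lookup (L i) x ~ lookup (L j) y → Adj H (at (P i) x) (at (P j) y)
    adj⁻ {i} {j} {x} {y} p rewrite at-P i x | at-P j y = p

    span : ∀ v → ∃[ i ] v On P i
    span v = split (∈-++⁻ (L zero) (∈-deduplicate⁻ _≟_ all (∈-lookup v)))
      where
      onP : ∀ i → lookup U v ∈ L i → ∃[ i ] v On P i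
      onP i p with ∈-index p
      ... | x , eq = i , x , lookup-injective unique (trans (at-P i x) eq)
      split : lookup U v ∈ L zero ⊎ lookup U v ∈ L (suc zero) ++ L (suc (suc zero)) → ∃[ i ] v On P i
      split (inj₁ p) = onP zero p
      split (inj₂ q) = [ onP (suc zero) , onP (suc (suc zero)) ]′ (∈-++⁻ (L (suc zero)) q)

  isEnd-or-inner : ∀ (a : V) (N : List V) b (x : Fin (suc (length (N ++ [ b ])))) → IsEnd x ⊎ lookup (a ∷ N ++ [ b ]) x ∈ N
  isEnd-or-inner a N b zero    = inj₁ (inj₁ refl)
  isEnd-or-inner a N b (suc x) with lookup-snoc N {b} x
  ... | inj₁ (eq , _) = inj₁ (inj₂ eq)
  ... | inj₂ i        = inj₂ i

  end-value : ∀ (a : V) (N : List V) b {x} → IsEnd x → lookup (a ∷ N ++ [ b ]) x ≡ a ⊎ lookup (a ∷ N ++ [ b ]) x ≡ b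
  end-value a N b (inj₁ refl) = inj₁ refl
  end-value a N b (inj₂ refl) = inj₂ (lookup-last a N b)

  inner≢ends : ∀ {a N b v} → Chordless (a ∷ N ++ [ b ]) → v ∈ N → v ≢ a × v ≢ b
  inner≢ends {a} {N} {b} c v∈ =
    (λ { refl → chordless-head∉ c (∈-++⁺ˡ v∈) }) ,
    λ { refl → chordless-head∉ (subst Chordless (reverse-snoc N b) (chordless-reverse (chordless-++⁻ʳ [ a ] c)))
                 (reverse⁺ v∈) }

  2≤length : ∀ (N : List V) b → N ≢ [] → 2 ≤ length (N ++ [ b ])
  2≤length []          b ne = ⊥-elim (ne refl)
  2≤length (_ ∷ [])    b ne = s≤s (s≤s z≤n)
  2≤length (_ ∷ y ∷ N) b ne = s≤s (s≤s z≤n)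

  1≤length : ∀ (N : List V) b → 1 ≤ length (N ++ [ b ])
  1≤length []      b = s≤s z≤n
  1≤length (_ ∷ _) b = s≤s z≤n

  -- Shortening the walks only drops inner vertices, so anticompleteness survives. As `a` and `b`
  -- are nonadjacent, every shortened path still has length at least 2.
  no-theta : Free IsTheta G → ∀ {a b} → a ≢ b → ¬ a ~ b → (A : Fin 3 → List V) →
             (∀ i → Linked _~_ (a ∷ A i ++ [ b ])) → (∀ {i j} → i ≢ j → A i ∥ A j) → ⊥
  no-theta free {a} {b} a≢b a≁b A walk A∥ = free H theta (inclusion unique)
    where
    short : ∀ i → ∃[ N ] N ⊆ A i × Chordless (a ∷ N ++ [ b ])
    short i = shortcut a (A i) b (walk i) a≢b
    N : Fin 3 → List V
    N i = proj₁ (short i)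
    c : ∀ i → Chordless (a ∷ N i ++ [ b ])
    c i = proj₂ (proj₂ (short i))
    N∥ : ∀ {i j} → i ≢ j → N i ∥ N j
    N∥ {i} {j} ne = ∥-mono (proj₁ (proj₂ (short i))) (proj₁ (proj₂ (short j))) (A∥ ne)
    open ThreePaths (λ _ → a) (λ i → N i ++ [ b ]) c
    N≢[] : ∀ {i} → N i ≢ []
    N≢[] {i} eq with c i
    ... | ci rewrite eq = a≁b (chordless-step [] ci)
    common : ∀ {i j} → i ≢ j → ∀ x y → lookup (a ∷ N i ++ [ b ]) x ≡ lookup (a ∷ N j ++ [ b ]) y → IsEnd x
    common {i} {j} ne x y eq = go (isEnd-or-inner a (N i) b x) (isEnd-or-inner a (N j) b y)
      where
      go : IsEnd x ⊎ lookup (a ∷ N i ++ [ b ]) x ∈ N i → IsEnd y ⊎ lookup (a ∷ N j ++ [ b ]) y ∈ N j → IsEnd x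
      go (inj₁ e) _ = e
      go (inj₂ k) (inj₂ l) = ⊥-elim (proj₁ (N∥ ne k l) eq)
      go (inj₂ k) (inj₁ e) = ⊥-elim ([ (λ eq′ → proj₁ (inner≢ends (c i) k) (trans eq eq′))
                                     , (λ eq′ → proj₂ (inner≢ends (c i) k) (trans eq eq′)) ]′ (end-value a (N j) b {y} e))
    crossing : ∀ {i j} → i ≢ j → ∀ x y → ¬ IsEnd x → ¬ IsEnd y → ¬ lookup (a ∷ N i ++ [ b ]) x ~ lookup (a ∷ N j ++ [ b ]) y
    crossing {i} {j} ne x y ¬x ¬y p = go (isEnd-or-inner a (N i) b x) (isEnd-or-inner a (N j) b y)
      where
      go : IsEnd x ⊎ lookup (a ∷ N i ++ [ b ]) x ∈ N i → IsEnd y ⊎ lookup (a ∷ N j ++ [ b ]) y ∈ N j → ⊥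
      go (inj₁ e) _        = ¬x e
      go (inj₂ _) (inj₁ e) = ¬y e
      go (inj₂ k) (inj₂ l) = proj₂ (N∥ ne k l) p
    theta : IsTheta H
    theta = record
      { a = first (P zero)
      ; b = last (P zero)
      ; len = λ i → length (N i ++ [ b ])
      ; P = P
      ; from-a = λ i → same⁻ {i} {zero} {zero} {zero} refl
      ; to-b = λ i → same⁻ {i} {zero} {fromℕ _} {fromℕ _} (trans (lookup-last a (N i) b) (sym (lookup-last a (N zero) b)))
      ; len≥2 = λ i → 2≤length (N i) b N≢[]
      ; disjoint = λ {i} {j} ne x y eq → common ne x y (same {i} {j} eq) , common (ne ∘ sym) y x (sym (same {i} {j} eq))
      ; cross = λ {i} {j} ne x y ¬x ¬y p → crossing ne x y ¬x ¬y (adj {i} {j} p)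
      ; span = span
      }

  -- The last argument provides `two-long`: a shortened path to a vertex `b i` not adjacent to `a`
  -- has an inner vertex.
  no-pyramid : Free IsPyramid G → ∀ {a} (b : Fin 3 → V) → (∀ i → a ≢ b i) → (A : Fin 3 → List V) →
               (∀ i → Linked _~_ (a ∷ A i ++ [ b i ])) → (∀ {i j} → i ≢ j → b i ~ b j) →
               (∀ {i j} → i ≢ j → ∀ {u v} → u ∈ A i ++ [ b i ] → v ∈ A j ++ [ b j ] →
                  u ≢ v × (u ~ v → u ≡ b i × v ≡ b j)) →
               ∃[ i ] ∃[ j ] i ≢ j × ¬ a ~ b i × ¬ a ~ b j → ⊥
  no-pyramid free {a} b a≢b A walk tri cr (i₀ , j₀ , i≢j , a≁i , a≁j) = free H pyramid (inclusion unique)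
    where
    short : ∀ i → ∃[ N ] N ⊆ A i × Chordless (a ∷ N ++ [ b i ])
    short i = shortcut a (A i) (b i) (walk i) (a≢b i)
    N : Fin 3 → List V
    N i = proj₁ (short i)
    c : ∀ i → Chordless (a ∷ N i ++ [ b i ])
    c i = proj₂ (proj₂ (short i))
    open ThreePaths (λ _ → a) (λ i → N i ++ [ b i ]) c
    N≢[] : ∀ {i} → ¬ a ~ b i → N i ≢ []
    N≢[] {i} a≁ eq with c i
    ... | ci rewrite eq = a≁ (chordless-step [] ci)
    in-A : ∀ i (x : Fin (length (N i ++ [ b i ]))) → lookup (N i ++ [ b i ]) x ∈ A i ++ [ b i ]
    in-A i x = ++⁺ (proj₁ (proj₂ (short i))) ⊆-refl (∈-lookup x)
    common : ∀ {i j} → i ≢ j → ∀ x y → lookup (a ∷ N i ++ [ b i ]) x ≡ lookup (a ∷ N j ++ [ b j ]) y → x ≡ zero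
    common ne zero y eq = refl
    common {i} ne (suc x) zero eq = ⊥-elim (chordless-head∉ (c i) (subst (_∈ N i ++ [ b i ]) eq (∈-lookup x)))
    common {i} {j} ne (suc x) (suc y) eq = ⊥-elim (proj₁ (cr ne (in-A i x) (in-A j y)) eq)
    at-last : ∀ i (x : Fin (suc (length (N i ++ [ b i ])))) → lookup (a ∷ N i ++ [ b i ]) x ≡ b i →
              x ≡ fromℕ (length (N i ++ [ b i ]))
    at-last i x eq = lookup-injective (chordless⇒unique (c i)) (trans eq (sym (lookup-last a (N i) (b i))))
    crossing : ∀ {i j} → i ≢ j → ∀ x y → x ≢ zero → y ≢ zero →
               lookup (a ∷ N i ++ [ b i ]) x ~ lookup (a ∷ N j ++ [ b j ]) y →
               x ≡ fromℕ (length (N i ++ [ b i ])) × y ≡ fromℕ (length (N j ++ [ b j ]))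
    crossing ne zero y x≢ y≢ p = ⊥-elim (x≢ refl)
    crossing ne (suc x) zero x≢ y≢ p = ⊥-elim (y≢ refl)
    crossing {i} {j} ne (suc x) (suc y) x≢ y≢ p with proj₂ (cr ne (in-A i x) (in-A j y)) p
    ... | e , f = at-last i (suc x) e , at-last j (suc y) f
    pyramid : IsPyramid H
    pyramid = record
      { a = first (P zero)
      ; len = λ i → length (N i ++ [ b i ])
      ; P = P
      ; from-a = λ i → same⁻ {i} {zero} {zero} {zero} refl
      ; len≥1 = λ i → 1≤length (N i) (b i)
      ; two-long = i₀ , j₀ , i≢j , 2≤length (N i₀) _ (N≢[] a≁i) , 2≤length (N j₀) _ (N≢[] a≁j)
      ; disjoint = λ {i} {j} ne x y eq → common ne x y (same {i} {j} eq) , common (ne ∘ sym) y x (sym (same {i} {j} eq))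
      ; triangle = λ {i} {j} ne → adj⁻ {i} {j} (aux i j (tri ne))
      ; cross = λ {i} {j} ne x y x≢ y≢ p → crossing ne x y x≢ y≢ (adj {i} {j} p)
      ; span = span
      }
      where
      aux : ∀ i j → b i ~ b j → lookup (a ∷ N i ++ [ b i ]) (fromℕ _) ~ lookup (a ∷ N j ++ [ b j ]) (fromℕ _)
      aux i j p rewrite lookup-last a (N i) (b i) | lookup-last a (N j) (b j) = p

  no-prism : Free IsPrism G → (a b : Fin 3 → V) → (∀ i → a i ≢ b i) → (A : Fin 3 → List V) →
             (∀ i → Linked _~_ (a i ∷ A i ++ [ b i ])) →
             (∀ {i j} → i ≢ j → a i ~ a j) → (∀ {i j} → i ≢ j → b i ~ b j) →
             (∀ {i j} → i ≢ j → ∀ {u v} → u ∈ a i ∷ A i ++ [ b i ] → v ∈ a j ∷ A j ++ [ b j ] →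
                u ≢ v × (u ~ v → (u ≡ a i × v ≡ a j) ⊎ (u ≡ b i × v ≡ b j))) → ⊥
  no-prism free a b a≢b A walk triᵃ triᵇ cr = free H prism (inclusion unique)
    where
    short : ∀ i → ∃[ N ] N ⊆ A i × Chordless (a i ∷ N ++ [ b i ])
    short i = shortcut (a i) (A i) (b i) (walk i) (a≢b i)
    N : Fin 3 → List V
    N i = proj₁ (short i)
    c : ∀ i → Chordless (a i ∷ N i ++ [ b i ])
    c i = proj₂ (proj₂ (short i))
    open ThreePaths a (λ i → N i ++ [ b i ]) c
    in-A : ∀ i (x : Fin (suc (length (N i ++ [ b i ])))) → lookup (a i ∷ N i ++ [ b i ]) x ∈ a i ∷ A i ++ [ b i ]
    in-A i x = ∷⁺ʳ (a i) (++⁺ (proj₁ (proj₂ (short i))) ⊆-refl) (∈-lookup x)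
    at-first : ∀ i (x : Fin (suc (length (N i ++ [ b i ])))) → lookup (a i ∷ N i ++ [ b i ]) x ≡ a i → x ≡ zero
    at-first i x eq = lookup-injective (chordless⇒unique (c i)) eq
    at-last : ∀ i (x : Fin (suc (length (N i ++ [ b i ])))) → lookup (a i ∷ N i ++ [ b i ]) x ≡ b i →
              x ≡ fromℕ (length (N i ++ [ b i ]))
    at-last i x eq = lookup-injective (chordless⇒unique (c i)) (trans eq (sym (lookup-last (a i) (N i) (b i))))
    crossing : ∀ {i j} → i ≢ j → ∀ x y → lookup (a i ∷ N i ++ [ b i ]) x ~ lookup (a j ∷ N j ++ [ b j ]) y →
               (x ≡ zero × y ≡ zero) ⊎ (x ≡ fromℕ (length (N i ++ [ b i ])) × y ≡ fromℕ (length (N j ++ [ b j ])))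
    crossing {i} {j} ne x y p with proj₂ (cr ne (in-A i x) (in-A j y)) p
    ... | inj₁ (e , f) = inj₁ (at-first i x e , at-first j y f)
    ... | inj₂ (e , f) = inj₂ (at-last i x e , at-last j y f)
    prism : IsPrism H
    prism = record
      { len = λ i → length (N i ++ [ b i ])
      ; P = P
      ; len≥1 = λ i → 1≤length (N i) (b i)
      ; disjoint = λ {i} {j} ne x y eq → proj₁ (cr ne (in-A i x) (in-A j y)) (same {i} {j} eq)
      ; triangleᵃ = λ {i} {j} ne → adj⁻ {i} {j} (triᵃ ne)
      ; triangleᵇ = λ {i} {j} ne → adj⁻ {i} {j} (aux i j (triᵇ ne))
      ; cross = λ {i} {j} ne x y p → crossing ne x y (adj {i} {j} p)
      ; span = span
      }
      where
      aux : ∀ i j → b i ~ b j → lookup (a i ∷ N i ++ [ b i ]) (fromℕ _) ~ lookup (a j ∷ N j ++ [ b j ]) (fromℕ _)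
      aux i j p rewrite lookup-last (a i) (N i) (b i) | lookup-last (a j) (N j) (b j) = p

  -- Rims, squares and even wheels

  degree : V → List V → ℕ
  degree u L = length (filter (u ~?_) L)

  -- `at-list` keeps the order of the list, so that `rimDegree`, a count over positions, can be
  -- compared with `degree`, a count over entries.
  record RimEmbedding (L : List V) : Set where
    field
      {extra} : ℕ
      size    : length L ≡ 4 + extra
      onto    : cycleGraph (suc extra) ↪ G
      at-list : tabulate (at onto) ≡ L

  cycle-embedding : ∀ {L} → Cycle L → RimEmbedding L
  cycle-embedding {[]} record { shape = () }
  cycle-embedding {_ ∷ []} record { shape = () }
  cycle-embedding {_ ∷ _ ∷ []} record { M = [] ; shape = () }
  cycle-embedding {_ ∷ _ ∷ []} record { M = _ ∷ _ ; shape = () }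
  cycle-embedding {_ ∷ _ ∷ _ ∷ []} record { M = [] ; inner = ne } = ⊥-elim (ne refl)
  cycle-embedding {_ ∷ _ ∷ _ ∷ []} record { M = _ ∷ [] ; shape = () }
  cycle-embedding {_ ∷ _ ∷ _ ∷ []} record { M = _ ∷ _ ∷ _ ; shape = () }
  cycle-embedding {v ∷ u ∷ m ∷ t ∷ T} cy@record { z = z ; M = M ; shape = shape ; v~u = p ; v~z = q ; apart = r ; path = c }
    with refl , eq ← ∷-injective shape
    with refl , eq ← ∷-injective eq = record
    { size    = refl
    ; onto    = record
      { at        = lookup (v ∷ P)
      ; injective = lookup-injective (cycle⇒unique cy)
      ; adjacent  = λ i j → mk⇔ (to i j) (from i j)
      }
    ; at-list = tabulate-lookup (v ∷ P)
    }
    where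
    P : List V
    P = u ∷ m ∷ t ∷ T
    P≡ : P ≡ u ∷ M ++ [ z ]
    P≡ = cong (u ∷_) eq
    chordless-P : Chordless P
    chordless-P = subst Chordless (sym P≡) c
    C = cycleGraph (suc (length T))
    P-last : lookup P (fromℕ (2 + length T)) ≡ z
    P-last = go P≡
      where
      go : ∀ {w W} → w ∷ W ≡ u ∷ M ++ [ z ] → lookup (w ∷ W) (fromℕ (length W)) ≡ z
      go refl = lookup-last u M z
    from₀ : ∀ j → v ~ lookup P j → j ≡ zero ⊎ suc j ≡ fromℕ (3 + length T)
    from₀ j = go P≡ j
      where
      go : ∀ {w W} → w ∷ W ≡ u ∷ M ++ [ z ] → ∀ j → v ~ lookup (w ∷ W) j → j ≡ zero ⊎ suc j ≡ fromℕ (suc (length W))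
      go refl zero    s = inj₁ refl
      go refl (suc j) s with lookup-snoc M {z} j
      ... | inj₁ (e , _) = inj₂ (cong suc e)
      ... | inj₂ i       = ⊥-elim (proj₂ (r (here refl) i) s)
    to : ∀ i j → Adj C i j → lookup (v ∷ P) i ~ lookup (v ∷ P) j
    to zero    zero    (inj₁ (inj₁ ()))
    to zero    zero    (inj₂ (inj₁ ()))
    to zero    zero    (inj₁ (inj₂ (() , _)))
    to zero    zero    (inj₂ (inj₂ (() , _)))
    to zero    (suc zero) _ = p
    to zero    (suc (suc j)) (inj₁ (inj₁ ()))
    to zero    (suc (suc j)) (inj₂ (inj₁ ()))
    to zero    (suc (suc j)) (inj₁ (inj₂ (() , _)))
    to zero    (suc (suc j)) (inj₂ (inj₂ (e , _))) = subst (v ~_) (sym (trans (cong (lookup (v ∷ P)) e) P-last)) q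
    to (suc zero) zero _ = ~-sym p
    to (suc (suc i)) zero (inj₁ (inj₁ ()))
    to (suc (suc i)) zero (inj₂ (inj₁ ()))
    to (suc (suc i)) zero (inj₂ (inj₂ (() , _)))
    to (suc (suc i)) zero (inj₁ (inj₂ (e , _))) = ~-sym (subst (v ~_) (sym (trans (cong (lookup (v ∷ P)) e) P-last)) q)
    to (suc i) (suc j) (inj₁ (inj₁ e)) = Equivalence.to (chordless-adj chordless-P i j) (inj₁ (ℕ.suc-injective e))
    to (suc i) (suc j) (inj₂ (inj₁ e)) = Equivalence.to (chordless-adj chordless-P i j) (inj₂ (ℕ.suc-injective e))
    to (suc i) (suc j) (inj₁ (inj₂ (_ , ())))
    to (suc i) (suc j) (inj₂ (inj₂ (_ , ())))
    from : ∀ i j → lookup (v ∷ P) i ~ lookup (v ∷ P) j → Adj C i j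
    from zero    zero    s = ⊥-elim (~-irrefl s)
    from zero    (suc j) s with from₀ j s
    ... | inj₁ refl = inj₁ (inj₁ refl)
    ... | inj₂ e    = inj₂ (inj₂ (e , refl))
    from (suc i) zero    s with from₀ i (~-sym s)
    ... | inj₁ refl = inj₂ (inj₁ refl)
    ... | inj₂ e    = inj₁ (inj₂ (e , refl))
    from (suc i) (suc j) s with Equivalence.from (chordless-adj chordless-P i j) s
    ... | inj₁ e = inj₁ (inj₁ (cong suc e))
    ... | inj₂ e = inj₂ (inj₁ (cong suc e))

  no-square : ¬ (square ↪ G) → ∀ {a b c d} → a ~ b → b ~ c → c ~ d → d ~ a →
              a ≢ c → ¬ a ~ c → b ≢ d → ¬ b ~ d → ⊥
  no-square free {a} {b} {c} {d} p q r s a≢c a≁c b≢d b≁d = free (RimEmbedding.onto (cycle-embedding cy))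
    where
    cy : Cycle (a ∷ b ∷ [ c ] ++ [ d ])
    cy = record { shape = refl ; inner = λ () ; v~u = p ; v~z = ~-sym s ; apart = ∥₁ a≢c a≁c
                ; path = link q (∥₁ b≢d b≁d) (link r (λ _ ()) [-]) }

  length-filter-tabulate : ∀ {m} {A B : Set} {p q} {P : A → Set p} {Q : B → Set q}
    (P? : ∀ x → Dec (P x)) (Q? : ∀ x → Dec (Q x)) (f : Fin m → A) (g : Fin m → B) →
    (∀ i → P (f i) → Q (g i)) → (∀ i → Q (g i) → P (f i)) →
    length (filter P? (tabulate f)) ≡ length (filter Q? (tabulate g))
  length-filter-tabulate {zero}  P? Q? f g to from = refl
  length-filter-tabulate {suc m} P? Q? f g to from with P? (f zero) | Q? (g zero)
  ... | yes _ | yes _ = cong suc (length-filter-tabulate P? Q? (f ∘ suc) (g ∘ suc) (to ∘ suc) (from ∘ suc))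
  ... | no _  | no _  = length-filter-tabulate P? Q? (f ∘ suc) (g ∘ suc) (to ∘ suc) (from ∘ suc)
  ... | yes p | no ¬q = ⊥-elim (¬q (to zero p))
  ... | no ¬p | yes q = ⊥-elim (¬p (from zero q))

  no-even-wheel : Free IsEvenWheel G → ∀ {L u} → Cycle L → u ∉ L → 3 ≤ degree u L → ¬ 2 ∣ degree u L
  no-even-wheel free {L} {u} cy u∉ deg≥3 even = free H wheel (inclusion unique)
    where
    open RimEmbedding (cycle-embedding cy)
    U : List V
    U = u ∷ L
    unique : Unique U
    unique = All.tabulate (λ { i refl → u∉ i }) ∷ cycle⇒unique cy
    H : Graph (length U)
    H = proj₂ (induced U)
    on : ∀ i → at onto i ∈ L
    on i = subst (at onto i ∈_) at-list (∈-tabulate⁺ {f = at onto} i)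
    lifted = lift {U = U} unique onto (there ∘ on)
    rim : Hole H
    rim = record { embed = proj₁ lifted }
    rimDegree≡ : rimDegree rim zero ≡ degree u L
    rimDegree≡ = trans
      (length-filter-tabulate (λ i → adj? H zero (at (proj₁ lifted) i)) (u ~?_) (λ i → i) (at onto)
        (λ i → subst (u ~_) (proj₂ lifted i)) (λ i → subst (u ~_) (sym (proj₂ lifted i))))
      (cong (degree u) at-list)
    wheel : IsEvenWheel H
    wheel = record
      { rim     = rim
      ; center  = zero
      ; outside = λ { (i , eq) → u∉ (subst (_∈ L) (trans (sym (proj₂ lifted i)) (cong (lookup U) eq)) (on i)) }
      ; deg≥3   = subst (3 ≤_) (sym rimDegree≡) deg≥3
      ; even    = subst (2 ∣_) (sym rimDegree≡) even
      ; span    = λ { zero → inj₁ refl ; (suc v) → inj₂ (onRim v) }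
      }
      where
      onRim : ∀ v → suc v On proj₁ lifted
      onRim v with ∈-tabulate⁻ {f = at onto} (subst (lookup L v ∈_) (sym at-list) (∈-lookup v))
      ... | i , eq = i , lookup-injective unique (trans (proj₂ lifted i) (sym eq))

  module _ (G∈𝒞 : 𝒞 G) where

    -- Attachments of a vertex to a cycle

    open 𝒞 G∈𝒞

    nonadjacent : V → List V → Set
    nonadjacent u A = ∀ {v} → v ∈ A → ¬ u ~ v

    apart-from : ∀ {u A} → u ∉ A → nonadjacent u A → [ u ] ∥ A
    apart-from u∉ u≁ (here refl) v∈ = (λ { refl → u∉ v∈ }) , u≁ v∈

    degree-++ : ∀ u A B → degree u (A ++ B) ≡ degree u A + degree u B
    degree-++ u A B = trans (cong length (filter-++ (u ~?_) A B)) (length-++ (filter (u ~?_) A))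

    degree-none : ∀ {u A} → nonadjacent u A → degree u A ≡ 0
    degree-none {u} ¬p = cong length (filter-none (u ~?_) (All.tabulate ¬p))

    degree-∷ : ∀ {u v} A → u ~ v → degree u (v ∷ A) ≡ suc (degree u A)
    degree-∷ {u} A p = cong length (filter-accept (u ~?_) p)

    degree-≥1 : ∀ {u v A} → v ∈ A → u ~ v → 1 ≤ degree u A
    degree-≥1 {u} {v} {A} v∈ p with ∈-∃++ v∈
    ... | X , Y , refl rewrite degree-++ u X (v ∷ Y) | degree-∷ Y p | ℕ.+-suc (degree u X) (degree u Y) = s≤s z≤n

    degree-rotate : ∀ u A B → degree u (A ++ B) ≡ degree u (B ++ A)
    degree-rotate u A B =
      trans (degree-++ u A B) (trans (ℕ.+-comm (degree u A) (degree u B)) (sym (degree-++ u B A)))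

    cycle⇒linked : ∀ {L} → Cycle L → Linked _~_ L
    cycle⇒linked record { shape = refl ; v~u = p ; path = c } = p ∷ chordless⇒linked c

    cycle-walk : ∀ {a} A {b B} → Cycle (a ∷ A ++ b ∷ B) → Linked _~_ (a ∷ A ++ [ b ])
    cycle-walk {a} A {b} {B} c =
      linked-++⁻ˡ (a ∷ A ++ [ b ]) (subst (Linked _~_ ∘ (a ∷_)) (sym (++-assoc A [ b ] B)) (cycle⇒linked c))

    walk-back : ∀ {b} B {a} → Linked _~_ (b ∷ B ++ [ a ]) → Linked _~_ (a ∷ reverse B ++ [ b ])
    walk-back {b} B {a} l = subst (Linked _~_)
      (trans (reverse-snoc (b ∷ B) a) (cong (a ∷_) (unfold-reverse b B))) (linked-reverse ~-sym l)

    cycle-walk-back : ∀ {a} A {b B} → Cycle (a ∷ A ++ b ∷ B) → Linked _~_ (a ∷ reverse B ++ [ b ])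
    cycle-walk-back {a} A {b} {B} c = walk-back B (cycle-walk B (cycle-rotate (a ∷ A) c))

    cycle-apart : ∀ {v} A {m B} → A ≢ [] → B ≢ [] → Cycle (v ∷ A ++ m ∷ B) → v ≢ m × ¬ v ~ m
    cycle-apart []      ne _ _ = ⊥-elim (ne refl)
    cycle-apart {v} (a ∷ A) {m} {B} _ ne c =
      chordless-apart [ v ] (cycle-arc (v ∷ a ∷ A ++ [ m ]) ne
        (subst (Cycle ∘ (v ∷_) ∘ (a ∷_)) (sym (++-assoc A [ m ] B)) c))
        (here refl) (∈-++⁺ʳ A (here refl))

    -- If `u` has a third neighbour on the cycle, the cycle and `u` form an even wheel. If `a` and
    -- `b` are the only neighbours, the two arcs between them and the path through `u` form a theta.
    even-degree : ∀ {L u a b} → Cycle L → u ∉ L → a ∈ L → b ∈ L → a ≢ b → ¬ a ~ b → u ~ a → u ~ b →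
                  ¬ 2 ∣ degree u L
    even-degree {L} {u} {a} {b} cy u∉ a∈ b∈ a≢b a≁b u~a u~b even with ∈-∃++ a∈
    ... | X , Y , refl = go (∈-∃++ (Any.tail (≢-sym a≢b) (++-swap-⊆ X b∈)))
      where
      cy′ : Cycle (a ∷ Y ++ X)
      cy′ = cycle-rotate X cy
      go : ∃[ A ] ∃[ B ] Y ++ X ≡ A ++ [ b ] ++ B → ⊥
      go (A , B , eq) = finish (any? (u ~?_) A) (any? (u ~?_) B)
        where
        c : Cycle (a ∷ A ++ b ∷ B)
        c = subst (Cycle ∘ (a ∷_)) eq cy′
        deg : degree u (X ++ a ∷ Y) ≡ suc (suc (degree u A + degree u B))
        deg = trans (degree-rotate u X (a ∷ Y)) (trans (cong (degree u ∘ (a ∷_)) eq) (trans (degree-∷ _ u~a)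
          (cong suc (trans (degree-++ u A (b ∷ B)) (trans (cong (degree u A +_) (degree-∷ B u~b)) (ℕ.+-suc _ _))))))
        u∉′ : u ∉ a ∷ A ++ b ∷ B
        u∉′ k = u∉ (++-swap-⊆ (a ∷ Y) (subst (u ∈_) (cong (a ∷_) (sym eq)) k))
        wheel : 1 ≤ degree u A + degree u B → ⊥
        wheel le = no-even-wheel evenWheel-free cy u∉ (subst (3 ≤_) (sym deg) (s≤s (s≤s le))) even
        finish : Dec (Any (u ~_) A) → Dec (Any (u ~_) B) → ⊥
        finish (yes p) _ with find p
        ... | v , v∈ , q = wheel (ℕ.≤-trans (degree-≥1 v∈ q) (ℕ.m≤m+n _ _))
        finish _ (yes p) with find p
        ... | v , v∈ , q = wheel (ℕ.≤-trans (degree-≥1 v∈ q) (ℕ.m≤n+m _ _))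
        finish (no ¬p) (no ¬q) = no-theta theta-free a≢b a≁b
          (three A (reverse B) [ u ])
          (three (cycle-walk A c) (cycle-walk-back A c) (~-sym u~a ∷ u~b ∷ [-]))
          (pairwise {R = λ i j → three {A = λ _ → List V} A (reverse B) [ u ] i ∥ three {A = λ _ → List V} A (reverse B) [ u ] j} ∥-sym
            (∥-mono ⊆-refl (reverse-⊆ B) (cycle-arcs∥ A c))
            (∥-sym (apart-from (u∉′ ∘ there ∘ ∈-++⁺ˡ) (λ v∈ q → ¬p (lose v∈ q))))
            (∥-mono (reverse-⊆ B) ⊆-refl
              (∥-sym (apart-from (u∉′ ∘ there ∘ ∈-++⁺ʳ A ∘ there) (λ v∈ q → ¬q (lose v∈ q))))))

    Cross : V → List V → V → List V → Set
    Cross b B b′ B′ = ∀ {u v} → u ∈ B → v ∈ B′ → u ≢ v × (u ~ v → u ≡ b × v ≡ b′)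

    cross-sym : ∀ {b B b′ B′} → Cross b B b′ B′ → Cross b′ B′ b B
    cross-sym c v∈ u∈ with c u∈ v∈
    ... | ne , f = ≢-sym ne , λ p → proj₂ (f (~-sym p)) , proj₁ (f (~-sym p))

    cross-snoc : ∀ {b B b′ B′} → b ≢ b′ → B ∥ B′ → [ b ] ∥ B′ → [ b′ ] ∥ B → Cross b (B ++ [ b ]) b′ (B′ ++ [ b′ ])
    cross-snoc {b} {B} {b′} {B′} ne p q r u∈ v∈ with ∈-++⁻ B u∈ | ∈-++⁻ B′ v∈
    ... | inj₁ i           | inj₁ j           = proj₁ (p i j) , ⊥-elim ∘ proj₂ (p i j)
    ... | inj₁ i           | inj₂ (here refl) = ≢-sym (proj₁ (r (here refl) i)) , ⊥-elim ∘ proj₂ (r (here refl) i) ∘ ~-sym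
    ... | inj₂ (here refl) | inj₁ j           = proj₁ (q (here refl) j) , ⊥-elim ∘ proj₂ (q (here refl) j)
    ... | inj₂ (here refl) | inj₂ (here refl) = ne , λ _ → refl , refl

    pyramid : ∀ {a b₀ b₁ b₂ A₀ A₁ A₂} →
              Linked _~_ (a ∷ A₀ ++ [ b₀ ]) → Linked _~_ (a ∷ A₁ ++ [ b₁ ]) → Linked _~_ (a ∷ A₂ ++ [ b₂ ]) →
              a ≢ b₀ → a ≢ b₁ → a ≢ b₂ → b₀ ~ b₁ → b₀ ~ b₂ → b₁ ~ b₂ →
              A₀ ∥ A₁ → A₀ ∥ A₂ → A₁ ∥ A₂ →
              [ b₀ ] ∥ A₁ → [ b₀ ] ∥ A₂ → [ b₁ ] ∥ A₀ → [ b₁ ] ∥ A₂ → [ b₂ ] ∥ A₀ → [ b₂ ] ∥ A₁ →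
              ¬ a ~ b₂ → ¬ a ~ b₀ ⊎ ¬ a ~ b₁ → ⊥
    pyramid {a} {b₀} {b₁} {b₂} {A₀} {A₁} {A₂} l₀ l₁ l₂ n₀ n₁ n₂ e₀₁ e₀₂ e₁₂ p₀₁ p₀₂ p₁₂ q₀₁ q₀₂ q₁₀ q₁₂ q₂₀ q₂₁ a≁b₂ a≁ =
      no-pyramid pyramid-free b (three n₀ n₁ n₂) A (three l₀ l₁ l₂)
        (pairwise {R = λ i j → b i ~ b j} ~-sym e₀₁ e₀₂ e₁₂)
        (pairwise {R = λ i j → Cross (b i) (A i ++ [ b i ]) (b j) (A j ++ [ b j ])} cross-sym
          (cross-snoc (~⇒≢ e₀₁) p₀₁ q₀₁ q₁₀) (cross-snoc (~⇒≢ e₀₂) p₀₂ q₀₂ q₂₀) (cross-snoc (~⇒≢ e₁₂) p₁₂ q₁₂ q₂₁))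
        ([ (λ m → zero , suc (suc zero) , (λ ()) , m , a≁b₂) , (λ m → suc zero , suc (suc zero) , (λ ()) , m , a≁b₂) ]′ a≁)
      where
      b : Fin 3 → V
      b = three b₀ b₁ b₂
      A : Fin 3 → List V
      A = three A₀ A₁ A₂

    theta : ∀ {a b A₀ A₁ A₂} →
            Linked _~_ (a ∷ A₀ ++ [ b ]) → Linked _~_ (a ∷ A₁ ++ [ b ]) → Linked _~_ (a ∷ A₂ ++ [ b ]) →
            a ≢ b → ¬ a ~ b → A₀ ∥ A₁ → A₀ ∥ A₂ → A₁ ∥ A₂ → ⊥
    theta {a} {b} {A₀} {A₁} {A₂} l₀ l₁ l₂ a≢b a≁b p₀₁ p₀₂ p₁₂ =
      no-theta theta-free a≢b a≁b A (three l₀ l₁ l₂) (pairwise {R = λ i j → A i ∥ A j} ∥-sym p₀₁ p₀₂ p₁₂)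
      where
      A : Fin 3 → List V
      A = three A₀ A₁ A₂

    -- A pyramid with apex `x` and triangle `u y r`; its paths are the edge from `x` to `u` and the
    -- arcs of the cycle from `x` to `y` and to `r`.
    adjacent-pair-and-one : ∀ {u x y r I R} → Cycle (x ∷ I ++ y ∷ r ∷ R) → u ∉ x ∷ I ++ y ∷ r ∷ R → I ≢ [] → R ≢ [] →
                            u ~ x → u ~ y → u ~ r → nonadjacent u I → ¬ nonadjacent u R
    adjacent-pair-and-one {u} {x} {y} {r} {I} {R} c u∉ I≢ R≢ u~x u~y u~r u≁I u≁R =
      pyramid {A₀ = []} (~-sym u~x ∷ [-]) (cycle-walk I c) (cycle-walk-back (I ++ [ y ]) c′)
        (≢-sym (~⇒≢ u~x)) (proj₁ x∦y) (proj₁ x∦r)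
        u~y u~r (cycle-step (cycle-rotate (x ∷ I) c))
        (λ ()) (λ ()) (∥-mono ⊆-refl (reverse-⊆ R) (∥-mono ⊆-refl there I∥rR))
        (apart-from (u∉ ∘ there ∘ ∈-++⁺ˡ) u≁I)
        (∥-mono ⊆-refl (reverse-⊆ R) (apart-from (u∉ ∘ there ∘ ∈-++⁺ʳ I ∘ there ∘ there) u≁R))
        (λ _ ()) (∥-mono (∈-++⁺ʳ I) (reverse-⊆ R) Iy∥R)
        (λ _ ()) (∥-sym (∥-mono ⊆-refl (λ { (here refl) → here refl }) I∥rR))
        (proj₂ x∦r) (inj₂ (proj₂ x∦y))
      where
      P : Chordless (I ++ y ∷ r ∷ R)
      P = cycle-tail c
      c′ : Cycle (x ∷ (I ++ [ y ]) ++ r ∷ R)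
      c′ = subst (Cycle ∘ (x ∷_)) (sym (++-assoc I [ y ] (r ∷ R))) c
      I∥rR : I ∥ (r ∷ R)
      I∥rR = chordless-apart I P
      Iy∥R : (I ++ [ y ]) ∥ R
      Iy∥R = chordless-apart (I ++ [ y ]) (cycle-tail c′)
      x∦y : x ≢ y × ¬ x ~ y
      x∦y = cycle-apart I I≢ (λ ()) c
      x∦r : x ≢ r × ¬ x ~ r
      x∦r = cycle-apart (I ++ [ y ]) (snoc≢[] I) R≢ c′

    -- A vertex joined to a nonadjacent vertex by a walk

    module _ {w q : V} {T : List V} (w≢q : w ≢ q) (w≁q : ¬ w ~ q) (walk : Linked _~_ (w ∷ T ++ [ q ])) where

      -- A theta with ends `w` and `q`: its paths go through `p`, through `p′` and through `T`.
      two-separated-neighbours : ∀ {F p p′ E} → Linked _~_ (w ∷ F ++ [ p ]) → Linked _~_ (p′ ∷ E ++ [ w ]) →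
        (F ++ [ p ]) ∥ (p′ ∷ E) → T ∥ (F ++ [ p ]) → T ∥ (p′ ∷ E) → q ~ p → ¬ q ~ p′
      two-separated-neighbours {F} {p} {p′} {E} l l′ F∥E T∥F T∥E q~p q~p′ =
        theta {A₀ = F ++ [ p ]} {reverse (p′ ∷ E)} {T}
          (subst (Linked _~_ ∘ (w ∷_)) (sym (++-assoc F [ p ] [ q ])) (linked-join (w ∷ F) l (~-sym q~p ∷ [-])))
          (walk-back (p′ ∷ E) (q~p′ ∷ l′)) walk w≢q w≁q
          (∥-mono ⊆-refl (reverse-⊆ (p′ ∷ E)) F∥E) (∥-sym T∥F) (∥-mono (reverse-⊆ (p′ ∷ E)) ⊆-refl (∥-sym T∥E))

      -- If `w` and `p` were nonadjacent, they would be the ends of a theta with paths through `F`,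
      -- `E` and `T ++ [ q ]`.
      one-neighbour : ∀ {F p E} → Linked _~_ (w ∷ F ++ [ p ]) → Linked _~_ (p ∷ E ++ [ w ]) →
        F ∥ E → T ∥ F → T ∥ E → [ q ] ∥ F → [ q ] ∥ E → q ~ p → w ≢ p → w ~ p
      one-neighbour {F} {p} {E} l l′ F∥E T∥F T∥E q∥F q∥E q~p w≢p = decidable-stable (w ~? p) (λ w≁p →
        theta {A₀ = F} {reverse E} {T ++ [ q ]}
          l (walk-back E l′)
          (subst (Linked _~_ ∘ (w ∷_)) (sym (++-assoc T [ q ] [ p ])) (linked-join (w ∷ T) walk (q~p ∷ [-])))
          w≢p w≁p
          (∥-mono ⊆-refl (reverse-⊆ E) F∥E) (∥-sym (∥-++ˡ T∥F q∥F)) (∥-mono (reverse-⊆ E) ⊆-refl (∥-sym (∥-++ˡ T∥E q∥E))))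

      -- If `w` missed `p` or `p′`, there would be a pyramid with apex `w` and triangle `p p′ q`,
      -- whose path to `q` runs through `T`.
      two-adjacent-neighbours : ∀ {F p p′ E} → Linked _~_ (w ∷ F ++ [ p ]) → Linked _~_ (p′ ∷ E ++ [ w ]) →
        F ∥ (p′ ∷ E) → (F ++ [ p ]) ∥ E → p ~ p′ → T ∥ (F ++ [ p ]) → T ∥ (p′ ∷ E) → [ q ] ∥ F → [ q ] ∥ E →
        q ~ p → q ~ p′ → w ≢ p → w ≢ p′ → w ~ p × w ~ p′
      two-adjacent-neighbours {F} {p} {p′} {E} l l′ F∥p′E Fp∥E p~p′ T∥Fp T∥p′E q∥F q∥E q~p q~p′ w≢p w≢p′ =
        decidable-stable (w ~? p) (λ w≁p → pyr (inj₁ w≁p)) , decidable-stable (w ~? p′) (λ w≁p′ → pyr (inj₂ w≁p′))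
        where
        p∈ : [ p ] ⊆ F ++ [ p ]
        p∈ = ∈-++⁺ʳ F
        p′∈ : [ p′ ] ⊆ p′ ∷ E
        p′∈ = ∈-++⁺ˡ
        pyr : ¬ w ~ p ⊎ ¬ w ~ p′ → ⊥
        pyr = pyramid {A₀ = F} {reverse E} {T}
          l (walk-back E l′) walk w≢p w≢p′ w≢q p~p′ (~-sym q~p) (~-sym q~p′)
          (∥-mono ⊆-refl (there ∘ reverse-⊆ E) F∥p′E) (∥-sym (∥-mono ⊆-refl ∈-++⁺ˡ T∥Fp))
          (∥-mono (reverse-⊆ E) ⊆-refl (∥-sym (∥-mono ⊆-refl there T∥p′E)))
          (∥-mono p∈ (reverse-⊆ E) Fp∥E) (∥-sym (∥-mono ⊆-refl p∈ T∥Fp))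
          (∥-sym (∥-mono ⊆-refl p′∈ F∥p′E)) (∥-sym (∥-mono ⊆-refl p′∈ T∥p′E))
          q∥F (∥-mono ⊆-refl (reverse-⊆ E) q∥E) w≁q

      -- Since `T` joins `w` to `q` away from `S`, two neighbours of `q` on `S` that are not
      -- consecutive give a theta. So `q` has one neighbour there or two consecutive ones, and a
      -- theta or a pyramid forces these to be adjacent to `w`.
      neighbours-off-w : ∀ {S} → Chordless S → Linked _~_ (w ∷ S ++ [ w ]) → T ∥ S → q ∉ S → w ∉ S →
                         ∀ {s} → s ∈ S → q ~ s → w ~ s
      neighbours-off-w {S} ch l T∥S q∉ w∉ {s} s∈ q~s with first-split (q ~?_) (lose s∈ q~s)
      ... | F , p , M , refl , q~p , q≁F = second (any? (q ~?_) M)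
        where
        l₁ : Linked _~_ (w ∷ F ++ [ p ])
        l₁ = linked-++⁻ˡ (w ∷ F ++ [ p ]) (subst (Linked _~_ ∘ (w ∷_))
               (trans (++-assoc F (p ∷ M) [ w ]) (sym (++-assoc F [ p ] (M ++ [ w ])))) l)
        lM : Linked _~_ (p ∷ M ++ [ w ])
        lM = linked-++⁻ʳ (w ∷ F) (subst (Linked _~_ ∘ (w ∷_)) (++-assoc F (p ∷ M) [ w ]) l)
        Fp : F ++ [ p ] ⊆ F ++ p ∷ M
        Fp = ++⁺ {ws = F} ⊆-refl ∈-++⁺ˡ
        q∥F : [ q ] ∥ F
        q∥F = apart-from (q∉ ∘ ∈-++⁺ˡ) q≁F
        second : Dec (Any (q ~_) M) → w ~ s
        second (no ¬m) = where-s (∈-++⁻ F s∈)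
          where
          w~p : w ~ p
          w~p = one-neighbour l₁ lM (chordless-apart F ch) (∥-mono ⊆-refl ∈-++⁺ˡ T∥S)
            (∥-mono ⊆-refl (∈-++⁺ʳ F ∘ there) T∥S) q∥F
            (apart-from (q∉ ∘ ∈-++⁺ʳ F ∘ there) (λ v∈ e → ¬m (lose v∈ e))) q~p
            (λ { refl → w∉ (∈-++⁺ʳ F (here refl)) })
          where-s : s ∈ F ⊎ s ∈ p ∷ M → w ~ s
          where-s (inj₁ i)           = ⊥-elim (q≁F i q~s)
          where-s (inj₂ (here refl)) = w~p
          where-s (inj₂ (there i))   = ⊥-elim (¬m (lose i q~s))
        second (yes m) with first-split (q ~?_) m
        -- At least one vertex of `S` lies between the first two neighbours of `q`.
        ... | x ∷ X , p′ , E , refl , q~p′ , _ = ⊥-elim (two-separated-neighbours l₁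
          (linked-++⁻ʳ (p ∷ x ∷ X) (subst (Linked _~_ ∘ (p ∷_)) (++-assoc (x ∷ X) (p′ ∷ E) [ w ]) lM))
          (∥-mono ⊆-refl (∈-++⁺ʳ X) (chordless-apart (F ++ [ p ]) (subst Chordless (sym (++-assoc F [ p ] _)) ch)))
          (∥-mono ⊆-refl Fp T∥S) (∥-mono ⊆-refl (∈-++⁺ʳ F ∘ there ∘ ∈-++⁺ʳ (x ∷ X)) T∥S) q~p q~p′)
        ... | [] , p′ , E , refl , q~p′ , _ with any? (q ~?_) E
        ...   | yes e with first-split (q ~?_) e
        -- A third neighbour of `q` is separated from `p` by `p′`.
        ...     | X , p″ , E′ , refl , q~p″ , _ = ⊥-elim (two-separated-neighbours l₁
          (linked-++⁻ʳ (p ∷ p′ ∷ X) (subst (Linked _~_ ∘ (p ∷_)) (++-assoc (p′ ∷ X) (p″ ∷ E′) [ w ]) lM))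
          (∥-mono ⊆-refl (∈-++⁺ʳ X) (chordless-apart (F ++ [ p ]) (subst Chordless (sym (++-assoc F [ p ] _)) ch)))
          (∥-mono ⊆-refl Fp T∥S) (∥-mono ⊆-refl (∈-++⁺ʳ F ∘ there ∘ ∈-++⁺ʳ (p′ ∷ X)) T∥S) q~p q~p″)
        second (yes m) | [] , p′ , E , refl , q~p′ , _ | no ¬e = where-s (∈-++⁻ F s∈)
          where
          both : w ~ p × w ~ p′
          both = two-adjacent-neighbours l₁ (Linked.tail lM) (chordless-apart F ch)
            (chordless-apart (F ++ [ p ]) (subst Chordless (sym (++-assoc F [ p ] _)) ch))
            (chordless-step F ch) (∥-mono ⊆-refl Fp T∥S) (∥-mono ⊆-refl (∈-++⁺ʳ F ∘ there) T∥S) q∥F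
            (apart-from (q∉ ∘ ∈-++⁺ʳ F ∘ there ∘ there) (λ v∈ e → ¬e (lose v∈ e))) q~p q~p′
            (λ { refl → w∉ (∈-++⁺ʳ F (here refl)) }) (λ { refl → w∉ (∈-++⁺ʳ F (there (here refl))) })
          where-s : s ∈ F ⊎ s ∈ p ∷ p′ ∷ E → w ~ s
          where-s (inj₁ i)                   = ⊥-elim (q≁F i q~s)
          where-s (inj₂ (here refl))         = proj₁ both
          where-s (inj₂ (there (here refl))) = proj₂ both
          where-s (inj₂ (there (there i)))   = ⊥-elim (¬e (lose i q~s))

    walk-from : ∀ {w q L} → Linked _~_ (w ∷ L) → Any (q ~_) L → ∃[ T ] T ⊆ L × Linked _~_ (w ∷ T ++ [ q ])
    walk-from {w} {q} l nb with first-split (q ~?_) nb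
    ... | X , h , Y , refl , q~h , _ = X ++ [ h ] , ++⁺ {ws = X} ⊆-refl ∈-++⁺ˡ ,
      subst (Linked _~_ ∘ (w ∷_)) (sym (++-assoc X [ h ] [ q ]))
        (linked-join (w ∷ X) (linked-++⁻ˡ (w ∷ X ++ [ h ]) (subst (Linked _~_ ∘ (w ∷_)) (sym (++-assoc X [ h ] Y)) l))
          (~-sym q~h ∷ [-]))

    -- If the neighbour of `q` comes first on `L`, the walk is found from `q` to `w` and reversed.
    walk-through : ∀ {w q L} → Linked _~_ L → Any (w ~_) L → Any (q ~_) L →
                   ∃[ T ] T ⊆ L × Linked _~_ (w ∷ T ++ [ q ])
    walk-through l (here w~m) nb = walk-from (w~m ∷ l) nb
    walk-through {w} {q} l (there nb) (here q~m) with walk-from {q} {w} (q~m ∷ l) (there nb)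
    ... | T , T⊆ , l′ = reverse T , T⊆ ∘ reverse-⊆ T , walk-back T l′
    walk-through l (there nb) (there nb′) with walk-through (Linked.tail l) nb nb′
    ... | T , T⊆ , l′ = T , there ∘ T⊆ , l′

    -- Rerouting the hole, and its `w`-sectors

    module _ (H : Hole G) (w : Fin n) (major : Major H w) where

      -- The arc z … p and the path Q close up to a cycle on which w has exactly one neighbour (namely y) fewer
      -- than on the given cycle, so one of the two cycles contradicts even-degree.
      reroute : ∀ {z A p M y R Qᵢ q′ q Q′ a b} → Cycle ((z ∷ A ++ [ p ]) ++ M ++ y ∷ R) →
                w ∉ (z ∷ A ++ [ p ]) ++ M ++ y ∷ R → w ∉ Qᵢ ++ [ q′ ] →
                Qᵢ ++ [ q′ ] ≡ q ∷ Q′ → Chordless (Qᵢ ++ [ q′ ]) → q ~ p → q′ ~ z →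
                [ p ] ∥ Q′ → [ z ] ∥ Qᵢ → A ∥ (Qᵢ ++ [ q′ ]) →
                w ~ y → nonadjacent w M → nonadjacent w R → nonadjacent w (Qᵢ ++ [ q′ ]) →
                a ∈ z ∷ A ++ [ p ] → b ∈ z ∷ A ++ [ p ] → a ≢ b → ¬ a ~ b → w ~ a → w ~ b → ⊥
      reroute {z} {A} {p} {M} {y} {R} {Qᵢ} {q′} {q} {Q′} {a} {b} cy w∉ w∉Q Q≡ chQ q~p q′~z p∥Q′ z∥Qᵢ A∥Q
              w~y w≁M w≁R w≁Q a∈ b∈ a≢b a≁b w~a w~b =
        [ even-degree (newCycle Qᵢ Q≡ chQ z∥Qᵢ A∥Q) w∉new (∈-++⁺ʳ Q a∈) (∈-++⁺ʳ Q b∈) a≢b a≁b w~a w~b ∘ subst (2 ∣_) (sym degree-new)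
        , even-degree cy w∉ (∈-++⁺ˡ a∈) (∈-++⁺ˡ b∈) a≢b a≁b w~a w~b ∘ subst (2 ∣_) (sym degree-old)
        ]′ (even-or-suc-even (degree w arc))
        where
        arc Q : List V
        arc = z ∷ A ++ [ p ]
        Q = Qᵢ ++ [ q′ ]
        w∉new : w ∉ Q ++ arc
        w∉new i with ∈-++⁻ Q i
        ... | inj₁ j = w∉Q j
        ... | inj₂ j = w∉ (∈-++⁺ˡ j)
        degree-new : degree w (Q ++ arc) ≡ degree w arc
        degree-new = trans (degree-++ w Q arc) (cong (_+ degree w arc) (degree-none w≁Q))
        degree-old : degree w (arc ++ M ++ y ∷ R) ≡ suc (degree w arc)
        degree-old = trans (degree-++ w arc (M ++ y ∷ R)) (trans (cong (degree w arc +_)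
          (trans (degree-++ w M (y ∷ R)) (trans (cong (_+ degree w (y ∷ R)) (degree-none w≁M))
            (trans (degree-∷ R w~y) (cong suc (degree-none w≁R)))))) (ℕ.+-comm (degree w arc) 1))
        chArc : Chordless arc
        chArc = cycle-arc arc (nonempty M) cy
          where
          nonempty : ∀ M → M ++ y ∷ R ≢ []
          nonempty []      ()
          nonempty (_ ∷ _) ()
        -- The arc carries two distinct nonadjacent vertices, so it is more than the edge `z p`.
        -- This keeps the new cycle from being a triangle when `Q` is a single vertex.
        A≢[] : A ≢ []
        A≢[] refl = a≁b-in a∈ b∈
          where
          a≁b-in : a ∈ z ∷ p ∷ [] → b ∈ z ∷ p ∷ [] → ⊥
          a≁b-in (here refl)         (here refl)         = a≢b refl
          a≁b-in (here refl)         (there (here refl)) = a≁b (chordless-step [] chArc)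
          a≁b-in (there (here refl)) (here refl)         = a≁b (~-sym (chordless-step [] chArc))
          a≁b-in (there (here refl)) (there (here refl)) = a≢b refl
        newCycle : ∀ Qᵢ → Qᵢ ++ [ q′ ] ≡ q ∷ Q′ → Chordless (Qᵢ ++ [ q′ ]) → [ z ] ∥ Qᵢ → A ∥ (Qᵢ ++ [ q′ ]) →
                   Cycle ((Qᵢ ++ [ q′ ]) ++ arc)
        -- `Cycle` names the second vertex of the list, which is `z`, `q′` or an inner vertex of `Q`
        -- as `Q` has one, two or more vertices.
        newCycle [] refl _ _ A∥Q = record
          { shape = refl ; inner = A≢[] ; v~u = q′~z ; v~z = q~p ; apart = ∥-sym A∥Q ; path = chArc }
        newCycle (_ ∷ []) refl chQ z∥Qᵢ A∥Q = record
          { shape = refl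
          ; inner = λ ()
          ; v~u   = chordless-step [] chQ
          ; v~z   = q~p
          ; apart = ∥-∷ʳ (∥-sym z∥Qᵢ) (∥-mono (λ { (here refl) → here refl }) ⊆-refl (∥-sym A∥Q))
          ; path  = chordless-join [] [-] chArc q′~z (λ ())
              (∥-++ʳ (∥-sym (∥-mono ⊆-refl there A∥Q)) (∥-sym p∥Q′))
          }
        newCycle (_ ∷ q₂ ∷ N) refl chQ z∥Qᵢ A∥Q = record
          { shape = cong (λ L → q ∷ q₂ ∷ L) (sym (++-assoc (N ++ [ q′ ]) (z ∷ A) [ p ]))
          ; inner = nonempty N
          ; v~u   = chordless-step [] chQ
          ; v~z   = q~p
          ; apart = ∥-++ʳ (chordless-apart [ q ] chQ)
                      (∥-∷ʳ (∥-mono (λ { (here refl) → here refl }) ⊆-refl (∥-sym z∥Qᵢ))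
                            (∥-mono (λ { (here refl) → here refl }) ⊆-refl (∥-sym A∥Q)))
          ; path  = subst Chordless (sym eq)
              (chordless-join (q₂ ∷ N) (chordless-++⁻ʳ [ q ] chQ) chArc q′~z
                (∥-∷ʳ (∥-sym (∥-mono ⊆-refl there z∥Qᵢ))
                  (∥-++ʳ (∥-sym (∥-mono ⊆-refl (there ∘ ∈-++⁺ˡ) A∥Q)) (∥-sym (∥-mono ⊆-refl ∈-++⁺ˡ p∥Q′))))
                (∥-++ʳ (∥-sym (∥-mono ⊆-refl (∈-++⁺ʳ (q ∷ q₂ ∷ N)) A∥Q)) (∥-sym (∥-mono ⊆-refl (∈-++⁺ʳ (q₂ ∷ N)) p∥Q′))))
          }
          where
          nonempty : ∀ N → (N ++ [ q′ ]) ++ z ∷ A ≢ []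
          nonempty []      ()
          nonempty (_ ∷ _) ()
          eq : q₂ ∷ ((N ++ [ q′ ]) ++ z ∷ A) ++ [ p ] ≡ (q₂ ∷ N) ++ q′ ∷ arc
          eq = cong (q₂ ∷_) (trans (++-assoc (N ++ [ q′ ]) (z ∷ A) [ p ]) (++-assoc N [ q′ ] arc))

      -- Some way to write `H` as a list, with any start and direction. Recording `H` by its vertex
      -- set alone is what lets such lists be rotated and reversed.
      record Ring (L : List V) : Set where
        field
          isCycle  : Cycle L
          on       : ∀ {v} → v ∈ L → v On embed H
          complete : ∀ {v} → v On embed H → v ∈ L

        w∉ : w ∉ L
        w∉ i = Major.outside major (on i)

      ring-rotate : ∀ A {B} → Ring (A ++ B) → Ring (B ++ A)
      ring-rotate A {B} r = record
        { isCycle  = cycle-rotate A (Ring.isCycle r)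
        ; on       = Ring.on r ∘ ++-swap-⊆ B
        ; complete = ++-swap-⊆ A ∘ Ring.complete r
        }

      ring-reverse : ∀ {L} → Ring L → Ring (reverse L)
      ring-reverse {L} r = record
        { isCycle  = cycle-reverse (Ring.isCycle r)
        ; on       = Ring.on r ∘ reverse-⊆ L
        ; complete = reverse⁺ ∘ Ring.complete r
        }

      spread : ∀ {L a b c} → Ring L → Chordless (a ∷ b ∷ [ c ]) → a ∷ b ∷ [ c ] ⊆ L →
               ¬ (∀ {v} → v ∈ L → w ~ v → v ∈ a ∷ b ∷ [ c ])
      spread {L} {a} {b} {c} r ch ⊆L covers = Major.spread major (proj₁ Q , covered)
        where
        Q : Σ[ Q ∈ Path (cycle H) 2 ] (∀ i → at (embed H) (at Q i) ≡ lookup (a ∷ b ∷ [ c ]) i)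
        Q = factor (embed H) (toPath ch) (λ i → Ring.on r (⊆L (∈-lookup i)))
        covered : ∀ i → Adj G w (at (embed H) i) → i On proj₁ Q
        covered i p with ∈-index (covers (Ring.complete r (i , refl)) p)
        ... | k , eq = k , _↪_.injective (embed H) (trans (proj₂ Q k) eq)

      cycle-first-three : ∀ {a b P} → Cycle (a ∷ b ∷ P) → ∃[ c ] ∃[ P′ ] P ≡ c ∷ P′ × Chordless (a ∷ b ∷ [ c ])
      cycle-first-three record { M = [] ; inner = ne } = ⊥-elim (ne refl)
      cycle-first-three record { z = z ; M = m ∷ M ; shape = refl ; v~u = p ; apart = q ; path = c } =
        m , M ++ [ z ] , refl , link p (∥-mono ⊆-refl (λ { (here refl) → here refl }) q) (link (chordless-step [] c) (λ _ ()) [-])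

      spread-three : ∀ {a b c P} → Ring (a ∷ b ∷ c ∷ P) → ¬ nonadjacent w P
      spread-three {a} {b} {c} r w≁ with cycle-first-three (Ring.isCycle r)
      ... | _ , _ , refl , ch = spread r ch
        (λ { (here e) → here e ; (there (here e)) → there (here e) ; (there (there (here e))) → there (there (here e)) })
        (λ { (here e) _ → here e ; (there (here e)) _ → there (here e) ; (there (there (here e))) _ → there (there (here e))
           ; (there (there (there i))) p → ⊥-elim (w≁ i p) })

      spread-two : ∀ {a b P} → Ring (a ∷ b ∷ P) → ¬ nonadjacent w P
      spread-two r w≁ with cycle-first-three (Ring.isCycle r)
      ... | _ , _ , refl , _ = spread-three r (w≁ ∘ there)

      -- Start and direction are chosen to put the sector first; the rest `R` of `H` may contain
      -- further neighbours of `w`.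
      record SectorRing (x : V) (I : List V) (y : V) (R : List V) : Set where
        field
          ring : Ring (x ∷ I ++ y ∷ R)
          w~x  : w ~ x
          w~y  : w ~ y
          w≁I  : nonadjacent w I

        open Ring ring public

      mirror : ∀ {x I y R} → SectorRing x I y R → SectorRing y (reverse I) x (reverse R)
      mirror {x} {I} {y} {R} s = record
        { ring = subst Ring (cong (y ∷_) (++-assoc (reverse I) [ x ] (reverse R)))
                   (ring-rotate (reverse R) (subst Ring (reverse-two x I y R) (ring-reverse ring)))
        ; w~x  = w~y
        ; w~y  = w~x
        ; w≁I  = w≁I ∘ reverse-⊆ I
        }
        where open SectorRing s

      sector-path : ∀ {x I y R} → R ≢ [] → SectorRing x I y R → Chordless (x ∷ I ++ [ y ])
      sector-path {x} {I} {y} {R} R≢ s =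
        cycle-arc (x ∷ I ++ [ y ]) R≢ (subst (Cycle ∘ (x ∷_)) (sym (++-assoc I [ y ] R)) (SectorRing.isCycle s))

      degree-sector : ∀ {x I y R} → SectorRing x I y R → degree w (x ∷ I ++ y ∷ R) ≡ 2 + degree w R
      degree-sector {x} {I} {y} {R} s = trans (degree-∷ _ w~x) (cong suc (trans (degree-++ w I (y ∷ R))
        (trans (cong (_+ degree w (y ∷ R)) (degree-none w≁I)) (degree-∷ R w~y))))
        where open SectorRing s

      -- R is the part of H outside a w-sector, and R° is R without the two vertices next to that sector.
      record Outside (R : List V) : Set where
        constructor outside
        field
          {r₁ rₘ} : V
          {R°}    : List V
          shape   : R ≡ r₁ ∷ R° ++ [ rₘ ]
          meets   : Any (w ~_) R°

      private
        -- The neighbours of `w` on `H` would be `x`, `y` and `r`: three consecutive vertices if `I`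
        -- is empty, which majority forbids, and otherwise the situation of a pyramid.
        one-extra : ∀ {x I y r R} → SectorRing x I y (r ∷ R) → R ≢ [] → w ~ r → ¬ nonadjacent w R
        one-extra {I = []}    s _  w~r w≁ = spread-three (SectorRing.ring s) w≁
        one-extra {I = _ ∷ _} s R≢ w~r w≁ = adjacent-pair-and-one isCycle w∉ (λ ()) R≢ w~x w~y w~r w≁I w≁
          where open SectorRing s

        -- The only neighbours `x` and `y` of `w` would be consecutive, against majority, or
        -- nonadjacent, which gives a theta through `w`.
        no-extra : ∀ {x I y R} → SectorRing x I y R → R ≢ [] → ¬ nonadjacent w R
        no-extra {I = []} s _ w≁ = spread-two (SectorRing.ring s) w≁
        no-extra {I = i ∷ I} {R = R} s R≢ w≁ =
          even-degree isCycle w∉ (here refl) (∈-++⁺ʳ (_ ∷ i ∷ I) (here refl)) (proj₁ x∦y) (proj₂ x∦y) w~x w~y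
            (subst (2 ∣_) (sym (trans (degree-sector s) (cong (2 +_) (degree-none w≁)))) (divides 1 refl))
          where
          open SectorRing s
          x∦y = cycle-apart (i ∷ I) (λ ()) R≢ isCycle

      -- Otherwise `w` sees no vertex of `H` besides `x`, `y`, `r₁` and `rₘ`. That it sees at most
      -- one of `r₁` and `rₘ` is excluded by `no-extra` and `one-extra`. If it sees both, it has
      -- exactly four neighbours, of which `y` and `rₘ` are nonadjacent, and `even-degree` applies.
      -- If `R` has fewer than two vertices, majority fails.
      outside-meets : ∀ {x I y R} → SectorRing x I y R → Outside R
      outside-meets {x} {I} {y} {[]} s = ⊥-elim (spread-two (ring-rotate (x ∷ I) ring) w≁I)
        where open SectorRing s
      outside-meets {x} {I} {y} {r₁ ∷ []} s = ⊥-elim (spread-three (ring-rotate (x ∷ I) ring) w≁I)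
        where open SectorRing s
      outside-meets {x} {I} {y} {r₁ ∷ r₂ ∷ R} s with snoc-view r₂ R
      ... | R° , rₘ , eq rewrite eq = go (any? (w ~?_) R°) (w ~? r₁) (w ~? rₘ)
        where
        open SectorRing s
        ¬any : ¬ Any (w ~_) R° → nonadjacent w R°
        ¬any ¬a v∈ p = ¬a (lose v∈ p)
        snoc : nonadjacent w R° → ¬ w ~ rₘ → nonadjacent w (R° ++ [ rₘ ])
        snoc p q v∈ with ∈-++⁻ R° v∈
        ... | inj₁ i           = p i
        ... | inj₂ (here refl) = q
        mirrored : SectorRing y (reverse I) x (rₘ ∷ reverse (r₁ ∷ R°))
        mirrored = subst (SectorRing y (reverse I) x) (reverse-snoc (r₁ ∷ R°) rₘ) (mirror s)
        go : Dec (Any (w ~_) R°) → Dec (w ~ r₁) → Dec (w ~ rₘ) → Outside (r₁ ∷ R° ++ [ rₘ ])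
        go (yes p) _ _ = outside refl p
        go (no ¬p) (no w≁r₁) (no w≁rₘ) = ⊥-elim (no-extra s (λ ())
          (λ { (here refl) → w≁r₁ ; (there i) → snoc (¬any ¬p) w≁rₘ i }))
        go (no ¬p) (yes w~r₁) (no w≁rₘ) = ⊥-elim (one-extra s (snoc≢[] R°) w~r₁ (snoc (¬any ¬p) w≁rₘ))
        go (no ¬p) (no w≁r₁) (yes w~rₘ) = ⊥-elim (one-extra mirrored
          (λ e → snoc≢[] (reverse R°) (trans (sym (unfold-reverse r₁ R°)) e)) w~rₘ
          (λ i → [ (λ { refl → w≁r₁ }) , ¬any ¬p ]′ (uncons (reverse-⊆ (r₁ ∷ R°) i))))
          where
          uncons : ∀ {v} → v ∈ r₁ ∷ R° → v ≡ r₁ ⊎ v ∈ R°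
          uncons (here e)  = inj₁ e
          uncons (there i) = inj₂ i
        go (no ¬p) (yes w~r₁) (yes w~rₘ) = ⊥-elim (even-degree isCycle w∉
          (there (∈-++⁺ʳ I (here refl))) (there (∈-++⁺ʳ I (there (∈-++⁺ʳ (r₁ ∷ R°) (here refl)))))
          (proj₁ y∦rₘ) (proj₂ y∦rₘ) w~y w~rₘ
          (subst (2 ∣_) (sym (trans (degree-sector s) (cong (2 +_) (trans (degree-∷ _ w~r₁) (cong suc
            (trans (degree-++ w R° [ rₘ ]) (trans (cong (_+ degree w [ rₘ ]) (degree-none (¬any ¬p))) (degree-∷ [] w~rₘ))))))))
            (divides 2 refl)))
          where
          y∦rₘ : y ≢ rₘ × ¬ y ~ rₘ
          y∦rₘ = cycle-apart (r₁ ∷ R°) (λ ()) (λ ())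
            (subst (Cycle ∘ (y ∷_) ∘ (r₁ ∷_)) (++-assoc R° [ rₘ ] (x ∷ I)) (cycle-rotate (x ∷ I) isCycle))

      -- The neighbours of `x` on the cycle are `rₘ` and the successor of `x` in the list.
      far-end-apart : ∀ {x I y r₁ R° rₘ} → Cycle (x ∷ I ++ y ∷ r₁ ∷ R° ++ [ rₘ ]) → [ x ] ∥ R°
      far-end-apart {I = []} c = ∥-mono ⊆-refl there (proj₁ (proj₂ (proj₂ (proj₂ (cycle-view c)))))
      far-end-apart {x} {I = i ∷ I} {y} {r₁} {R°} {rₘ} c = ∥-mono ⊆-refl (∈-++⁺ʳ I ∘ there ∘ there) (proj₁ (proj₂ (proj₂ (proj₂
        (cycle-view (subst (Cycle ∘ (x ∷_) ∘ (i ∷_)) (sym (++-assoc I (y ∷ r₁ ∷ R°) [ rₘ ])) c))))))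

      -- Strictly between `p` and `z`, the hole has `y` and no other neighbour of `w`; `Q` replaces
      -- this part. The nonadjacent pair that `reroute` asks for is `x`, which lies on `F ++ [ p ]`,
      -- and the neighbour `t` of `w` from `outside-meets`, which comes at `z` or later because `w`
      -- sees nothing of `R₁`.
      reroute-sector : ∀ {x I y R F p M R₁ z R₂ Qᵢ q′ q Q′} → SectorRing x I y R →
                       x ∷ I ≡ F ++ p ∷ M → R ≡ R₁ ++ z ∷ R₂ → nonadjacent w R₁ →
                       Qᵢ ++ [ q′ ] ≡ q ∷ Q′ → Chordless (Qᵢ ++ [ q′ ]) → w ∉ Qᵢ ++ [ q′ ] → nonadjacent w (Qᵢ ++ [ q′ ]) →
                       q ~ p → q′ ~ z → [ p ] ∥ Q′ → [ z ] ∥ Qᵢ →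
                       R₂ ∥ (Qᵢ ++ [ q′ ]) → F ∥ (Qᵢ ++ [ q′ ]) → ⊥
      reroute-sector {x} {I} {y} {R} {F} {p} {M} {R₁} {z} {R₂} s I≡ refl w≁R₁ Q≡ chQ w∉Q w≁Q q~p q′~z p∥Q′ z∥Qᵢ R₂∥Q F∥Q
        with outside-meets s
      ... | outside {r₁} {rₘ} {R°} R≡ meets with find meets
      ...   | t , t∈R° , w~t =
        reroute (Ring.isCycle ring′) (Ring.w∉ ring′) w∉Q Q≡ chQ q~p q′~z p∥Q′ z∥Qᵢ (∥-++ˡ R₂∥Q F∥Q)
          w~y w≁M w≁R₁ w≁Q x∈ t∈ (proj₁ x∦t) (proj₂ x∦t) w~x w~t
        where
        open SectorRing s
        rotated : (z ∷ R₂) ++ (F ++ p ∷ M) ++ y ∷ R₁ ≡ (z ∷ (R₂ ++ F) ++ [ p ]) ++ M ++ y ∷ R₁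
        rotated = cong (z ∷_) (begin
          R₂ ++ (F ++ p ∷ M) ++ y ∷ R₁          ≡⟨ cong (R₂ ++_) (++-assoc F (p ∷ M) (y ∷ R₁)) ⟩
          R₂ ++ F ++ p ∷ M ++ y ∷ R₁            ≡⟨ ++-assoc R₂ F (p ∷ M ++ y ∷ R₁) ⟨
          (R₂ ++ F) ++ p ∷ M ++ y ∷ R₁          ≡⟨ ++-assoc (R₂ ++ F) [ p ] (M ++ y ∷ R₁) ⟨
          ((R₂ ++ F) ++ [ p ]) ++ M ++ y ∷ R₁   ∎)
          where open ≡-Reasoning
        ring′ : Ring ((z ∷ (R₂ ++ F) ++ [ p ]) ++ M ++ y ∷ R₁)
        ring′ = subst Ring rotated (ring-rotate ((F ++ p ∷ M) ++ y ∷ R₁)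
          (subst Ring (trans (cong (_++ y ∷ R₁ ++ z ∷ R₂) I≡) (sym (++-assoc (F ++ p ∷ M) (y ∷ R₁) (z ∷ R₂)))) ring))
        w≁M : nonadjacent w M
        w≁M = go F I≡
          where
          go : ∀ F → x ∷ I ≡ F ++ p ∷ M → nonadjacent w M
          go []      refl i = w≁I i
          go (_ ∷ F) refl i = w≁I (∈-++⁺ʳ F (there i))
        x∈ : x ∈ z ∷ (R₂ ++ F) ++ [ p ]
        x∈ = there (go F I≡)
          where
          go : ∀ F → x ∷ I ≡ F ++ p ∷ M → x ∈ (R₂ ++ F) ++ [ p ]
          go []      refl = ∈-++⁺ʳ (R₂ ++ []) (here refl)
          go (_ ∷ F) refl = ∈-++⁺ˡ (∈-++⁺ʳ R₂ (here refl))
        t∈ : t ∈ z ∷ (R₂ ++ F) ++ [ p ]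
        t∈ with ∈-++⁻ R₁ (subst (t ∈_) (sym R≡) (there (∈-++⁺ˡ t∈R°)))
        ... | inj₁ i           = ⊥-elim (w≁R₁ i w~t)
        ... | inj₂ (here e)    = here e
        ... | inj₂ (there i)   = there (∈-++⁺ˡ (∈-++⁺ˡ i))
        x∦t : x ≢ t × ¬ x ~ t
        x∦t = far-end-apart (subst (λ R → Cycle (x ∷ I ++ y ∷ R)) R≡ isCycle) (here refl) t∈R°

      -- A single vertex attached to H

      -- `Q` leads from the first neighbour of `q` on `x ∷ I` to `r`, the vertex after `y`. Were it
      -- anticomplete to the rest of `H`, it would bypass `y` as in `reroute-sector`.
      end-attached : ∀ {x I y r R Qᵢ q′ q Q′} → SectorRing x I y (r ∷ R) →
                     Qᵢ ++ [ q′ ] ≡ q ∷ Q′ → Chordless (Qᵢ ++ [ q′ ]) → w ∉ Qᵢ ++ [ q′ ] → nonadjacent w (Qᵢ ++ [ q′ ]) →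
                     Any (q ~_) (x ∷ I) → q ∉ x ∷ I → (x ∷ I) ∥ Q′ →
                     q′ ~ r → [ r ] ∥ Qᵢ → ¬ R ∥ (Qᵢ ++ [ q′ ])
      end-attached s Q≡ chQ w∉Q w≁Q nb q∉ xI∥Q′ q′~r r∥Qᵢ R∥Q with first-split (_ ~?_) nb
      ... | F , p , M , eq , q~p , q≁F =
        reroute-sector {F = F} {p} {M} {[]} s eq refl (λ ()) Q≡ chQ w∉Q w≁Q q~p q′~r
          (∥-mono (λ { (here refl) → subst (p ∈_) (sym eq) (∈-++⁺ʳ F (here refl)) }) ⊆-refl xI∥Q′) r∥Qᵢ R∥Q
          (subst (F ∥_) (sym Q≡) (∥-∷ʳ (∥-sym (apart-from (q∉ ∘ F⊆) q≁F)) (∥-mono F⊆ ⊆-refl xI∥Q′)))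
        where
        F⊆ : F ⊆ _ ∷ _
        F⊆ i = subst (_ ∈_) (sym eq) (∈-++⁺ˡ i)

      sector-walk : ∀ {x I y R} → R ≢ [] → SectorRing x I y R → Linked _~_ (w ∷ (x ∷ I ++ [ y ]) ++ [ w ])
      sector-walk {x} {I} {y} R≢ s = w~x ∷ subst (Linked _~_ ∘ (x ∷_)) (sym (++-assoc I [ y ] [ w ]))
        (linked-join (x ∷ I) (chordless⇒linked (sector-path R≢ s)) (~-sym w~y ∷ [-]))
        where open SectorRing s

      module _ {x I y R} (s : SectorRing x I y R) {r₁ R° rₘ} (R≡ : R ≡ r₁ ∷ R° ++ [ rₘ ]) where

        R≢[] : R ≢ []
        R≢[] R≡[] = nil≢cons (trans (sym R≡[]) R≡)
          where
          nil≢cons : [] ≢ r₁ ∷ R° ++ [ rₘ ]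
          nil≢cons ()

        private
          c : Cycle (x ∷ I ++ y ∷ r₁ ∷ R° ++ [ rₘ ])
          c = subst (λ R → Cycle (x ∷ I ++ y ∷ R)) R≡ (SectorRing.isCycle s)

        outer-path : Chordless (r₁ ∷ R° ++ [ rₘ ])
        outer-path = chordless-++⁻ʳ [ y ] (chordless-++⁻ʳ I (cycle-tail c))

        sector∥inner : (x ∷ I ++ [ y ]) ∥ R°
        sector∥inner = ∥-∷ˡ (far-end-apart c) (∥-mono ⊆-refl ∈-++⁺ˡ
          (chordless-apart (I ++ [ y ]) (subst Chordless (sym (++-assoc I [ y ] _)) (cycle-tail c))))

        inner-linked : Linked _~_ R°
        inner-linked = linked-++⁻ˡ R° (Linked.tail (chordless⇒linked outer-path))

        outer-split : ∀ {v} → v ∈ R → v ≡ r₁ ⊎ v ∈ R° ⊎ v ≡ rₘ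
        outer-split i with subst (_ ∈_) R≡ i
        ... | here e  = inj₁ e
        ... | there j with ∈-++⁻ R° j
        ...   | inj₁ k        = inj₂ (inj₁ k)
        ...   | inj₂ (here e) = inj₂ (inj₂ e)

        reverse-outer : reverse R ≡ rₘ ∷ reverse R° ++ [ r₁ ]
        reverse-outer = trans (cong reverse R≡) (trans (reverse-snoc (r₁ ∷ R°) rₘ) (cong (rₘ ∷_) (unfold-reverse r₁ R°)))

        -- If `q` had a neighbour in `R°`, a walk from `w` to `q` through `R°` would stay away from
        -- the sector, and `neighbours-off-w` would make the interior vertex `v` adjacent to `w`.
        interior-neighbour : ∀ {q v} → w ≢ q → ¬ w ~ q → q ∉ x ∷ I ++ [ y ] → Any (w ~_) R° →
                             v ∈ I → q ~ v → nonadjacent q R°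
        interior-neighbour w≢q w≁q q∉ meets v∈I q~v u∈ q~u with walk-through inner-linked meets (lose u∈ q~u)
        ... | T , T⊆ , walk = SectorRing.w≁I s v∈I
          (neighbours-off-w w≢q w≁q walk (sector-path R≢[] s) (sector-walk R≢[] s)
            (∥-sym (∥-mono ⊆-refl T⊆ sector∥inner)) q∉ (SectorRing.w∉ s ∘ sector⊆) (there (∈-++⁺ˡ v∈I)) q~v)
          where
          sector⊆ : x ∷ I ++ [ y ] ⊆ x ∷ I ++ y ∷ R
          sector⊆ = ∷⁺ʳ x (++⁺ {ws = I} ⊆-refl ∈-++⁺ˡ)

      module _ {q : V} (w≢q : w ≢ q) (w≁q : ¬ w ~ q) (q∉H : ¬ q On embed H) where

        private
          q∉ : ∀ {L} → Ring L → q ∉ L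
          q∉ r = q∉H ∘ Ring.on r

          q∉sector : ∀ {x I y R} → SectorRing x I y R → q ∉ x ∷ I ++ [ y ]
          q∉sector {I = I} s i = q∉ (SectorRing.ring s) (∷⁺ʳ _ (++⁺ {ws = I} ⊆-refl ∈-++⁺ˡ) i)

        -- Here the path of `end-attached` is the single vertex `q`.
        one-end : ∀ {x I y r R v} → SectorRing x I y (r ∷ R) → v ∈ I → q ~ v → q ~ r → ¬ nonadjacent q R
        one-end {I = I} s v∈I q~v q~r q≁R =
          end-attached {Qᵢ = []} s refl [-] (λ { (here e) → w≢q e }) (λ { (here refl) → w≁q }) (lose (there v∈I) q~v)
            (q∉ ring ∘ ∈-++⁺ˡ) (λ _ ()) q~r (λ _ ())
            (∥-sym (apart-from (q∉ ring ∘ there ∘ ∈-++⁺ʳ I ∘ there ∘ there) q≁R))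
          where open SectorRing s

        -- If `w` missed `r₁`, then `r₁` would be interior to the next sector, from `y` to some `z`,
        -- and `q` would attach to the interiors of two sectors. Applying `interior-neighbour` to
        -- both leaves `q` only four neighbours on `H`: the last vertex `u` of `I`, then `y`, `r₁`
        -- and `rₘ`. This contradicts `even-degree`, as `u` and `r₁` are nonadjacent.
        both-ends : ∀ {x I y R r₁ R° rₘ v} → SectorRing x I y R → R ≡ r₁ ∷ R° ++ [ rₘ ] → Any (w ~_) R° →
                    v ∈ I → q ~ v → q ~ r₁ → q ~ rₘ → w ~ r₁
        both-ends {x} {I} {y} {R} {r₁} {R°} {rₘ} {v} s R≡ meets v∈I q~v q~r₁ q~rₘ =
          decidable-stable (w ~? r₁) (λ w≁r₁ → impossible w≁r₁ (first-split (w ~?_) meets-R))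
          where
          open SectorRing s
          q≁R° : nonadjacent q R°
          q≁R° = interior-neighbour s R≡ w≢q w≁q (q∉sector s) meets v∈I q~v
          meets-R : Any (w ~_) R
          meets-R with find meets
          ... | t , t∈ , w~t = lose (subst (t ∈_) (sym R≡) (there (∈-++⁺ˡ t∈))) w~t
          impossible : ¬ w ~ r₁ → ∃[ J ] ∃[ z ] ∃[ R′ ] R ≡ J ++ z ∷ R′ × w ~ z × nonadjacent w J → ⊥
          impossible w≁r₁ ([] , z , R′ , eq , w~z , _) with trans (sym eq) R≡
          ... | refl = w≁r₁ w~z
          impossible w≁r₁ (_ ∷ J , z , [] , eq , w~z , w≁J) with ∷ʳ-injective (_ ∷ J) (r₁ ∷ R°) (trans (sym eq) R≡)
          ... | refl , _ with find meets
          ...   | t , t∈ , w~t = w≁J (there t∈) w~t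
          impossible w≁r₁ (j ∷ J , z , t ∷ R″ , refl , w~z , w≁J) with ∷-injective R≡ | snoc-I I v∈I
            where
            snoc-I : ∀ I → v ∈ I → ∃[ I′ ] ∃[ u ] I ≡ I′ ++ [ u ]
            snoc-I (i ∷ I) _ = snoc-view i I
          ... | refl , R′≡ | I′ , u , refl = even-degree isCycle (q∉ ring)
                  (there (∈-++⁺ˡ (∈-++⁺ʳ I′ (here refl)))) (there (∈-++⁺ʳ I (there (here refl))))
                  (proj₁ u∦r₁) (proj₂ u∦r₁) q~u q~r₁ (subst (2 ∣_) (sym degree≡4) (divides 2 refl))
            where
            next : SectorRing y (r₁ ∷ J) z ((t ∷ R″) ++ x ∷ I)
            next = record
              { ring = subst (Ring ∘ (y ∷_) ∘ (r₁ ∷_)) (++-assoc J (z ∷ t ∷ R″) (x ∷ I)) (ring-rotate (x ∷ I) ring)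
              ; w~x = w~y ; w~y = w~z ; w≁I = w≁J }
            q≁ : nonadjacent q (R″ ++ x ∷ I′)
            q≁ = interior-neighbour next {t} {R″ ++ x ∷ I′} {u} (cong (t ∷_) (sym (++-assoc R″ (x ∷ I′) [ u ])))
                   w≢q w≁q (q∉sector next) (lose (∈-++⁺ʳ R″ (here refl)) w~x) (here refl) q~r₁
            q~u : q ~ u
            q~u with ∈-++⁻ I′ v∈I
            ... | inj₁ i           = ⊥-elim (q≁ (∈-++⁺ʳ R″ (there i)) q~v)
            ... | inj₂ (here refl) = q~v
            near-y : Chordless (u ∷ y ∷ r₁ ∷ J ++ z ∷ t ∷ R″)
            near-y = chordless-++⁻ʳ I′ (subst Chordless (++-assoc I′ [ u ] _) (cycle-tail isCycle))
            u∦r₁ : u ≢ r₁ × ¬ u ~ r₁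
            u∦r₁ = chordless-apart [ u ] near-y (here refl) (here refl)
            -- Otherwise `u y r₁ q` is a square.
            q~y : q ~ y
            q~y = decidable-stable (q ~? y) (λ q≁y → no-square square-free
              (chordless-step [] near-y) (chordless-step [ u ] near-y) (~-sym q~r₁) q~u (proj₁ u∦r₁) (proj₂ u∦r₁)
              (λ { refl → w≁q w~y }) (≁-sym q≁y))
            degree≡4 : degree q (x ∷ I ++ y ∷ r₁ ∷ J ++ z ∷ t ∷ R″) ≡ 4
            degree≡4 = trans (degree-++ q (x ∷ I′ ++ [ u ]) _) (cong₂ _+_
              (trans (degree-++ q (x ∷ I′) [ u ]) (cong₂ _+_ (degree-none (q≁ ∘ ∈-++⁺ʳ R″)) (degree-∷ [] q~u)))
              (trans (degree-∷ _ q~y) (cong suc (trans (degree-∷ _ q~r₁) (cong suc (trans (cong (degree q) R′≡)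
                (trans (degree-++ q R° [ rₘ ]) (cong₂ _+_ (degree-none q≁R°) (degree-∷ [] q~rₘ)))))))))

        -- By `interior-neighbour`, `q` can see only `r₁` and `rₘ` in `R`. If it sees one of them,
        -- `H` can be rerouted through `q`. If it sees both, they are neighbours of `w` by
        -- `both-ends`, so `q r₁ w rₘ` is a square.
        interior-fits : ∀ {x I y R v} → SectorRing x I y R → v ∈ I → q ~ v → nonadjacent q R
        interior-fits {x} {I} {y} {R} {v} s v∈I q~v {h} h∈ q~h with outside-meets s
        ... | outside {r₁} {rₘ} {R°} R≡ meets = go (q ~? r₁) (q ~? rₘ)
          where
          q≁R° : nonadjacent q R°
          q≁R° = interior-neighbour s R≡ w≢q w≁q (q∉sector s) meets v∈I q~v
          meets′ : Any (w ~_) (reverse R°)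
          meets′ = reverse⁺ meets
          reversed : SectorRing y (reverse I) x (rₘ ∷ reverse R° ++ [ r₁ ])
          reversed = subst (SectorRing y (reverse I) x) (reverse-outer s R≡) (mirror s)
          R°-nonempty : ∃[ t ] ∃[ T ] R° ≡ t ∷ T
          R°-nonempty with find meets
          ... | _ , t∈ , _ = uncons t∈
            where
            uncons : ∀ {t T} → t ∈ T → ∃[ t ] ∃[ T′ ] T ≡ t ∷ T′
            uncons {T = t ∷ T} _ = t , T , refl
          r₁∦rₘ : r₁ ≢ rₘ × ¬ r₁ ~ rₘ
          r₁∦rₘ with R°-nonempty
          ... | t , T , refl = chordless-apart [ r₁ ] (outer-path s {R° = t ∷ T} R≡) (here refl) (∈-++⁺ʳ T (here refl))
          snoc : ∀ {z A} → nonadjacent q A → ¬ q ~ z → nonadjacent q (A ++ [ z ])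
          snoc {A = A} p r i with ∈-++⁻ A i
          ... | inj₁ j           = p j
          ... | inj₂ (here refl) = r
          go : Dec (q ~ r₁) → Dec (q ~ rₘ) → ⊥
          go (no q≁r₁) (no q≁rₘ) with outer-split s R≡ h∈
          ... | inj₁ refl        = q≁r₁ q~h
          ... | inj₂ (inj₁ h∈R°) = q≁R° h∈R° q~h
          ... | inj₂ (inj₂ refl) = q≁rₘ q~h
          go (yes q~r₁) (no q≁rₘ) = one-end (subst (SectorRing x I y) R≡ s) v∈I q~v q~r₁ (snoc q≁R° q≁rₘ)
          go (no q≁r₁) (yes q~rₘ) = one-end reversed (reverse⁺ v∈I) q~v q~rₘ (snoc (q≁R° ∘ reverse-⊆ R°) q≁r₁)
          go (yes q~r₁) (yes q~rₘ) = no-square square-free (~-sym q~r₁) q~rₘ (~-sym w~rₘ) w~r₁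
            (proj₁ r₁∦rₘ) (proj₂ r₁∦rₘ) (≢-sym w≢q) (≁-sym w≁q)
            where
            w~r₁ : w ~ r₁
            w~r₁ = both-ends s R≡ meets v∈I q~v q~r₁ q~rₘ
            w~rₘ : w ~ rₘ
            w~rₘ = both-ends reversed refl meets′ (reverse⁺ v∈I) q~v q~rₘ q~r₁

      -- Walks straddling two sectors

      -- A walk may run along H: a vertex of H on the walk counts as touched.
      Touch : List V → V → Set
      Touch Q h = Any (λ q → h ≡ q ⊎ q ~ h) Q

      FitsIn : List V → List V → Set
      FitsIn Q S = ∀ {h} → h On embed H → Touch Q h → h ∈ S

      Off : List V → Set
      Off Q = w ∉ Q × nonadjacent w Q

      off-⊆ : ∀ {Q Q′} → Q ⊆ Q′ → Off Q′ → Off Q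
      off-⊆ i (p , q) = p ∘ i , q ∘ i

      unfit : ∀ {Q S h q} → FitsIn Q S → h On embed H → h ∉ S → q ∈ Q → h ≢ q × ¬ h ~ q
      unfit fit on h∉ q∈ = (λ e → h∉ (fit on (lose q∈ (inj₁ e)))) , λ p → h∉ (fit on (lose q∈ (inj₂ (~-sym p))))

      touch-split : ∀ {Q q h} → Touch (Q ++ [ q ]) h → Touch Q h ⊎ h ≡ q ⊎ q ~ h
      touch-split {Q} t with find t
      ... | q , q∈ , p with ∈-++⁻ Q q∈
      ...   | inj₁ i           = inj₁ (lose i p)
      ...   | inj₂ (here refl) = inj₂ p

      first-touches : ∀ {a M b} → Linked _~_ (a ∷ M ++ [ b ]) → Touch (M ++ [ b ]) a
      first-touches {M = []}    (p ∷ _) = here (inj₂ (~-sym p))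
      first-touches {M = _ ∷ _} (p ∷ _) = here (inj₂ (~-sym p))

      reverse-init-⊆ : ∀ (a : V) M → reverse M ++ [ a ] ⊆ a ∷ M
      reverse-init-⊆ a M = ++-⊆ (there ∘ reverse-⊆ M) λ { (here e) → here e }

      reverse-tail-⊆ : ∀ M (b : V) → b ∷ reverse M ⊆ M ++ [ b ]
      reverse-tail-⊆ M b (here e)  = ∈-++⁺ʳ M (here e)
      reverse-tail-⊆ M b (there i) = ∈-++⁺ˡ (reverse-⊆ M i)

      -- A vertex of the walk that is missing from one of the two parts is an end of the walk, and
      -- its neighbour on the walk lies in that part.
      self-touches : ∀ {a M b q} → Linked _~_ (a ∷ M ++ [ b ]) → q ∈ a ∷ M ++ [ b ] →
                     Touch (a ∷ M) q × Touch (M ++ [ b ]) q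
      self-touches l (here refl) = here (inj₁ refl) , first-touches l
      self-touches {a} {M} l (there i) with ∈-++⁻ M i
      ... | inj₁ j           = lose (there j) (inj₁ refl) , lose (∈-++⁺ˡ j) (inj₁ refl)
      ... | inj₂ (here refl) = Any-resp-⊆ (reverse-init-⊆ a M) (first-touches (walk-back M l)) ,
                               lose (∈-++⁺ʳ M (here refl)) (inj₁ refl)

      -- What a shortest counterexample looks like from the two sectors in which its two shorter
      -- parts fit.
      record Straddling (q : V) (M : List V) (q′ : V) (S₁ S₂ : List V) : Set where
        field
          walk : Linked _~_ (q ∷ M ++ [ q′ ])
          off  : Off (q ∷ M ++ [ q′ ])
          fit₁ : FitsIn (q ∷ M) S₁
          fit₂ : FitsIn (M ++ [ q′ ]) S₂
          not₁ : ¬ FitsIn (q ∷ M ++ [ q′ ]) S₁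
          not₂ : ¬ FitsIn (q ∷ M ++ [ q′ ]) S₂

        ends-differ : q ≢ q′
        ends-differ refl = not₁ (λ on t → fit₁ on (Any-resp-⊆ (λ { (here e) → here e ; (there i) →
          [ there , (λ { (here e) → here e }) ]′ (∈-++⁻ M i) }) t))

        short : ∃[ N ] N ⊆ M × Chordless (q ∷ N ++ [ q′ ])
        short = shortcut q M q′ walk ends-differ

        outside-H : (∀ {h} → h ∈ S₁ → h ∈ S₂ → w ~ h) → ∀ {v} → v ∈ q ∷ M ++ [ q′ ] → ¬ v On embed H
        outside-H common v∈ on with self-touches walk v∈
        ... | t₁ , t₂ = proj₂ off v∈ (common (fit₁ on t₁) (fit₂ on t₂))

        whole : ∀ {h} → Touch (q ∷ M ++ [ q′ ]) h → Touch (q ∷ M) h ⊎ Touch (M ++ [ q′ ]) h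
        whole (here p)  = inj₁ (here p)
        whole (there t) = inj₂ t

        -- If `q` saw nothing of `P`, every vertex of `H` touched by `q` would already lie in `S₂`,
        -- and so the whole walk would fit in `S₂`.
        attaches₁ : (∀ {v} → v ∈ q ∷ M ++ [ q′ ] → ¬ v On embed H) →
                    (∀ {P} → (∀ {h} → h ∈ S₁ → h ∈ S₂ ⊎ h ∈ P) → Any (q ~_) P)
        attaches₁ q∉H {P} part = decidable-any (λ ¬any → not₂ (λ on t → [ (λ { (here (inj₁ refl)) → ⊥-elim (q∉H (here refl) on)
            ; (here (inj₂ p)) → [ (λ i → i) , (λ i → ⊥-elim (¬any (lose i p))) ]′ (part (fit₁ on (here (inj₂ p))))
            ; (there t) → fit₂ on (Any-resp-⊆ ∈-++⁺ˡ t) }) , fit₂ on ]′ (whole t)))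
          where
          decidable-any : ¬ ¬ Any (q ~_) P → Any (q ~_) P
          decidable-any = decidable-stable (any? (q ~?_) P)

      straddling-reverse : ∀ {q M q′ S₁ S₂} → Straddling q M q′ S₁ S₂ → Straddling q′ (reverse M) q S₂ S₁
      straddling-reverse {q} {M} {q′} s = record
        { walk = walk-back M walk
        ; off  = off-⊆ same off
        ; fit₁ = λ on t → fit₂ on (Any-resp-⊆ (reverse-tail-⊆ M q′) t)
        ; fit₂ = λ on t → fit₁ on (Any-resp-⊆ (reverse-init-⊆ q M) t)
        ; not₁ = λ f → not₂ (λ on t → f on (Any-resp-⊆ same⁻ t))
        ; not₂ = λ f → not₁ (λ on t → f on (Any-resp-⊆ same⁻ t))
        }
        where
        open Straddling s
        same : q′ ∷ reverse M ++ [ q ] ⊆ q ∷ M ++ [ q′ ]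
        same = ++-⊆ {xs = q′ ∷ reverse M} (there ∘ reverse-tail-⊆ M q′) (λ { (here e) → here e })
        same⁻ : q ∷ M ++ [ q′ ] ⊆ q′ ∷ reverse M ++ [ q ]
        same⁻ (here e)  = there (∈-++⁺ʳ (reverse M) (here e))
        same⁻ (there i) with ∈-++⁻ M i
        ... | inj₁ j           = there (∈-++⁺ˡ (reverse⁺ j))
        ... | inj₂ (here refl) = here refl

      -- The hole is rerouted around the common end `y`. It leaves `x ∷ I` at the first neighbour of
      -- `q` and returns at the last neighbour of `q′` on `J ++ [ z ]`, so that the kept parts `F`
      -- and `R₂` of the sectors are anticomplete to the path; `W` is so because it is disjoint from
      -- both sectors.
      consecutive-sectors : ∀ {x I y J z W q M q′} → SectorRing x I y (J ++ z ∷ W) → nonadjacent w J →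
                            ¬ Straddling q M q′ (x ∷ I ++ [ y ]) (y ∷ J ++ [ z ])
      consecutive-sectors {x} {I} {y} {J} {z} {W} {q} {M} {q′} s w≁J st =
        go (first-split (q ~?_) (attaches₁ on∉ (λ i → [ inj₂ , (λ { (here e) → inj₁ (here e) }) ]′ (∈-++⁻ (x ∷ I) i))))
           (last-split (q′ ~?_) (Straddling.attaches₁ (straddling-reverse st) on∉ʳ
             (λ { (here e) → inj₁ (∈-++⁺ʳ (x ∷ I) (here e)) ; (there i) → inj₂ i })))
        where
        open SectorRing s
        open Straddling st
        S₁ S₂ : List V
        S₁ = x ∷ I ++ [ y ]
        S₂ = y ∷ J ++ [ z ]
        unique : Unique (x ∷ I ++ y ∷ J ++ z ∷ W)
        unique = cycle⇒unique isCycle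
        S₂⊆ : S₂ ⊆ y ∷ J ++ z ∷ W
        S₂⊆ = ∷⁺ʳ y (++⁺ {ws = J} ⊆-refl ∈-++⁺ˡ)
        xI∉S₂ : ∀ {v} → v ∈ x ∷ I → v ∉ S₂
        xI∉S₂ i = unique-++-disjoint (x ∷ I) unique i ∘ S₂⊆
        S₁∉R : ∀ {v} → v ∈ J ++ z ∷ W → v ∉ S₁
        S₁∉R i j = unique-++-disjoint S₁ (subst Unique (cong (x ∷_) (sym (++-assoc I [ y ] _))) unique) j i
        W∉S₂ : ∀ {v} → v ∈ W → v ∉ S₂
        W∉S₂ i j = unique-++-disjoint (x ∷ I ++ S₂)
          (subst Unique (cong (x ∷_) (trans (cong (λ L → I ++ y ∷ L) (sym (++-assoc J [ z ] W))) (sym (++-assoc I S₂ W)))) unique)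
          (there (∈-++⁺ʳ I j)) i
        S₁∩S₂ : ∀ {h} → h ∈ S₁ → h ∈ S₂ → w ~ h
        S₁∩S₂ i j with ∈-++⁻ (x ∷ I) i
        ... | inj₁ k           = ⊥-elim (xI∉S₂ k j)
        ... | inj₂ (here refl) = w~y
        on∉ : ∀ {v} → v ∈ q ∷ M ++ [ q′ ] → ¬ v On embed H
        on∉ = outside-H S₁∩S₂
        on∉ʳ : ∀ {v} → v ∈ q′ ∷ reverse M ++ [ q ] → ¬ v On embed H
        on∉ʳ = Straddling.outside-H (straddling-reverse st) (λ i j → S₁∩S₂ j i)
        go : ∃[ F ] ∃[ p ] ∃[ B ] x ∷ I ≡ F ++ p ∷ B × q ~ p × nonadjacent q F →
             ∃[ R₁ ] ∃[ z′ ] ∃[ R₂ ] J ++ [ z ] ≡ R₁ ++ z′ ∷ R₂ × q′ ~ z′ × nonadjacent q′ R₂ → ⊥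
        go (F , p , B , I≡ , q~p , q≁F) (R₁ , z′ , R₂ , J≡ , q′~z′ , q′≁R₂) with short
        ... | N , N⊆ , chN =
          reroute-sector {F = F} {p} {B} {R₁} {z′} {R₂ ++ W} {q ∷ N} {q′} {q} {N ++ [ q′ ]} s I≡
            (trans (sym (++-assoc J [ z ] W)) (trans (cong (_++ W) J≡) (++-assoc R₁ (z′ ∷ R₂) W)))
            (w≁J ∘ prefix-⊆-init R₁ (sym J≡)) refl chN (proj₁ off ∘ Q⊆) (proj₂ off ∘ Q⊆) q~p q′~z′
            (λ { (here refl) i → unfit fit₂ (on (∈-++⁺ˡ p∈)) (xI∉S₂ p∈) (Q′⊆ i) })
            (λ { (here refl) i → unfit fit₁ (on (inR (z′∈ (here refl)))) (S₁∉R (⊆R (z′∈ (here refl)))) (Qᵢ⊆ i) })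
            (∥-++ˡ R₂∥Q W∥Q) F∥Q
          where
          Q′⊆ : N ++ [ q′ ] ⊆ M ++ [ q′ ]
          Q′⊆ = ++⁺ N⊆ ⊆-refl
          Qᵢ⊆ : q ∷ N ⊆ q ∷ M
          Qᵢ⊆ = ∷⁺ʳ q N⊆
          Q⊆ : q ∷ N ++ [ q′ ] ⊆ q ∷ M ++ [ q′ ]
          Q⊆ = ∷⁺ʳ q Q′⊆
          F⊆ : F ⊆ x ∷ I
          F⊆ i = subst (_ ∈_) (sym I≡) (∈-++⁺ˡ i)
          p∈ : p ∈ x ∷ I
          p∈ = subst (p ∈_) (sym I≡) (∈-++⁺ʳ F (here refl))
          z′∈ : z′ ∷ R₂ ⊆ J ++ [ z ]
          z′∈ i = subst (_ ∈_) (sym J≡) (∈-++⁺ʳ R₁ i)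
          ⊆R : J ++ [ z ] ⊆ J ++ z ∷ W
          ⊆R = ++⁺ {ws = J} ⊆-refl ∈-++⁺ˡ
          inR : ∀ {v} → v ∈ J ++ [ z ] → v ∈ x ∷ I ++ y ∷ J ++ z ∷ W
          inR i = there (∈-++⁺ʳ I (there (⊆R i)))
          R₂∥Q : R₂ ∥ (q ∷ N ++ [ q′ ])
          R₂∥Q i = ∥-++ʳ {R₂} {q ∷ N}
            (λ k l → unfit fit₁ (on (inR (z′∈ (there k)))) (S₁∉R (⊆R (z′∈ (there k)))) (Qᵢ⊆ l))
            (λ { k (here refl) → (λ { refl → on∉ (there (∈-++⁺ʳ M (here refl))) (on (inR (z′∈ (there k)))) }) , ≁-sym (q′≁R₂ k) }) i
          W∈ : ∀ {v} → v ∈ W → v ∈ J ++ z ∷ W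
          W∈ = ∈-++⁺ʳ J ∘ there
          W∥Q : W ∥ (q ∷ N ++ [ q′ ])
          W∥Q i = ∥-++ʳ {W} {q ∷ N}
            (λ k l → unfit fit₁ (on (there (∈-++⁺ʳ I (there (W∈ k))))) (S₁∉R (W∈ k)) (Qᵢ⊆ l))
            (λ { k (here refl) → unfit fit₂ (on (there (∈-++⁺ʳ I (there (W∈ k))))) (W∉S₂ k) (∈-++⁺ʳ M (here refl)) }) i
          F∥Q : F ∥ (q ∷ N ++ [ q′ ])
          F∥Q = ∥-∷ʳ
            (λ { k (here refl) → (λ { refl → on∉ (here refl) (on (∈-++⁺ˡ (F⊆ k))) }) , ≁-sym (q≁F k) })
            (λ k l → unfit fit₂ (on (∈-++⁺ˡ (F⊆ k))) (xI∉S₂ (F⊆ k)) (Q′⊆ l))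

      -- Disjoint sectors

      -- How `q` meets a sector decides its role: a single neighbour can be an end of a theta or the
      -- apex of a pyramid, two consecutive ones form a triangle with `q`, and a wide attachment
      -- gives `q` two separated routes along the sector.
      data Narrow (q : V) (S : List V) : Set where
        single : ∀ F {a} E → S ≡ F ++ a ∷ E → q ~ a → nonadjacent q F → nonadjacent q E → Narrow q S
        pair   : ∀ F {a a′} E → S ≡ F ++ a ∷ a′ ∷ E → q ~ a → q ~ a′ → nonadjacent q F → nonadjacent q E → Narrow q S

      Wide : V → List V → Set
      Wide q S = ∃[ F ] ∃[ p ] ∃[ b ] ∃[ B ] ∃[ p′ ] ∃[ E ] S ≡ F ++ p ∷ b ∷ B ++ p′ ∷ E × q ~ p × q ~ p′

      narrow-or-wide : ∀ {q S} → Any (q ~_) S → Narrow q S ⊎ Wide q S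
      narrow-or-wide {q} nb with first-split (q ~?_) nb
      ... | F , a , M , refl , q~a , q≁F with any? (q ~?_) M
      ...   | no ¬m = inj₁ (single F M refl q~a q≁F (λ i p → ¬m (lose i p)))
      ...   | yes m with first-split (q ~?_) m
      ...     | b ∷ B , p′ , E , refl , q~p′ , _ = inj₂ (F , a , b , B , p′ , E , refl , q~a , q~p′)
      ...     | [] , a′ , E , refl , q~a′ , _ with any? (q ~?_) E
      ...       | no ¬e = inj₁ (pair F E refl q~a q~a′ q≁F (λ i p → ¬e (lose i p)))
      ...       | yes e with first-split (q ~?_) e
      ...         | B , p′ , E′ , refl , q~p′ , _ = inj₂ (F , a , a′ , B , p′ , E′ , refl , q~a , q~p′)

      attachments : ∀ {q S} → Narrow q S → List V
      attachments (single _ {a} _ _ _ _ _)      = [ a ]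
      attachments (pair _ {a} {a′} _ _ _ _ _ _) = a ∷ [ a′ ]

      narrow-neighbour : ∀ {q S h} (ν : Narrow q S) → h ∈ S → q ~ h → h ∈ attachments ν
      narrow-neighbour (single F E refl _ q≁F q≁E) h∈ p with ∈-++⁻ F h∈
      ... | inj₁ i         = ⊥-elim (q≁F i p)
      ... | inj₂ (here e)  = here e
      ... | inj₂ (there i) = ⊥-elim (q≁E i p)
      narrow-neighbour (pair F E refl _ _ q≁F q≁E) h∈ p with ∈-++⁻ F h∈
      ... | inj₁ i                 = ⊥-elim (q≁F i p)
      ... | inj₂ (here e)          = here e
      ... | inj₂ (there (here e))  = there (here e)
      ... | inj₂ (there (there i)) = ⊥-elim (q≁E i p)

      -- If both ends of the list lie in the segment from `x` to `y`, this segment is the whole list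
      -- and `R°` is its interior `I`.
      cannot-span : ∀ {x I y r₁ R° rₘ} U W → U ++ x ∷ I ++ y ∷ W ≡ r₁ ∷ R° ++ [ rₘ ] → Unique (U ++ x ∷ I ++ y ∷ W) →
                    r₁ ∈ x ∷ I ++ [ y ] → rₘ ∈ x ∷ I ++ [ y ] → nonadjacent w I → ¬ Any (w ~_) R°
      cannot-span {I = I} (u ∷ U) W eq uniq r₁∈ _ _ _ with ∷-injective eq
      ... | refl , _ = unique-++-disjoint [ u ] uniq (here refl) (∈-++⁺ʳ U (∷⁺ʳ _ (++⁺ {ws = I} ⊆-refl ∈-++⁺ˡ) r₁∈))
      cannot-span {x} {I} {y} {r₁} {R°} [] [] eq _ _ _ w≁I meets with ∷-injective eq
      ... | refl , eq′ with ∷ʳ-injective I R° eq′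
      ...   | refl , _ with find meets
      ...     | t , t∈ , w~t = w≁I t∈ w~t
      cannot-span {x} {I} {y} {r₁} {R°} {rₘ} [] (v ∷ W) eq uniq _ rₘ∈ _ _ with snoc-view v W
      ... | W′ , z , W≡ = unique-++-disjoint (x ∷ I ++ [ y ])
          (subst Unique (cong (x ∷_) (sym (++-assoc I [ y ] (v ∷ W)))) uniq) rₘ∈
          (subst (rₘ ∈_) (sym W≡) (subst (λ u → rₘ ∈ W′ ++ [ u ]) (sym z≡rₘ) (∈-++⁺ʳ W′ (here refl))))
        where
        z≡rₘ : z ≡ rₘ
        z≡rₘ = proj₂ (∷ʳ-injective (x ∷ I ++ y ∷ W′) (r₁ ∷ R°)
          (trans (cong (x ∷_) (++-assoc I (y ∷ W′) [ z ])) (trans (cong (λ W → x ∷ I ++ y ∷ W) (sym W≡)) eq)))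

      -- `U` or `W` may be empty, so an end of one sector may be adjacent to an end of the other.
      -- `no-edge` takes care of this: a walk that touches only those two vertices would give no
      -- theta.
      record Apart (x₁ : V) (I₁ : List V) (y₁ : V) (U : List V) (x₂ : V) (I₂ : List V) (y₂ : V) (W : List V)
                   (q : V) (M : List V) (q′ : V) : Set where
        field
          sector     : SectorRing x₁ I₁ y₁ (U ++ x₂ ∷ I₂ ++ y₂ ∷ W)
          w~x₂       : w ~ x₂
          w~y₂       : w ~ y₂
          w≁I₂       : nonadjacent w I₂
          straddling : Straddling q M q′ (x₁ ∷ I₁ ++ [ y₁ ]) (x₂ ∷ I₂ ++ [ y₂ ])
          no-edge    : ∀ {a b} → a On embed H → b On embed H → a ~ b → ¬ FitsIn (q ∷ M ++ [ q′ ]) (a ∷ [ b ])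

        S₁ S₂ Q R : List V
        S₁ = x₁ ∷ I₁ ++ [ y₁ ]
        S₂ = x₂ ∷ I₂ ++ [ y₂ ]
        Q  = q ∷ M ++ [ q′ ]
        R  = U ++ x₂ ∷ I₂ ++ y₂ ∷ W

        open SectorRing sector public using (ring; on; w∉; w~x; w~y; w≁I; isCycle)
        open Straddling straddling public

        w≢q : w ≢ q
        w≢q e = proj₁ off (here e)

        w≁q : ¬ w ~ q
        w≁q = proj₂ off (here refl)

        unique : Unique (S₁ ++ R)
        unique = subst Unique (cong (x₁ ∷_) (sym (++-assoc I₁ [ y₁ ] R))) (cycle⇒unique isCycle)

        S₂⊆R : S₂ ⊆ R
        S₂⊆R i = ∈-++⁺ʳ U (∷⁺ʳ x₂ (++⁺ {ws = I₂} ⊆-refl ∈-++⁺ˡ) i)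

        S₁∌R : ∀ {v} → v ∈ R → v ∉ S₁
        S₁∌R i j = unique-++-disjoint S₁ unique j i

        S₂∌S₁ : ∀ {v} → v ∈ S₁ → v ∉ S₂
        S₂∌S₁ i j = S₁∌R (S₂⊆R j) i

        on-S₁ : ∀ {v} → v ∈ S₁ → v On embed H
        on-S₁ i = on (∷⁺ʳ x₁ (++⁺ {ws = I₁} ⊆-refl ∈-++⁺ˡ) i)

        on-R : ∀ {v} → v ∈ R → v On embed H
        on-R i = on (there (∈-++⁺ʳ I₁ (there i)))

        off-H : ∀ {v} → v ∈ Q → ¬ v On embed H
        off-H = outside-H (λ i j → ⊥-elim (S₂∌S₁ i j))

        tail∥S₁ : (M ++ [ q′ ]) ∥ S₁
        tail∥S₁ = ∥-sym (λ i j → unfit fit₂ (on-S₁ i) (S₂∌S₁ i) j)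

        init∥R : (q ∷ M) ∥ R
        init∥R = ∥-sym (λ i j → unfit fit₁ (on-R i) (S₁∌R i) j)

        first-attached : Any (q ~_) S₁
        first-attached = attaches₁ off-H inj₂

        split-ring : Ring (S₁ ++ U ++ S₂ ++ W)
        split-ring = subst Ring (trans (cong (x₁ ∷_) (sym (++-assoc I₁ [ y₁ ] R)))
          (cong (λ L → S₁ ++ U ++ x₂ ∷ L) (sym (++-assoc I₂ [ y₂ ] W)))) ring

        -- A vertex of `H` touched by an inner vertex of the walk would lie in both sectors, which
        -- are disjoint; so only `q` and `q′` touch `H`.
        touches : (ν₁ : Narrow q S₁) (ν₂ : Narrow q′ S₂) → FitsIn Q (attachments ν₁ ++ attachments ν₂)
        touches ν₁ ν₂ h-on t = [ by-init , by-tail ]′ (whole t)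
          where
          by-tail : Touch (M ++ [ q′ ]) _ → _
          by-tail t with touch-split {M} t
          ... | inj₁ t′              = ⊥-elim (S₂∌S₁ (fit₁ h-on (there t′)) (fit₂ h-on t))
          ... | inj₂ (inj₁ refl)     = ⊥-elim (off-H (there (∈-++⁺ʳ M (here refl))) h-on)
          ... | inj₂ (inj₂ p)        = ∈-++⁺ʳ (attachments ν₁) (narrow-neighbour ν₂ (fit₂ h-on t) p)
          by-init : Touch (q ∷ M) _ → _
          by-init (here (inj₁ refl)) = ⊥-elim (off-H (here refl) h-on)
          by-init (here (inj₂ p))    = ∈-++⁺ˡ (narrow-neighbour ν₁ (fit₁ h-on (here (inj₂ p))) p)
          by-init (there t)          = ⊥-elim (S₂∌S₁ (fit₁ h-on (there t)) (fit₂ h-on (Any-resp-⊆ ∈-++⁺ˡ t)))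

      swap-apart : ∀ {x₁ I₁ y₁ U x₂ I₂ y₂ W q M q′} → Apart x₁ I₁ y₁ U x₂ I₂ y₂ W q M q′ →
                   Apart x₂ I₂ y₂ W x₁ I₁ y₁ U q′ (reverse M) q
      swap-apart {x₁} {I₁} {y₁} {U} {x₂} {I₂} {y₂} {W} {q} {M} {q′} d = record
        { sector = record
          { ring = subst Ring (cong (x₂ ∷_) (++-assoc I₂ (y₂ ∷ W) (x₁ ∷ I₁ ++ y₁ ∷ U)))
              (ring-rotate (x₁ ∷ I₁ ++ y₁ ∷ U) (subst Ring (cong (x₁ ∷_) (sym (++-assoc I₁ (y₁ ∷ U) _))) ring))
          ; w~x  = w~x₂
          ; w~y  = w~y₂
          ; w≁I  = w≁I₂
          }
        ; w~x₂ = w~x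
        ; w~y₂ = w~y
        ; w≁I₂ = w≁I
        ; straddling = straddling-reverse straddling
        ; no-edge = λ a-on b-on p f → no-edge a-on b-on p (λ on t → f on (Any-resp-⊆ Q⊆ t))
        }
        where
        open Apart d
        Q⊆ : Q ⊆ q′ ∷ reverse M ++ [ q ]
        Q⊆ (here e)  = there (∈-++⁺ʳ (reverse M) (here e))
        Q⊆ (there i) with ∈-++⁻ M i
        ... | inj₁ j           = there (∈-++⁺ˡ (reverse⁺ j))
        ... | inj₂ (here refl) = here refl

      -- If `q′` has a neighbour in `R°`, then `w` and `q` are the ends of a theta with two paths
      -- along `S₁` and the third through `R°` and the walk. Otherwise `q′` sees at most `r₁` and
      -- `rₘ` in `R`: just one of them gives a rerouting by `end-attached`, and both cannot lie in
      -- `S₂`.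
      not-wide : ∀ {x₁ I₁ y₁ U x₂ I₂ y₂ W q M q′} → Apart x₁ I₁ y₁ U x₂ I₂ y₂ W q M q′ →
                 ¬ Wide q (x₁ ∷ I₁ ++ [ y₁ ])
      not-wide {x₁} {I₁} {y₁} {U} {x₂} {I₂} {y₂} {W} {q} {M} {q′} d (F , p , b , B , p′ , E , S₁≡ , q~p , q~p′)
        with outside-meets (Apart.sector d)
      ... | outside {r₁} {rₘ} {R°} R≡ meets = go (any? (q′ ~?_) R°) (q′ ~? r₁) (q′ ~? rₘ)
        where
        open Apart d
        second-attached : Any (q′ ~_) S₂
        second-attached = Apart.first-attached (swap-apart d)
        inR : r₁ ∷ R° ++ [ rₘ ] ⊆ R
        inR i = subst (_ ∈_) (sym R≡) i
        -- As `p` precedes `p′` on `S₁`, it is not `y₁`, and `p′` is not `x₁`. The first fact is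
        -- needed to bypass `y₁`, the second to bypass `x₁`.
        p∈ : p ∈ x₁ ∷ I₁
        p∈ = prefix-⊆-init (F ++ [ p ]) (trans (++-assoc F [ p ] _) (sym S₁≡)) (∈-++⁺ʳ F (here refl))
        p′∈ : p′ ∈ y₁ ∷ reverse I₁
        p′∈ = rotated (after F S₁≡)
          where
          after : ∀ F → x₁ ∷ I₁ ++ [ y₁ ] ≡ F ++ p ∷ b ∷ B ++ p′ ∷ E → p′ ∈ I₁ ++ [ y₁ ]
          after []      eq = subst (p′ ∈_) (sym (proj₂ (∷-injective eq))) (there (∈-++⁺ʳ B (here refl)))
          after (_ ∷ F) eq = subst (p′ ∈_) (sym (proj₂ (∷-injective eq))) (∈-++⁺ʳ F (there (there (∈-++⁺ʳ B (here refl)))))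
          rotated : p′ ∈ I₁ ++ [ y₁ ] → p′ ∈ y₁ ∷ reverse I₁
          rotated i = [ there ∘ reverse⁺ , (λ { (here e) → here e }) ]′ (∈-++⁻ I₁ i)
        end : ∀ {x I y r R′} → SectorRing x I y (r ∷ R′) → x ∷ I ⊆ S₁ → r ∷ R′ ⊆ R → Any (q ~_) (x ∷ I) →
              q′ ~ r → ¬ nonadjacent q′ R′
        end {R′ = R′} s I⊆ R⊆ nb q′~r q′≁R′ with short
        ... | N , N⊆ , chN = end-attached {Qᵢ = q ∷ N} {q′} s refl chN (proj₁ off ∘ Q⊆) (proj₂ off ∘ Q⊆) nb
            (off-H (here refl) ∘ on-S₁ ∘ I⊆)
            (∥-sym (∥-mono (++⁺ N⊆ ⊆-refl) I⊆ tail∥S₁)) q′~r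
            (∥-sym (∥-mono (∷⁺ʳ q N⊆) (λ { (here refl) → R⊆ (here refl) }) init∥R))
            (∥-++ʳ {B = q ∷ N} (∥-sym (∥-mono (∷⁺ʳ q N⊆) (R⊆ ∘ there) init∥R))
              (∥-sym (apart-from (off-H (there (∈-++⁺ʳ M (here refl))) ∘ on-R ∘ R⊆ ∘ there) q′≁R′)))
          where
          Q⊆ : q ∷ N ++ [ q′ ] ⊆ q ∷ M ++ [ q′ ]
          Q⊆ = ∷⁺ʳ q (++⁺ N⊆ ⊆-refl)
        snoc : ∀ {z A} → nonadjacent q′ A → ¬ q′ ~ z → nonadjacent q′ (A ++ [ z ])
        snoc {A = A} e f i with ∈-++⁻ A i
        ... | inj₁ j           = e j
        ... | inj₂ (here refl) = f
        I₁⊆ : ∀ {v} → v ∈ I₁ → v ∈ S₁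
        I₁⊆ = there ∘ ∈-++⁺ˡ
        go : Dec (Any (q′ ~_) R°) → Dec (q′ ~ r₁) → Dec (q′ ~ rₘ) → ⊥
        go (yes nb) _ _ with walk-through (inner-linked sector R≡) meets nb
        ... | T , T⊆ , l = two-separated-neighbours {T = T ++ q′ ∷ reverse M} w≢q w≁q
            (subst (Linked _~_ ∘ (w ∷_)) (sym (++-assoc T (q′ ∷ reverse M) [ q ])) (linked-join (w ∷ T) l (walk-back M walk)))
            (linked-++⁻ˡ (w ∷ F ++ [ p ]) (subst (Linked _~_ ∘ (w ∷_))
              (trans (++-assoc F (p ∷ X) [ w ]) (sym (++-assoc F [ p ] (X ++ [ w ])))) closed))
            (linked-++⁻ʳ (w ∷ F ++ p ∷ b ∷ B) (subst (Linked _~_ ∘ (w ∷_))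
              (trans (++-assoc F (p ∷ X) [ w ]) (trans (cong (λ L → F ++ p ∷ b ∷ L) (++-assoc B (p′ ∷ E) [ w ]))
                (sym (++-assoc F (p ∷ b ∷ B) (p′ ∷ E ++ [ w ]))))) closed))
            (∥-mono ⊆-refl (∈-++⁺ʳ B) (chordless-apart (F ++ [ p ]) (subst Chordless (sym (++-assoc F [ p ] X)) chS)))
            (∥-mono ⊆-refl (λ i → subst (_ ∈_) (trans (++-assoc F [ p ] X) (sym S₁≡)) (∈-++⁺ˡ i)) T∥)
            (∥-mono ⊆-refl (λ i → subst (_ ∈_) (sym S₁≡) (∈-++⁺ʳ F (there (there (∈-++⁺ʳ B i))))) T∥)
            q~p q~p′
          where
          X : List V
          X = b ∷ B ++ p′ ∷ E
          closed : Linked _~_ (w ∷ (F ++ p ∷ X) ++ [ w ])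
          closed = subst (λ S → Linked _~_ (w ∷ S ++ [ w ])) S₁≡ (sector-walk (R≢[] sector R≡) sector)
          chS : Chordless (F ++ p ∷ X)
          chS = subst Chordless S₁≡ (sector-path (R≢[] sector R≡) sector)
          T∥ : (T ++ q′ ∷ reverse M) ∥ S₁
          T∥ = ∥-++ˡ (∥-sym (∥-mono ⊆-refl T⊆ (sector∥inner sector R≡))) (∥-mono (reverse-tail-⊆ M q′) ⊆-refl tail∥S₁)
        go (no ¬nb) (yes a) (yes c) = cannot-span U W R≡ uniqueR
            (fit₂ (on-R (inR (here refl))) (lose (∈-++⁺ʳ M (here refl)) (inj₂ a)))
            (fit₂ (on-R (inR rₘ∈)) (lose (∈-++⁺ʳ M (here refl)) (inj₂ c))) w≁I₂ meets
          where
          rₘ∈ : rₘ ∈ r₁ ∷ R° ++ [ rₘ ]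
          rₘ∈ = there (∈-++⁺ʳ R° (here refl))
          uniqueR : Unique R
          uniqueR = subst Unique (sym R≡) (chordless⇒unique (outer-path sector R≡))
        go (no ¬nb) (yes a) (no c) = end (subst (SectorRing x₁ I₁ y₁) R≡ sector) ∈-++⁺ˡ inR (lose p∈ q~p) a
          (snoc (λ i e → ¬nb (lose i e)) c)
        go (no ¬nb) (no a) (yes c) = end (subst (SectorRing y₁ (reverse I₁) x₁) (reverse-outer sector R≡) (mirror sector))
          (λ { (here refl) → there (∈-++⁺ʳ I₁ (here refl)) ; (there i) → I₁⊆ (reverse-⊆ I₁ i) })
          (λ i → reverse-⊆ R (subst (_ ∈_) (sym (reverse-outer sector R≡)) i))
          (lose p′∈ q~p′) c (snoc (λ i e → ¬nb (lose (reverse-⊆ R° i) e)) a)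
        go (no ¬nb) (no a) (no c) with find second-attached
        ... | h , h∈ , q′~h with outer-split sector R≡ (S₂⊆R h∈)
        ...   | inj₁ refl        = a q′~h
        ...   | inj₂ (inj₁ i)    = ¬nb (lose i q′~h)
        ...   | inj₂ (inj₂ refl) = c q′~h

      rotate-two : ∀ F₁ {a} E₁ U F₂ {b} E₂ W → Ring ((F₁ ++ a ∷ E₁) ++ U ++ (F₂ ++ b ∷ E₂) ++ W) →
                   Ring (a ∷ (E₁ ++ U ++ F₂) ++ b ∷ (E₂ ++ W ++ F₁))
      rotate-two F₁ {a} E₁ U F₂ {b} E₂ W r = subst Ring eq
        (ring-rotate F₁ (subst Ring (++-assoc F₁ (a ∷ E₁) _) r))
        where
        open ≡-Reasoning
        eq : (a ∷ E₁ ++ U ++ (F₂ ++ b ∷ E₂) ++ W) ++ F₁ ≡ a ∷ (E₁ ++ U ++ F₂) ++ b ∷ (E₂ ++ W ++ F₁)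
        eq = cong (a ∷_) (begin
          (E₁ ++ U ++ (F₂ ++ b ∷ E₂) ++ W) ++ F₁    ≡⟨ cong (λ L → (E₁ ++ U ++ L) ++ F₁) (++-assoc F₂ (b ∷ E₂) W) ⟩
          (E₁ ++ U ++ F₂ ++ b ∷ E₂ ++ W) ++ F₁      ≡⟨ cong (λ L → (E₁ ++ L) ++ F₁) (++-assoc U F₂ _) ⟨
          (E₁ ++ (U ++ F₂) ++ b ∷ E₂ ++ W) ++ F₁    ≡⟨ cong (_++ F₁) (++-assoc E₁ (U ++ F₂) _) ⟨
          ((E₁ ++ U ++ F₂) ++ b ∷ E₂ ++ W) ++ F₁    ≡⟨ ++-assoc (E₁ ++ U ++ F₂) (b ∷ E₂ ++ W) F₁ ⟩
          (E₁ ++ U ++ F₂) ++ b ∷ (E₂ ++ W) ++ F₁    ≡⟨ cong (λ L → (E₁ ++ U ++ F₂) ++ b ∷ L) (++-assoc E₂ W F₁) ⟩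
          (E₁ ++ U ++ F₂) ++ b ∷ E₂ ++ W ++ F₁      ∎)

      fits⇒∥ : ∀ {Q K A} → FitsIn Q K → (∀ {v} → v ∈ A → v On embed H × v ∉ K) → A ∥ Q
      fits⇒∥ fit A∉K i j with A∉K i
      ... | on , v∉ = unfit fit on v∉ j

      module _ {a A b B} (r : Ring (a ∷ A ++ b ∷ B)) where

        private
          u : Unique (a ∷ A ++ b ∷ B)
          u = cycle⇒unique (Ring.isCycle r)

          u′ : Unique (b ∷ B ++ a ∷ A)
          u′ = cycle⇒unique (cycle-rotate (a ∷ A) (Ring.isCycle r))

        cut≢ : a ≢ b
        cut≢ refl = unique-++-disjoint [ a ] u (here refl) (∈-++⁺ʳ A (here refl))

        left-arc : ∀ {v} → v ∈ A → v On embed H × v ∉ a ∷ b ∷ B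
        left-arc i = Ring.on r (there (∈-++⁺ˡ i)) , λ
          { (here refl) → unique-++-disjoint [ a ] u (here refl) (∈-++⁺ˡ i)
          ; (there j)   → unique-++-disjoint (a ∷ A) u (there i) j }

        right-arc : ∀ {v} → v ∈ B → v On embed H × v ∉ b ∷ a ∷ A
        right-arc i = Ring.on r (there (∈-++⁺ʳ A (there i))) , λ
          { (here refl) → unique-++-disjoint [ b ] u′ (here refl) (∈-++⁺ˡ i)
          ; (there j)   → unique-++-disjoint (b ∷ B) u′ (there i) j }

      shift : ∀ {a A b b′ B} → Ring (a ∷ A ++ b ∷ b′ ∷ B) → Ring (a ∷ (A ++ [ b ]) ++ b′ ∷ B)
      shift {a} {A} {b} {b′} {B} = subst (Ring ∘ (a ∷_)) (sym (++-assoc A [ b ] (b′ ∷ B)))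

      module _ {x₁ I₁ y₁ U x₂ I₂ y₂ W q M q′} (d : Apart x₁ I₁ y₁ U x₂ I₂ y₂ W q M q′) where

        open Apart d

        q′∈ : q′ ∈ M ++ [ q′ ]
        q′∈ = ∈-++⁺ʳ M (here refl)

        -- A theta with ends `a` and `b`, whose paths are the two arcs of `H` and the walk.
        single-single : ∀ {a A b B} → Ring (a ∷ A ++ b ∷ B) → q ~ a → q′ ~ b → ¬ FitsIn Q (a ∷ [ b ])
        single-single {a} {A} {b} {B} r q~a q′~b fit =
          theta {a} {b} {A} {reverse B} {Q} (cycle-walk A c) (cycle-walk-back A c)
            (subst (Linked _~_ ∘ (a ∷_) ∘ (q ∷_)) (sym (++-assoc M [ q′ ] [ b ]))
              (~-sym q~a ∷ linked-join (q ∷ M) walk (q′~b ∷ [-])))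
            (cut≢ r) (λ p → no-edge a-on b-on p fit)
            (∥-mono ⊆-refl (reverse-⊆ B) (cycle-arcs∥ A c))
            (fits⇒∥ fit (λ i → proj₁ (left-arc r i) , proj₂ (left-arc r i) ∘ two))
            (∥-mono (reverse-⊆ B) ⊆-refl (fits⇒∥ fit (λ i → proj₁ (right-arc r i) , proj₂ (right-arc r i) ∘ two′)))
          where
          c = Ring.isCycle r
          a-on = Ring.on r (here refl)
          b-on = Ring.on r (there (∈-++⁺ʳ A (here refl)))
          two : a ∷ [ b ] ⊆ a ∷ b ∷ B
          two = ∷⁺ʳ a ∈-++⁺ˡ
          two′ : a ∷ [ b ] ⊆ b ∷ a ∷ A
          two′ (here e)         = there (here e)
          two′ (there (here e)) = here e

        -- A pyramid with apex `a` and triangle `b b′ q′`. Its path through `q` is long, and one of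
        -- the other two is because `H` has no triangle, so `a` is not adjacent to both `b` and
        -- `b′`.
        single-pair : ∀ {a A b b′ B} → Ring (a ∷ A ++ b ∷ b′ ∷ B) → a ∈ S₁ → b ∈ S₂ → b′ ∈ S₂ →
                      q ~ a → q′ ~ b → q′ ~ b′ → ¬ FitsIn Q (a ∷ b ∷ [ b′ ])
        single-pair {a} {A} {b} {b′} {B} r a∈ b∈ b′∈ q~a q′~b q′~b′ fit =
          pyramid {a} {b} {b′} {q′} {A} {reverse B} {q ∷ M}
            (cycle-walk A c) (cycle-walk-back (A ++ [ b ]) c′) (~-sym q~a ∷ walk)
            (cut≢ r) (cut≢ (shift {A = A} r)) (λ { refl → off-H (there q′∈) a-on })
            b~b′ (~-sym q′~b) (~-sym q′~b′)
            (∥-mono ⊆-refl (there ∘ reverse-⊆ B) (cycle-arcs∥ A c))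
            (∥-mono ⊆-refl Qᵢ⊆ A∥Q) (∥-mono (reverse-⊆ B) Qᵢ⊆ B∥Q)
            (∥-mono ⊆-refl (reverse-⊆ B) (chordless-apart [ b ] bb′B)) (b∥init b∈)
            (∥-sym (∥-mono ⊆-refl (λ { (here refl) → here refl }) (cycle-arcs∥ A c))) (b∥init b′∈)
            (∥-sym (∥-mono ⊆-refl (λ { (here refl) → there q′∈ }) A∥Q))
            (∥-sym (∥-mono (reverse-⊆ B) (λ { (here refl) → there q′∈ }) B∥Q))
            (proj₂ (unfit fit₂ a-on (S₂∌S₁ a∈) q′∈))
            (not-both (a ~? b))
          where
          c = Ring.isCycle r
          c′ = Ring.isCycle (shift {A = A} r)
          a-on = Ring.on r (here refl)
          Qᵢ⊆ : q ∷ M ⊆ Q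
          Qᵢ⊆ = ∷⁺ʳ q ∈-++⁺ˡ
          bb′B : Chordless (b ∷ b′ ∷ B)
          bb′B = chordless-++⁻ʳ A (cycle-tail c)
          b~b′ : b ~ b′
          b~b′ = chordless-step [] bb′B
          A∥Q : A ∥ Q
          A∥Q = fits⇒∥ fit (λ i → proj₁ (left-arc r i) , proj₂ (left-arc r i) ∘
            λ { (here e) → here e ; (there (here e)) → there (here e) ; (there (there (here e))) → there (there (here e)) })
          B∥Q : B ∥ Q
          B∥Q = fits⇒∥ fit (λ i → proj₁ (right-arc (shift {A = A} r) i) , proj₂ (right-arc (shift {A = A} r) i) ∘
            λ { (here e) → there (here e) ; (there (here e)) → there (there (∈-++⁺ʳ A (here e))) ; (there (there (here e))) → here e })
          b∥init : ∀ {v} → v ∈ S₂ → [ v ] ∥ (q ∷ M)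
          b∥init i = ∥-sym (∥-mono ⊆-refl (λ { (here refl) → S₂⊆R i }) init∥R)
          not-both : Dec (a ~ b) → ¬ a ~ b ⊎ ¬ a ~ b′
          not-both (no ¬p) = inj₁ ¬p
          not-both (yes p) = inj₂ (λ p′ → cycle-no-triangle c (here refl) (there (∈-++⁺ʳ A (here refl)))
            (there (∈-++⁺ʳ A (there (here refl)))) p p′ b~b′)

        -- A prism with triangles `q a′ a` and `q′ b b′`; its paths are the walk, the arc from `a′`
        -- to `b` and the arc from `a` to `b′`.
        pair-pair : ∀ {a a′ A b b′ B} → Ring (a ∷ a′ ∷ A ++ b ∷ b′ ∷ B) → a ∈ S₁ → a′ ∈ S₁ → b ∈ S₂ → b′ ∈ S₂ →
                    q ~ a → q ~ a′ → q′ ~ b → q′ ~ b′ → ¬ FitsIn Q (a ∷ a′ ∷ b ∷ [ b′ ])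
        pair-pair {a} {a′} {A} {b} {b′} {B} r a∈ a′∈ b∈ b′∈ q~a q~a′ q′~b q′~b′ fit =
          no-prism prism-free s t (three ends-differ a′≢b (cut≢ {A = a′ ∷ A ++ [ b ]} {b′} {B} (shift {A = a′ ∷ A} r))) N
            (three walk (linked-++⁻ˡ (a′ ∷ A ++ [ b ]) (subst (Linked _~_ ∘ (a′ ∷_)) (sym (++-assoc A [ b ] (b′ ∷ B)))
                          (chordless⇒linked (cycle-tail c))))
                        (cycle-walk-back (a′ ∷ A ++ [ b ]) c′))
            (pairwise {R = λ i j → s i ~ s j} ~-sym q~a′ q~a (~-sym a~a′))
            (pairwise {R = λ i j → t i ~ t j} ~-sym q′~b q′~b′ b~b′)
            (pairwise {R = CrossEnds} cross-ends-sym cross₀₁ cross₀₂ cross₁₂)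
          where
          c = Ring.isCycle r
          c′ = Ring.isCycle (shift {A = a′ ∷ A} r)
          s t : Fin 3 → V
          s = three q a′ a
          t = three q′ b b′
          N : Fin 3 → List V
          N = three M A (reverse B)
          CrossEnds : Fin 3 → Fin 3 → Set
          CrossEnds i j = ∀ {u v} → u ∈ s i ∷ N i ++ [ t i ] → v ∈ s j ∷ N j ++ [ t j ] →
            u ≢ v × (u ~ v → (u ≡ s i × v ≡ s j) ⊎ (u ≡ t i × v ≡ t j))
          cross-ends-sym : ∀ {i j} → CrossEnds i j → CrossEnds j i
          cross-ends-sym f v∈ u∈ with f u∈ v∈
          ... | ne , g = ≢-sym ne , λ p → [ (λ (e , e′) → inj₁ (e′ , e)) , (λ (e , e′) → inj₂ (e′ , e)) ]′ (g (~-sym p))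
          on-ring : ∀ {v} → v ∈ a ∷ a′ ∷ A ++ b ∷ b′ ∷ B → v On embed H
          on-ring = Ring.on r
          bb′B : Chordless (b ∷ b′ ∷ B)
          bb′B = chordless-++⁻ʳ (a′ ∷ A) (cycle-tail c)
          b~b′ : b ~ b′
          b~b′ = chordless-step [] bb′B
          a~a′ : a ~ a′
          a~a′ = cycle-step c
          a′≢b : a′ ≢ b
          a′≢b refl = S₂∌S₁ a′∈ b∈
          A∥Q : A ∥ Q
          A∥Q = fits⇒∥ fit (λ i → on-ring (there (there (∈-++⁺ˡ i))) , λ
            { (here refl)                         → unique-++-disjoint (a ∷ [ a′ ]) u (here refl) (∈-++⁺ˡ i)
            ; (there (here refl))                 → unique-++-disjoint (a ∷ [ a′ ]) u (there (here refl)) (∈-++⁺ˡ i)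
            ; (there (there (here refl)))         → unique-++-disjoint (a ∷ a′ ∷ A) u (there (there i)) (here refl)
            ; (there (there (there (here refl)))) → unique-++-disjoint (a ∷ a′ ∷ A) u (there (there i)) (there (here refl)) })
            where u = cycle⇒unique c
          B∥Q : B ∥ Q
          B∥Q = fits⇒∥ fit (λ i → on-ring (there (there (∈-++⁺ʳ A (there (there i))))) , λ
            { (here refl)                         → unique-++-disjoint (b ∷ b′ ∷ B) u (there (there i)) (here refl)
            ; (there (here refl))                 → unique-++-disjoint (b ∷ b′ ∷ B) u (there (there i)) (there (here refl))
            ; (there (there (here refl)))         → unique-++-disjoint (b ∷ [ b′ ]) u (here refl) (∈-++⁺ˡ i)
            ; (there (there (there (here refl)))) → unique-++-disjoint (b ∷ [ b′ ]) u (there (here refl)) (∈-++⁺ˡ i) })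
            where u = cycle⇒unique (cycle-rotate (a ∷ a′ ∷ A) c)
          start : ∀ {v u} → v ∈ S₁ → u ∈ Q → u ≢ v × (u ~ v → u ≡ q)
          start v∈ u∈ = (λ { refl → off-H u∈ (on-S₁ v∈) }) , λ p → only u∈ p
            where
            only : ∀ {u} → u ∈ Q → u ~ _ → u ≡ q
            only (here e)  _ = e
            only (there i) p = ⊥-elim (proj₂ (tail∥S₁ i v∈) p)
          finish : ∀ {v u} → v ∈ S₂ → u ∈ Q → u ≢ v × (u ~ v → u ≡ q′)
          finish v∈ u∈ = (λ { refl → off-H u∈ (on-R (S₂⊆R v∈)) }) , λ p → only (∈-++⁻ (q ∷ M) u∈) p
            where
            only : ∀ {u} → u ∈ q ∷ M ⊎ u ∈ [ q′ ] → u ~ _ → u ≡ q′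
            only (inj₂ (here e)) _ = e
            only (inj₁ i)        p = ⊥-elim (proj₂ (init∥R i (S₂⊆R v∈)) p)
          against : ∀ {a₀ b₀ X} → a₀ ∈ S₁ → b₀ ∈ S₂ → X ∥ Q → ∀ {u v} → u ∈ Q → v ∈ a₀ ∷ X ++ [ b₀ ] →
                    u ≢ v × (u ~ v → (u ≡ q × v ≡ a₀) ⊎ (u ≡ q′ × v ≡ b₀))
          against a₀∈ b₀∈ X∥Q u∈ (here refl) = proj₁ (start a₀∈ u∈) , λ p → inj₁ (proj₂ (start a₀∈ u∈) p , refl)
          against {X = X} a₀∈ b₀∈ X∥Q u∈ (there i) with ∈-++⁻ X i
          ... | inj₁ j           = ≢-sym (proj₁ (X∥Q j u∈)) , λ p → ⊥-elim (proj₂ (X∥Q j u∈) (~-sym p))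
          ... | inj₂ (here refl) = proj₁ (finish b₀∈ u∈) , λ p → inj₂ (proj₂ (finish b₀∈ u∈) p , refl)
          cross₀₁ : CrossEnds zero (suc zero)
          cross₀₁ = against a′∈ b∈ A∥Q
          cross₀₂ : CrossEnds zero (suc (suc zero))
          cross₀₂ = against a∈ b′∈ (∥-mono (reverse-⊆ B) ⊆-refl B∥Q)
          apart⇒ : ∀ {u v} {C : Set} → u ≢ v × ¬ u ~ v → u ≢ v × (u ~ v → C)
          apart⇒ (ne , ¬p) = ne , ⊥-elim ∘ ¬p
          a∥Ab : [ a ] ∥ (A ++ [ b ])
          a∥Ab = chordless-apart [ a ] (cycle-arc (a ∷ a′ ∷ A ++ [ b ]) {b′ ∷ B} (λ ()) c′)
          a′A∥b′B : (a′ ∷ A) ∥ (b′ ∷ B)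
          a′A∥b′B = cycle-arcs∥ (a′ ∷ A) c
          b∥B : [ b ] ∥ B
          b∥B = chordless-apart [ b ] bb′B
          reversed : ∀ {v} → v ∈ reverse B ++ [ b′ ] → v ∈ b′ ∷ B
          reversed i = [ there ∘ reverse-⊆ B , (λ { (here e) → here e }) ]′ (∈-++⁻ (reverse B) i)
          cross₁₂ : CrossEnds (suc zero) (suc (suc zero))
          cross₁₂ (here refl) (here refl) = ≢-sym (~⇒≢ a~a′) , λ _ → inj₁ (refl , refl)
          cross₁₂ (there i)   (here refl) = apart⇒ (∥-sym a∥Ab i (here refl))
          cross₁₂ (here refl) (there j)   = apart⇒ (a′A∥b′B (here refl) (reversed j))
          cross₁₂ (there i)   (there j) with ∈-++⁻ A i | reversed j
          ... | inj₁ k           | l           = apart⇒ (a′A∥b′B (there k) l)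
          ... | inj₂ (here refl) | here refl   = ~⇒≢ b~b′ , λ _ → inj₂ (refl , refl)
          ... | inj₂ (here refl) | there l     = apart⇒ (b∥B (here refl) l)

      single-and-pair : ∀ {x₁ I₁ y₁ U x₂ I₂ y₂ W q M q′} → Apart x₁ I₁ y₁ U x₂ I₂ y₂ W q M q′ →
        ∀ F₁ {a} E₁ → x₁ ∷ I₁ ++ [ y₁ ] ≡ F₁ ++ a ∷ E₁ → q ~ a → nonadjacent q F₁ → nonadjacent q E₁ →
        ∀ F₂ {b b′} E₂ → x₂ ∷ I₂ ++ [ y₂ ] ≡ F₂ ++ b ∷ b′ ∷ E₂ → q′ ~ b → q′ ~ b′ → nonadjacent q′ F₂ → ¬ nonadjacent q′ E₂
      single-and-pair {U = U} {W = W} d F₁ {a} E₁ eq₁ q~a q≁F₁ q≁E₁ F₂ {b} {b′} E₂ eq₂ q′~b q′~b′ q′≁F₂ q′≁E₂ =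
        single-pair d (rotate-two F₁ E₁ U F₂ (b′ ∷ E₂) W
          (subst Ring (cong₂ (λ S S′ → S ++ U ++ S′ ++ W) eq₁ eq₂) (Apart.split-ring d)))
          (subst (a ∈_) (sym eq₁) (∈-++⁺ʳ F₁ (here refl)))
          (subst (b ∈_) (sym eq₂) (∈-++⁺ʳ F₂ (here refl))) (subst (b′ ∈_) (sym eq₂) (∈-++⁺ʳ F₂ (there (here refl))))
          q~a q′~b q′~b′ 
          (Apart.touches d (single F₁ E₁ eq₁ q~a q≁F₁ q≁E₁) (pair F₂ E₂ eq₂ q′~b q′~b′ q′≁F₂ q′≁E₂))

      not-narrow : ∀ {x₁ I₁ y₁ U x₂ I₂ y₂ W q M q′} → Apart x₁ I₁ y₁ U x₂ I₂ y₂ W q M q′ →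
                   Narrow q (x₁ ∷ I₁ ++ [ y₁ ]) → ¬ Narrow q′ (x₂ ∷ I₂ ++ [ y₂ ])
      not-narrow {U = U} {W = W} d ν₁@(single F₁ {a} E₁ eq₁ q~a _ _) ν₂@(single F₂ {b} E₂ eq₂ q′~b _ _) =
        single-single d (rotate-two F₁ E₁ U F₂ E₂ W
          (subst Ring (cong₂ (λ S S′ → S ++ U ++ S′ ++ W) eq₁ eq₂) (Apart.split-ring d))) q~a q′~b (Apart.touches d ν₁ ν₂)
      not-narrow d (single F₁ E₁ eq₁ q~a q≁F₁ q≁E₁) (pair F₂ E₂ eq₂ q′~b q′~b′ q′≁F₂ q′≁E₂) =
        single-and-pair d F₁ E₁ eq₁ q~a q≁F₁ q≁E₁ F₂ E₂ eq₂ q′~b q′~b′ q′≁F₂ q′≁E₂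
      not-narrow d (pair F₂ E₂ eq₂ q~b q~b′ q≁F₂ q≁E₂) (single F₁ E₁ eq₁ q′~a q′≁F₁ q′≁E₁) =
        single-and-pair (swap-apart d) F₁ E₁ eq₁ q′~a q′≁F₁ q′≁E₁ F₂ E₂ eq₂ q~b q~b′ q≁F₂ q≁E₂
      not-narrow {U = U} {W = W} d ν₁@(pair F₁ {a} {a′} E₁ eq₁ q~a q~a′ _ _) ν₂@(pair F₂ {b} {b′} E₂ eq₂ q′~b q′~b′ _ _) =
        pair-pair d (rotate-two F₁ (a′ ∷ E₁) U F₂ (b′ ∷ E₂) W
          (subst Ring (cong₂ (λ S S′ → S ++ U ++ S′ ++ W) eq₁ eq₂) (Apart.split-ring d)))
          (subst (a ∈_) (sym eq₁) (∈-++⁺ʳ F₁ (here refl))) (subst (a′ ∈_) (sym eq₁) (∈-++⁺ʳ F₁ (there (here refl))))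
          (subst (b ∈_) (sym eq₂) (∈-++⁺ʳ F₂ (here refl))) (subst (b′ ∈_) (sym eq₂) (∈-++⁺ʳ F₂ (there (here refl))))
          q~a q~a′ q′~b q′~b′ (Apart.touches d ν₁ ν₂)

      disjoint-sectors : ∀ {x₁ I₁ y₁ U x₂ I₂ y₂ W q M q′} → ¬ Apart x₁ I₁ y₁ U x₂ I₂ y₂ W q M q′
      disjoint-sectors d with narrow-or-wide (Apart.first-attached d) | narrow-or-wide (Apart.first-attached (swap-apart d))
      ... | inj₂ ω  | _       = not-wide d ω
      ... | inj₁ _  | inj₂ ω  = not-wide (swap-apart d) ω
      ... | inj₁ ν₁ | inj₁ ν₂ = not-narrow d ν₁ ν₂

      -- The hole as a cyclic sequence of sectors

      chordless-tabulate : ∀ {m} (f : Fin (suc m) → V) → (∀ {i j} → f i ≡ f j → i ≡ j) →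
                           (∀ {i j} → Consecutive i j → f i ~ f j) → (∀ {i j} → f i ~ f j → Consecutive i j) →
                           Chordless (tabulate f)
      chordless-tabulate {zero}  f inj to from = [-]
      chordless-tabulate {suc m} f inj to from = link (to (inj₁ refl)) far
        (chordless-tabulate (f ∘ suc) (Fin.suc-injective ∘ inj) (to ∘ suc⁺) (suc⁻ ∘ from))
        where
        suc⁻ : ∀ {m} {i j : Fin m} → Consecutive (suc i) (suc j) → Consecutive i j
        suc⁻ (inj₁ eq) = inj₁ (ℕ.suc-injective eq)
        suc⁻ (inj₂ eq) = inj₂ (ℕ.suc-injective eq)
        suc⁺ : ∀ {m} {i j : Fin m} → Consecutive i j → Consecutive (suc i) (suc j)
        suc⁺ (inj₁ eq) = inj₁ (cong suc eq)
        suc⁺ (inj₂ eq) = inj₂ (cong suc eq)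
        f₂ : Fin m → V
        f₂ i = f (suc (suc i))
        far : [ f zero ] ∥ tabulate f₂
        far (here refl) i∈ with ∈-tabulate⁻ {f = f₂} i∈
        ... | i , eq = (λ e → Fin.0≢1+n (inj (trans e eq))) , λ p → not-consecutive i (from (subst (f zero ~_) eq p))
          where
          not-consecutive : ∀ {m} (i : Fin m) → ¬ Consecutive zero (suc (suc i))
          not-consecutive _ (inj₁ ())
          not-consecutive _ (inj₂ ())

      hole-ring : Ring (tabulate (at (embed H)))
      hole-ring = record
        { isCycle  = record
          { shape = cong (λ P → h zero ∷ h (suc zero) ∷ P) rest
          ; inner = λ ()
          ; v~u   = Equivalence.to (_↪_.adjacent (embed H) _ _) (inj₁ (inj₁ refl))
          ; v~z   = Equivalence.to (_↪_.adjacent (embed H) _ _) (inj₂ (inj₂ (refl , refl)))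
          ; apart = far
          ; path  = subst Chordless (cong (h (suc zero) ∷_) rest) (chordless-tabulate (h ∘ suc)
                      (Fin.suc-injective ∘ _↪_.injective (embed H))
                      (λ {i} {j} → Equivalence.to (_↪_.adjacent (embed H) (suc i) (suc j)) ∘ toCycle)
                      (λ {i} {j} → fromCycle ∘ Equivalence.from (_↪_.adjacent (embed H) (suc i) (suc j))))
          }
        ; on       = λ v∈ → map₂ sym (∈-tabulate⁻ {f = h} v∈)
        ; complete = λ { (i , refl) → ∈-tabulate⁺ {f = h} i }
        }
        where
        k : ℕ
        k = Hole.extra H
        h : Fin (4 + k) → V
        h = at (embed H)
        h₂ : Fin (2 + k) → V
        h₂ i = h (suc (suc i))
        rest : tabulate h₂ ≡ tabulate (h₂ ∘ inject₁) ++ [ h₂ (fromℕ (1 + k)) ]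
        rest = tabulate-snoc h₂
        toCycle : ∀ {i j} → Consecutive i j → Adj (cycle H) (suc i) (suc j)
        toCycle (inj₁ e) = inj₁ (inj₁ (cong suc e))
        toCycle (inj₂ e) = inj₂ (inj₁ (cong suc e))
        fromCycle : ∀ {i j} → Adj (cycle H) (suc i) (suc j) → Consecutive i j
        fromCycle (inj₁ (inj₁ e)) = inj₁ (ℕ.suc-injective e)
        fromCycle (inj₂ (inj₁ e)) = inj₂ (ℕ.suc-injective e)
        fromCycle (inj₁ (inj₂ (_ , ())))
        fromCycle (inj₂ (inj₂ (_ , ())))
        not-adjacent : ∀ {i : Fin (1 + k)} → ¬ Adj (cycle H) zero (suc (suc (inject₁ i)))
        not-adjacent (inj₁ (inj₁ ()))
        not-adjacent (inj₁ (inj₂ (() , _)))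
        not-adjacent (inj₂ (inj₁ ()))
        not-adjacent (inj₂ (inj₂ (e , _))) = Fin.fromℕ≢inject₁ (sym (Fin.suc-injective (Fin.suc-injective e)))
        far : [ h zero ] ∥ tabulate (h₂ ∘ inject₁)
        far (here refl) i∈ with ∈-tabulate⁻ {f = h₂ ∘ inject₁} i∈
        ... | i , eq = (λ e → Fin.0≢1+n (_↪_.injective (embed H) (trans e eq))) ,
                       λ p → not-adjacent (Equivalence.from (_↪_.adjacent (embed H) _ _) (subst (h zero ~_) eq p))

      -- A bead (x , I) is a neighbour x of w together with the stretch I of H up to the next neighbour of w.
      Bead : Set
      Bead = V × List V

      flat : List Bead → List V
      flat []            = []
      flat ((x , I) ∷ N) = x ∷ I ++ flat N

      flat-++ : ∀ X Y → flat (X ++ Y) ≡ flat X ++ flat Y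
      flat-++ []            Y = refl
      flat-++ ((x , I) ∷ X) Y = cong (x ∷_) (trans (cong (I ++_) (flat-++ X Y)) (sym (++-assoc I (flat X) (flat Y))))

      Beaded : List Bead → Set
      Beaded N = ∀ {x I} → (x , I) ∈ N → w ~ x × nonadjacent w I

      parse : ∀ L → ∃[ I ] ∃[ N ] L ≡ I ++ flat N × nonadjacent w I × Beaded N
      parse [] = [] , [] , refl , (λ ()) , λ ()
      parse (v ∷ L) with w ~? v | parse L
      ... | yes p | I , N , refl , w≁I , b = [] , (v , I) ∷ N , refl , (λ ()) , λ { (here refl) → p , w≁I ; (there i) → b i }
      ... | no ¬p | I , N , refl , w≁I , b = v ∷ I , N , refl , (λ { (here refl) → ¬p ; (there i) → w≁I i }) , b

      -- `bead` records that the sequence is nonempty: a sector must be named even for a walk that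
      -- touches nothing.
      record Necklace : Set where
        field
          beads  : List Bead
          ring   : Ring (flat beads)
          beaded : Beaded beads
          bead   : Bead
          bead∈  : bead ∈ beads

      -- Majority gives `w` a neighbour on `H`; starting there leaves no stretch before the first
      -- bead.
      necklace : Necklace
      necklace with any? (w ~?_) (tabulate (at (embed H)))
      ... | no ¬a = ⊥-elim (spread-two hole-ring (λ i p → ¬a (lose (there (there i)) p)))
      ... | yes a with first-split (w ~?_) a
      ...   | A , x , B , eq , w~x , _ with parse (B ++ A)
      ...     | I , N , eq′ , w≁I , b = record
        { beads  = (x , I) ∷ N
        ; ring   = subst (Ring ∘ (x ∷_)) eq′ (ring-rotate A (subst Ring eq hole-ring))
        ; beaded = λ { (here refl) → w~x , w≁I ; (there i) → b i }
        ; bead   = x , I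
        ; bead∈  = here refl
        }

      module _ (κ : Necklace) where

        open Necklace κ

        starts : List Bead → List V
        starts []            = []
        starts ((y , _) ∷ _) = [ y ]

        -- The second argument is the necklace after the bead, continued cyclically, so its first
        -- bead starts at the far end of the sector.
        sector : Bead → List Bead → List V
        sector (x , I) N = x ∷ I ++ starts N

        bead-ring : ∀ X {Y} → beads ≡ X ++ Y → Ring (flat (Y ++ X))
        bead-ring X {Y} eq = subst Ring (sym (flat-++ Y X)) (ring-rotate (flat X)
          (subst Ring (trans (cong flat eq) (flat-++ X Y)) ring))

        beads-∈ : ∀ X {Y} → beads ≡ X ++ Y → Y ++ X ⊆ beads
        beads-∈ X {Y} eq i = subst (_ ∈_) (sym eq) (++-swap-⊆ Y i)

        sector-ring : ∀ {x I y J N} → Ring (flat ((x , I) ∷ (y , J) ∷ N)) → ((x , I) ∷ (y , J) ∷ N) ⊆ beads →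
                      SectorRing x I y (J ++ flat N)
        sector-ring r ⊆beads = record
          { ring = r
          ; w~x = proj₁ (beaded (⊆beads (here refl)))
          ; w~y = proj₁ (beaded (⊆beads (there (here refl))))
          ; w≁I = proj₂ (beaded (⊆beads (here refl))) }

        not-alone : ∀ {x I} → Ring (x ∷ I ++ []) → ¬ nonadjacent w I
        not-alone {I = []} r _ with Ring.isCycle r
        ... | record { shape = () }
        not-alone {x} {I = i ∷ I} r w≁ = spread-two (subst (Ring ∘ (x ∷_)) (++-identityʳ (i ∷ I)) r) (w≁ ∘ there)

        sector-at : ∀ X {x I Y} → beads ≡ X ++ (x , I) ∷ Y →
                    ∃[ y ] ∃[ J ] ∃[ N ] Y ++ X ≡ (y , J) ∷ N × SectorRing x I y (J ++ flat N)
        sector-at X {x} {I} {Y} eq = go (Y ++ X) (bead-ring X eq) (beads-∈ X eq)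
          where
          go : ∀ N → Ring (flat ((x , I) ∷ N)) → ((x , I) ∷ N) ⊆ beads →
               ∃[ y ] ∃[ J ] ∃[ N′ ] N ≡ (y , J) ∷ N′ × SectorRing x I y (J ++ flat N′)
          go []            r ⊆beads = ⊥-elim (not-alone r (proj₂ (beaded (⊆beads (here refl)))))
          go ((y , J) ∷ N) r ⊆beads = y , J , N , refl , sector-ring r ⊆beads

        -- Each split of the list of beads names a sector, `Y ++ X` being the beads that follow in
        -- cyclic order. The property is decidable, which justifies arguing from a walk that does
        -- not fit.
        Fits : List V → Set
        Fits Q = ∃[ X ] ∃[ p ] ∃[ Y ] beads ≡ X ++ p ∷ Y × FitsIn Q (sector p (Y ++ X))

        touch? : ∀ Q h → Dec (Touch Q h)
        touch? Q h = any? (λ q → (h ≟ q) ⊎-dec (q ~? h)) Q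

        fitsIn? : ∀ Q S → Dec (FitsIn Q S)
        fitsIn? Q S with Fin.all? (λ i → touch? Q (at (embed H) i) →-dec (at (embed H) i ∈? S))
        ... | yes f = yes λ { (i , refl) t → f i t }
        ... | no ¬f = no λ f → ¬f (λ i t → f (i , refl) t)

        fits? : ∀ Q → Dec (Fits Q)
        fits? Q = split? (λ X p Y → fitsIn? Q (sector p (Y ++ X))) beads

        locate : ∀ {v} N → v ∈ flat N → ∃[ X ] ∃[ x ] ∃[ I ] ∃[ Y ] N ≡ X ++ (x , I) ∷ Y × v ∈ x ∷ I
        locate ((x , I) ∷ N) v∈ with ∈-++⁻ (x ∷ I) v∈
        ... | inj₁ i = [] , x , I , N , refl , i
        ... | inj₂ i with locate N i
        ...   | X , x′ , I′ , Y , refl , j = (x , I) ∷ X , x′ , I′ , Y , refl , j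

        predecessor : ∀ X {p Y} → beads ≡ X ++ p ∷ Y → Y ++ X ≢ [] →
                      ∃[ X′ ] ∃[ u ] ∃[ Y′ ] ∃[ Z ] beads ≡ X′ ++ u ∷ Y′ × Y′ ++ X′ ≡ p ∷ Z × Y ++ X ≡ Z ++ [ u ]
        predecessor [] {p} {[]} eq ne = ⊥-elim (ne refl)
        predecessor [] {p} {y ∷ Y} eq ne with snoc-view y Y
        ... | Z , u , Y≡ = p ∷ Z , u , [] , Z , trans eq (cong (p ∷_) Y≡) , refl , trans (++-identityʳ (y ∷ Y)) Y≡
        predecessor (x ∷ X) {p} {Y} eq ne with snoc-view x X
        ... | X′ , u , X≡ = X′ , u , p ∷ Y , Y ++ X′ ,
          trans eq (trans (cong (_++ p ∷ Y) X≡) (++-assoc X′ [ u ] (p ∷ Y))) , refl ,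
          trans (cong (Y ++_) X≡) (sym (++-assoc Y X′ [ u ]))

        -- Of the vertices in `x ∷ I`, only `x` has a neighbour on `H` outside the sector, namely
        -- the vertex before it, and both lie in the previous sector. `no-edge` rests on this.
        edge-in-sector : ∀ {a b} → a On embed H → b On embed H → a ~ b →
                         ∃[ X ] ∃[ p ] ∃[ Y ] beads ≡ X ++ p ∷ Y × a ∈ sector p (Y ++ X) × b ∈ sector p (Y ++ X)
        edge-in-sector {a} {b} a-on b-on a~b with locate beads (Ring.complete ring a-on)
        ... | X , x , I , Y , eq , a∈ with sector-at X eq
        ...   | y , J , N , YX≡ , s = go (∈-++⁻ (x ∷ I ++ [ y ]) (subst (b ∈_) (cong (x ∷_) (sym (++-assoc I [ y ] _))) (complete b-on)))
          where
          open SectorRing s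
          in-sector : ∀ {v} → v ∈ x ∷ I ++ [ y ] → v ∈ sector (x , I) (Y ++ X)
          in-sector i = subst (λ N → _ ∈ x ∷ I ++ starts N) (sym YX≡) i
          go : b ∈ x ∷ I ++ [ y ] ⊎ b ∈ J ++ flat N →
               ∃[ X ] ∃[ p ] ∃[ Y ] beads ≡ X ++ p ∷ Y × a ∈ sector p (Y ++ X) × b ∈ sector p (Y ++ X)
          go (inj₁ i) = X , (x , I) , Y , eq , in-sector (∈-++⁺ˡ a∈) , in-sector i
          go (inj₂ i) = previous a∈ (outside-meets s)
            where
            previous : a ∈ x ∷ I → Outside (J ++ flat N) →
               ∃[ X ] ∃[ p ] ∃[ Y ] beads ≡ X ++ p ∷ Y × a ∈ sector p (Y ++ X) × b ∈ sector p (Y ++ X)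
            previous (there a∈I) _ = ⊥-elim (proj₂ (cycle-arcs∥ I isCycle a∈I i) a~b)
            previous (here refl) (outside {r₁} {rₘ} {R°} R≡ _) with outer-split s R≡ i
            ... | inj₁ refl = ⊥-elim (proj₂ (cycle-apart (I ++ [ y ]) (snoc≢[] I) (snoc≢[] R°)
                                (subst (Cycle ∘ (x ∷_)) (trans (cong (λ R → I ++ y ∷ R) R≡) (sym (++-assoc I [ y ] _))) isCycle)) a~b)
            ... | inj₂ (inj₁ b∈R°) = ⊥-elim (proj₂ (sector∥inner s R≡ (here refl) b∈R°) a~b)
            ... | inj₂ (inj₂ refl) with predecessor X eq (λ e → cons≢[] (trans (sym YX≡) e))
              where
              cons≢[] : (y , J) ∷ N ≢ []
              cons≢[] ()
            ...   | X′ , (u , K) , Y′ , Z , eq′ , Y′X′≡ , YX≡′ =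
              X′ , (u , K) , Y′ , eq′ ,
              subst (λ N → x ∈ u ∷ K ++ starts N) (sym Y′X′≡) (there (∈-++⁺ʳ K (here refl))) ,
              ∈-++⁺ˡ (subst (b ∈_) (cong (u ∷_) (++-identityʳ K)) (snoc-⊆-suffix (y ∷ r₁ ∷ R°) (flat Z)
                (trans (cong (y ∷_) (sym R≡)) (trans (cong flat (trans (sym YX≡) YX≡′)) (flat-++ Z [ (u , K) ])))))

        -- Every walk outside `N[w]` fits in a sector

        module _ {Q : List V} (¬fits : ¬ Fits Q) where

          not-on-edge : ∀ {a b} → a On embed H → b On embed H → a ~ b → ¬ FitsIn Q (a ∷ [ b ])
          not-on-edge a-on b-on a~b f with edge-in-sector a-on b-on a~b
          ... | X , p , Y , eq , a∈ , b∈ = ¬fits (X , p , Y , eq , λ on t →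
            both (f on t) a∈ b∈)
            where
            both : ∀ {a b h S} → h ∈ a ∷ [ b ] → a ∈ S → b ∈ S → h ∈ S
            both (here refl)         a∈ _  = a∈
            both (there (here refl)) _  b∈ = b∈

        fits-[] : Fits []
        fits-[] with ∈-∃++ bead∈
        ... | X , Y , eq = X , bead , Y , eq , λ _ ()

        -- If `q` is on `H`, it is interior to a sector, which then contains its neighbours on `H`
        -- too. If `q` is off `H` and sees a vertex of `H` that `w` misses, `interior-fits` applies.
        -- If all neighbours of `q` on `H` are neighbours of `w`, two nonadjacent ones would form a
        -- square with `w` and `q`; so they form a clique of `H`, which is at most an edge and lies
        -- in a sector.
        single-fits : ∀ {q} → Off [ q ] → Fits [ q ]
        single-fits {q} off = decidable-stable (fits? [ q ]) (λ ¬fits → go ¬fits (Fin.any? (λ i → at (embed H) i ≟ q)))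
          where
          w≢q : w ≢ q
          w≢q e = proj₁ off (here e)
          w≁q : ¬ w ~ q
          w≁q = proj₂ off (here refl)
          fit-at : ∀ X {x I Y} (eq : beads ≡ X ++ (x , I) ∷ Y) → ¬ Fits [ q ] → ¬ (∀ {y R} → SectorRing x I y R → FitsIn [ q ] (x ∷ I ++ [ y ]))
          fit-at X {x} {I} {Y} eq ¬fits f with sector-at X eq
          ... | y , J , N , YX≡ , s = ¬fits (X , (x , I) , Y , eq , subst (λ N → FitsIn [ q ] (x ∷ I ++ starts N)) (sym YX≡) (f s))
          go : ¬ Fits [ q ] → Dec (∃[ i ] at (embed H) i ≡ q) → ⊥
          go ¬fits (yes q-on) with locate beads (Ring.complete ring q-on)
          ... | X , x , I , Y , eq , here refl = w≁q (proj₁ (beaded (subst (_ ∈_) (sym eq) (∈-++⁺ʳ X (here refl)))))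
          ... | X , x , I , Y , eq , there q∈I = fit-at X eq ¬fits closed
            where
            closed : ∀ {y R} → SectorRing x I y R → FitsIn [ q ] (x ∷ I ++ [ y ])
            closed s on (here (inj₁ refl)) = there (∈-++⁺ˡ q∈I)
            closed {y} {R} s {h} on (here (inj₂ p)) with ∈-++⁻ (x ∷ I ++ [ y ]) (subst (h ∈_) (cong (x ∷_) (sym (++-assoc I [ y ] R))) (SectorRing.complete s on))
            ... | inj₁ i = i
            ... | inj₂ i = ⊥-elim (proj₂ (cycle-arcs∥ I (SectorRing.isCycle s) q∈I i) p)
          go ¬fits (no q∉H) with any? (λ v → (q ~? v) ×-dec ¬? (w ~? v)) (flat beads)
          ... | yes a with find a
          ...   | v , v∈ , q~v , w≁v with locate beads v∈
          ...     | X , x , I , Y , eq , here refl = w≁v (proj₁ (beaded (subst (_ ∈_) (sym eq) (∈-++⁺ʳ X (here refl)))))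
          ...     | X , x , I , Y , eq , there v∈I = fit-at X eq ¬fits fit
            where
            fit : ∀ {y R} → SectorRing x I y R → FitsIn [ q ] (x ∷ I ++ [ y ])
            fit s on (here (inj₁ refl)) = ⊥-elim (q∉H on)
            fit {y} {R} s {h} on (here (inj₂ p)) with ∈-++⁻ (x ∷ I ++ [ y ]) (subst (h ∈_) (cong (x ∷_) (sym (++-assoc I [ y ] R))) (SectorRing.complete s on))
            ... | inj₁ i = i
            ... | inj₂ i = ⊥-elim (interior-fits w≢q w≁q q∉H s v∈I q~v i p)
          go ¬fits (no q∉H) | no ¬a with any? (q ~?_) (flat beads)
          ... | no ¬nb with ∈-∃++ bead∈
          ...   | X , Y , eq = ¬fits (X , bead , Y , eq , none)
            where
            none : FitsIn [ q ] _
            none on (here (inj₁ refl)) = ⊥-elim (q∉H on)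
            none on (here (inj₂ p))    = ⊥-elim (¬nb (lose (Ring.complete ring on) p))
          go ¬fits (no q∉H) | no ¬a | yes nb with find nb
          ... | a , a∈ , q~a with locate beads a∈
          ...   | X , x , I , Y , eq , a∈xI = fit-at X eq ¬fits fit
            where
            common : ∀ {h} → h On embed H → q ~ h → w ~ h
            common {h} on p = decidable-stable (w ~? h) (λ ¬p → ¬a (lose (Ring.complete ring on) (p , ¬p)))
            adjacent : ∀ {u v} → u On embed H → v On embed H → q ~ u → q ~ v → u ≢ v → u ~ v
            adjacent {u} {v} u-on v-on q~u q~v u≢v = decidable-stable (u ~? v) (λ u≁v → no-square square-free
              (~-sym q~u) q~v (~-sym (common v-on q~v)) (common u-on q~u) u≢v u≁v (≢-sym w≢q) (≁-sym w≁q))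
            a-on : a On embed H
            a-on = Ring.on ring a∈
            fit : ∀ {y R} → SectorRing x I y R → FitsIn [ q ] (x ∷ I ++ [ y ])
            fit s on (here (inj₁ refl)) = ⊥-elim (q∉H on)
            fit {y} s {b} b-on (here (inj₂ q~b)) with a ≟ b
            ... | yes refl = ∈-++⁺ˡ a∈xI
            ... | no a≢b = ⊥-elim (not-on-edge ¬fits a-on b-on a~b edge)
              where
              a~b : a ~ b
              a~b = adjacent a-on b-on q~a q~b a≢b
              edge : FitsIn [ q ] (a ∷ [ b ])
              edge on (here (inj₁ refl)) = ⊥-elim (q∉H on)
              edge {c} on (here (inj₂ q~c)) with a ≟ c | b ≟ c
              ... | yes refl | _        = here refl
              ... | no _     | yes refl = there (here refl)
              ... | no a≢c   | no b≢c   = ⊥-elim (cycle-no-triangle (Ring.isCycle ring) a∈ (Ring.complete ring b-on)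
                (Ring.complete ring on) a~b (adjacent a-on on q~a q~c a≢c) (adjacent b-on on q~b q~c b≢c))

        flat-rotate : ∀ A {B} → Ring (flat (A ++ B)) → Ring (flat (B ++ A))
        flat-rotate A {B} r = subst Ring (sym (flat-++ B A)) (ring-rotate (flat A) (subst Ring (flat-++ A B) r))

        adjacent-beads : ∀ {p p′ z Z q M q′} → Ring (flat (p ∷ p′ ∷ z ∷ Z)) → (p ∷ p′ ∷ z ∷ Z) ⊆ beads →
                         ¬ Straddling q M q′ (sector p (p′ ∷ z ∷ Z)) (sector p′ (z ∷ Z ++ [ p ]))
        adjacent-beads r ⊆beads = consecutive-sectors (sector-ring r ⊆beads) (proj₂ (beaded (⊆beads (there (here refl)))))

        -- Two beads mean that `w` has just two neighbours on `H`, against `outside-meets`.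
        two-beads : ∀ {p p′} → Ring (flat (p ∷ [ p′ ])) → ¬ (p ∷ [ p′ ]) ⊆ beads
        two-beads {p′ = y , J} r ⊆beads with outside-meets (sector-ring r ⊆beads)
        ... | outside {R° = R°} R≡ meets with find meets
        ...   | t , t∈ , w~t = proj₂ (beaded (⊆beads (there (here refl))))
          (subst (t ∈_) (trans (sym R≡) (++-identityʳ J)) (there (∈-++⁺ˡ t∈))) w~t

        -- Beads that are neighbours in cyclic order have sectors with a common end; if `p` follows
        -- `p′`, the walk is reversed to reach the case where `p′` follows `p`.
        no-straddling : ∀ p Z p′ Z′ {q M q′} → Ring (flat (p ∷ Z ++ p′ ∷ Z′)) → (p ∷ Z ++ p′ ∷ Z′) ⊆ beads →
                        (∀ {a b} → a On embed H → b On embed H → a ~ b → ¬ FitsIn (q ∷ M ++ [ q′ ]) (a ∷ [ b ])) →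
                        ¬ Straddling q M q′ (sector p (Z ++ p′ ∷ Z′)) (sector p′ (Z′ ++ p ∷ Z))
        no-straddling p []      p′ []       r ⊆beads no-edge st = two-beads r ⊆beads
        no-straddling p []      p′ (_ ∷ _)  r ⊆beads no-edge st = adjacent-beads r ⊆beads st
        no-straddling p (z ∷ Z) p′ []       r ⊆beads no-edge st =
          adjacent-beads (flat-rotate (p ∷ z ∷ Z) r) (⊆beads ∘ ++-swap-⊆ [ p′ ]) (straddling-reverse st)
        no-straddling (x₁ , I₁) ((y₁ , K₁) ∷ Z) (x₂ , I₂) ((y₂ , K₂) ∷ Z′) r ⊆beads no-edge st = disjoint-sectors record
          { sector     = subst (SectorRing x₁ I₁ y₁)
                           (trans (cong (K₁ ++_) (flat-++ Z _)) (sym (++-assoc K₁ (flat Z) _))) (sector-ring r ⊆beads)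
          ; w~x₂       = proj₁ (beaded p′∈)
          ; w~y₂       = proj₁ (beaded (⊆beads (there (there (∈-++⁺ʳ Z (there (here refl)))))))
          ; w≁I₂       = proj₂ (beaded p′∈)
          ; straddling = st
          ; no-edge    = no-edge
          }
          where
          p′∈ : (x₂ , I₂) ∈ beads
          p′∈ = ⊆beads (there (there (∈-++⁺ʳ Z (here refl))))

        -- If both splits are at the same bead, its sector contains all that the walk touches.
        -- Otherwise the walk straddles two sectors, and the necklace is read from `p` on, whether
        -- `p′` comes after or before it in the list.
        both-parts-fit : ∀ {q M q′} → Linked _~_ (q ∷ M ++ [ q′ ]) → Off (q ∷ M ++ [ q′ ]) →
                         Fits (q ∷ M) → Fits (M ++ [ q′ ]) → Fits (q ∷ M ++ [ q′ ])
        both-parts-fit {q} {M} {q′} walk off (X , p , Y , eq , f) (X′ , p′ , Y′ , eq′ , f′) =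
          decidable-stable (fits? (q ∷ M ++ [ q′ ])) (λ ¬fits → go ¬fits (compare-splits X X′ (trans (sym eq) eq′)))
          where
          go : ¬ Fits (q ∷ M ++ [ q′ ]) →
               (X ≡ X′ × p ≡ p′ × Y ≡ Y′) ⊎ (∃[ Z ] X′ ≡ X ++ p ∷ Z × Y ≡ Z ++ p′ ∷ Y′) ⊎ (∃[ Z ] X ≡ X′ ++ p′ ∷ Z × Y′ ≡ Z ++ p ∷ Y) → ⊥
          straddle : ¬ Fits (q ∷ M ++ [ q′ ]) → Straddling q M q′ (sector p (Y ++ X)) (sector p′ (Y′ ++ X′))
          straddle ¬fits = record
            { walk = walk ; off = off ; fit₁ = f ; fit₂ = f′
            ; not₁ = λ g → ¬fits (X , p , Y , eq , g) ; not₂ = λ g → ¬fits (X′ , p′ , Y′ , eq′ , g) }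
          go ¬fits (inj₁ (refl , refl , refl)) = ¬fits (X , p , Y , eq , λ on → λ { (here t) → f on (here t) ; (there t) → f′ on t })
          go ¬fits (inj₂ (inj₁ (Z , refl , refl))) = no-straddling p Z p′ (Y′ ++ X)
            (subst (Ring ∘ flat ∘ (p ∷_)) (++-assoc Z (p′ ∷ Y′) X) (bead-ring X eq))
            (subst (λ N → (p ∷ N) ⊆ beads) (++-assoc Z (p′ ∷ Y′) X) (beads-∈ X eq))
            (not-on-edge ¬fits)
            (subst₂ (λ N N′ → Straddling q M q′ (sector p N) (sector p′ N′)) (++-assoc Z (p′ ∷ Y′) X) (sym (++-assoc Y′ X (p ∷ Z)))
              (straddle ¬fits))
          go ¬fits (inj₂ (inj₂ (Z , refl , refl))) = no-straddling p (Y ++ X′) p′ Z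
            (subst (Ring ∘ flat ∘ (p ∷_)) (sym (++-assoc Y X′ (p′ ∷ Z))) (bead-ring X eq))
            (subst (λ N → (p ∷ N) ⊆ beads) (sym (++-assoc Y X′ (p′ ∷ Z))) (beads-∈ X eq))
            (not-on-edge ¬fits)
            (subst₂ (λ N N′ → Straddling q M q′ (sector p N) (sector p′ N′)) (sym (++-assoc Y X′ (p′ ∷ Z))) (++-assoc Z (p ∷ Y) X′)
              (straddle ¬fits))

        -- The induction removes either end of the walk, and dropping the last entry yields no
        -- subterm of the list; hence the bound `k`.
        fits : ∀ k Q → length Q ≤ k → Linked _~_ Q → Off Q → Fits Q
        fits _ [] _ _ _ = fits-[]
        fits _ (q ∷ []) _ _ off = single-fits off
        fits (suc k) (q ∷ m ∷ Q) (s≤s le) walk off with snoc-view m Q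
        ... | M , q′ , eq = subst (Fits ∘ (q ∷_)) (sym eq) (both-parts-fit walk′ off′
          (fits k (q ∷ M) (ℕ.≤-trans (ℕ.≤-reflexive (sym (trans (length-++ M) (ℕ.+-comm (length M) 1)))) le′)
            (linked-++⁻ˡ (q ∷ M) walk′) (off-⊆ (∷⁺ʳ q ∈-++⁺ˡ) off′))
          (fits k (M ++ [ q′ ]) le′ (Linked.tail walk′) (off-⊆ there off′)))
          where
          le′ : length (M ++ [ q′ ]) ≤ k
          le′ = subst (λ L → length L ≤ k) eq le
          walk′ : Linked _~_ (q ∷ M ++ [ q′ ])
          walk′ = subst (Linked _~_ ∘ (q ∷_)) eq walk
          off′ : Off (q ∷ M ++ [ q′ ])
          off′ = subst (Off ∘ (q ∷_)) eq off

        -- From walks to components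

        ∉closedNbhd⇒off : ∀ {Q} → (∀ {v} → v ∈ Q → ¬ closedNbhd G w v) → Off Q
        ∉closedNbhd⇒off f = (λ w∈ → f w∈ (inj₁ refl)) , λ v∈ p → f v∈ (inj₂ p)

        toSector : ∀ {x I y R} → SectorRing x I y R → Σ[ P ∈ Sector H w ] Sector.x P ≡ x × Sector.y P ≡ y
        toSector {x} {I} {y} s with outside-meets s
        ... | outside R≡ _ = record
          { len≥1    = 1≤length I y
          ; path     = proj₁ lifted
          ; x-adj    = subst (w ~_) (sym x≡) (SectorRing.w~x s)
          ; y-adj    = subst (w ~_) (sym y≡) (SectorRing.w~y s)
          ; interior = λ i ¬end → [ ⊥-elim ∘ ¬end , (λ i∈ → SectorRing.w≁I s i∈ ∘ subst (w ~_) (proj₂ lifted i)) ]′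
                                    (isEnd-or-inner x I y i)
          } , x≡ , y≡
          where
          chordless : Chordless (x ∷ I ++ [ y ])
          chordless = sector-path (R≢[] s R≡) s
          sector⊆ : x ∷ I ++ [ y ] ⊆ x ∷ I ++ y ∷ _
          sector⊆ = ∷⁺ʳ x (++⁺ {ws = I} ⊆-refl ∈-++⁺ˡ)
          lifted : Σ[ P ∈ Path (cycle H) (length (I ++ [ y ])) ] (∀ i → at (embed H) (at P i) ≡ lookup (x ∷ I ++ [ y ]) i)
          lifted = factor (embed H) (toPath chordless) (λ i → SectorRing.on s (sector⊆ (∈-lookup i)))
          x≡ : at (embed H) (at (proj₁ lifted) zero) ≡ x
          x≡ = proj₂ lifted zero
          y≡ : at (embed H) (at (proj₁ lifted) (fromℕ (length (I ++ [ y ])))) ≡ y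
          y≡ = trans (proj₂ lifted (fromℕ (length (I ++ [ y ])))) (lookup-last x I y)

        module _ (C : Subset n) {v₀ : V} (v₀∉ : ¬ closedNbhd G w v₀)
                 (component : ∀ u → u Subset.∈ C ⇔ Star (λ s t → ¬ closedNbhd G w s × ¬ closedNbhd G w t × Adj G s t) v₀ u) where

          private
            Step : V → V → Set
            Step s t = ¬ closedNbhd G w s × ¬ closedNbhd G w t × Adj G s t

          WalkOutside : V → List V → Set
          WalkOutside s L = Linked _~_ (s ∷ L) × (∀ {v} → v ∈ s ∷ L → ¬ closedNbhd G w v)

          -- A detour to `u` and back is inserted at the start, so the new walk begins at `s` again
          -- and contains the old one.
          extend : ∀ {s u L} → Star Step s u → WalkOutside s L → ∃[ L′ ] WalkOutside s L′ × (s ∷ L) ⊆ (s ∷ L′) × u ∈ s ∷ L′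
          extend {L = L} ε W = L , W , ⊆-refl , here refl
          extend ((s∉ , t∉ , s~t) ◅ rest) (l , f) with extend rest (~-sym s~t ∷ l , λ { (here refl) → t∉ ; (there i) → f i })
          ... | L′ , (l′ , f′) , ⊆L′ , u∈ = _ ∷ L′ , (s~t ∷ l′ , λ { (here refl) → s∉ ; (there i) → f′ i }) , there ∘ ⊆L′ ∘ there , there u∈

          -- A single walk through all of `C` makes `fits` yield one sector for the whole component.
          cover : ∀ us → (∀ {u} → u ∈ us → u Subset.∈ C) → ∃[ L ] WalkOutside v₀ L × us ⊆ v₀ ∷ L
          cover [] _ = [] , ([-] , λ { (here refl) → v₀∉ }) , λ ()
          cover (u ∷ us) ⊆C with cover us (⊆C ∘ there)
          ... | L , W , us⊆ with extend (Equivalence.to (component u) (⊆C (here refl))) W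
          ...   | L′ , W′ , ⊆L′ , u∈ = L′ , W′ , λ { (here refl) → u∈ ; (there i) → ⊆L′ (us⊆ i) }

          in-component⇒∉ : ∀ {c} → c Subset.∈ C → ¬ closedNbhd G w c
          in-component⇒∉ {c} c∈ with cover [ c ] (λ { (here refl) → c∈ })
          ... | L , (_ , f) , ⊆L = f (⊆L (here refl))

          -- A vertex outside `N[w]` with a neighbour in `C` is reachable and belongs to `C`; and
          -- `w` itself has no neighbour in `C`.
          boundary-⊆-N : ∀ {v} → nbhd G C v → w ~ v
          boundary-⊆-N {v} (v∉C , c , c∈ , v~c) with v ≟ w
          ... | yes refl = ⊥-elim (in-component⇒∉ c∈ (inj₂ v~c))
          ... | no v≢w = decidable-stable (w ~? v) (λ w≁v → v∉C (Equivalence.from (component v)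
            (Equivalence.to (component c) c∈ ◅◅ (in-component⇒∉ c∈ , [ v≢w , w≁v ]′ , ~-sym v~c) ◅ ε)))

          covering-walk : ∃[ L ] WalkOutside v₀ L × (∀ {c} → c Subset.∈ C → c ∈ v₀ ∷ L)
          covering-walk with cover (filter (Subset._∈? C) (allFin n)) (proj₂ ∘ ∈-filter⁻ (Subset._∈? C) {xs = allFin n})
          ... | L , W , ⊆L = L , W , λ c∈ → ⊆L (∈-filter⁺ (Subset._∈? C) {xs = allFin n} (∈-allFin _) c∈)

          boundary-in-sector : Σ[ P ∈ Sector H w ] (∀ v → nbhd G C v →
                               (v ≡ Sector.x P ⊎ v ≡ Sector.y P) ⊎ (Adj G w v × ¬ (v On embed H)))
          boundary-in-sector with covering-walk
          ... | L , (walk , outside-N[w]) , C⊆ with fits (length (v₀ ∷ L)) (v₀ ∷ L) ℕ.≤-refl walk (∉closedNbhd⇒off outside-N[w])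
          ...   | X , (x , I) , Y , eq , fit with sector-at X eq
          ...     | y , J , N , YX≡ , s with toSector s
          ...       | P , x≡ , y≡ = P , λ v v∈N → split v v∈N (Fin.any? (λ i → at (embed H) i ≟ v))
            where
            split : ∀ v → nbhd G C v → Dec (v On embed H) → (v ≡ Sector.x P ⊎ v ≡ Sector.y P) ⊎ (Adj G w v × ¬ (v On embed H))
            split v v∈N (no ¬on) = inj₂ (boundary-⊆-N v∈N , ¬on)
            -- A vertex of `N(C)` on `H` is touched by the walk, hence lies in the sector; being
            -- adjacent to `w`, it is not interior.
            split v v∈N@(_ , c , c∈ , v~c) (yes v-on) with subst (λ N → v ∈ x ∷ I ++ starts N) YX≡ (fit v-on (lose (C⊆ c∈) (inj₂ (~-sym v~c))))
            ... | here refl = inj₁ (inj₁ (sym x≡))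
            ... | there i with ∈-++⁻ I i
            ...   | inj₁ v∈I         = ⊥-elim (SectorRing.w≁I s v∈I (boundary-⊆-N v∈N))
            ...   | inj₂ (here refl) = inj₁ (inj₂ (sym y≡))

theorem2p4 : ∀ {n : ℕ} (G : Graph n) → 𝒞 G →
    (H : Hole G) (w : Fin n) → Major H w →
    (C : Subset n) → (IsComponentOf G ∖ closedNbhd G w) C →
    Σ[ P ∈ Sector H w ]
    (∀ v → nbhd G C v →
    (v ≡ Sector.x P ⊎ v ≡ Sector.y P) ⊎ (Adj G w v × ¬ (v On embed H)))
theorem2p4 G G∈𝒞 H w major C (_ , v₀∉ , component) = boundary-in-sector G G∈𝒞 H w major (necklace G G∈𝒞 H w major) C v₀∉ component
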